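{- Let $G$ be a simple 2-connected graph of order $n\ge 13$. If $G$ is $\{K_{1,3}, P_6\}$-free, then $G$ is chorded pancyclic.
   Context: $G$ is $\{H_1,\dots,H_r\}$-free if $G$ contains no induced subgraph isomorphic to any $H_i$. $K_{1,3}$ is the claw and $P_t$ denotes the path on $t$ vertices. A chorded cycle is a cycle $C$ such that $G$ has an edge joining two vertices nonconsecutive on $C$. A graph $G$ of order $n$ is chorded pancyclic if it contains a chorded cycle of every length $m$ with $4\le m\le n$. -}

module Defs where

open import Data.Nat using (ℕ; zero; suc; _≤_; _<_)
open import Data.Fin using (Fin; toℕ)
open import Data.Bool using (Bool; true; false)
open import Data.List using (List; []; _∷_)
open import Data.Product using (Σ; _×_; _,_; ∃; ∃-syntax)
open import Data.Sum using (_⊎_)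
open import Relation.Nullary using (¬_)
open import Relation.Binary.PropositionalEquality using (_≡_; _≢_)
open import Function.Definitions using (Injective)

record Graph (n : ℕ) : Set where
  field
    adj   : Fin n → Fin n → Bool
    sym   : ∀ u v → adj u v ≡ adj v u
    irrefl : ∀ v → adj v v ≡ false

open Graph public

Adj : ∀ {n} → Graph n → Fin n → Fin n → Set
Adj G u v = adj G u v ≡ true

InducedSub : ∀ {k n} → Graph k → Graph n → Set
InducedSub {k} {n} H G =
  Σ (Fin k → Fin n) λ f → Injective _≡_ _≡_ f × (∀ i j → adj H i j ≡ adj G (f i) (f j))

Free : ∀ {k n} → Graph k → Graph n → Set
Free H G = ¬ InducedSub H G

data Walk {n} (G : Graph n) (P : Fin n → Set) : Fin n → Fin n → Set where
  here : ∀ {u} → P u → Walk G P u u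
  step : ∀ {u v w} → P u → Adj G u v → Walk G P v w → Walk G P u w

ConnectedOn : ∀ {n} → Graph n → (Fin n → Set) → Set
ConnectedOn {n} G P = ∀ u w → P u → P w → Walk G P u w

TwoConnected : ∀ {n} → Graph n → Set
TwoConnected {n} G =
  3 ≤ n × ConnectedOn G (λ _ → Data.Unit.⊤) × (∀ v → ConnectedOn G (λ x → x ≢ v))
  where import Data.Unit

claw : Graph 4
claw = record { adj = a ; sym = s ; irrefl = r }
  where
  a : Fin 4 → Fin 4 → Bool
  a Fin.zero Fin.zero = false
  a Fin.zero (Fin.suc _) = true
  a (Fin.suc _) Fin.zero = true
  a (Fin.suc _) (Fin.suc _) = false
  s : ∀ u v → a u v ≡ a v u
  s Fin.zero Fin.zero = Relation.Binary.PropositionalEquality.refl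
  s Fin.zero (Fin.suc _) = Relation.Binary.PropositionalEquality.refl
  s (Fin.suc _) Fin.zero = Relation.Binary.PropositionalEquality.refl
  s (Fin.suc _) (Fin.suc _) = Relation.Binary.PropositionalEquality.refl
  r : ∀ v → a v v ≡ false
  r Fin.zero = Relation.Binary.PropositionalEquality.refl
  r (Fin.suc _) = Relation.Binary.PropositionalEquality.refl

pathAdjℕ : ℕ → ℕ → Bool
pathAdjℕ zero zero = false
pathAdjℕ zero (suc zero) = true
pathAdjℕ zero (suc (suc _)) = false
pathAdjℕ (suc zero) zero = true
pathAdjℕ (suc (suc _)) zero = false
pathAdjℕ (suc i) (suc j) = pathAdjℕ i j

pathAdjℕ-sym : ∀ i j → pathAdjℕ i j ≡ pathAdjℕ j i
pathAdjℕ-sym zero zero = Relation.Binary.PropositionalEquality.refl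
pathAdjℕ-sym zero (suc zero) = Relation.Binary.PropositionalEquality.refl
pathAdjℕ-sym zero (suc (suc j)) = Relation.Binary.PropositionalEquality.refl
pathAdjℕ-sym (suc zero) zero = Relation.Binary.PropositionalEquality.refl
pathAdjℕ-sym (suc (suc i)) zero = Relation.Binary.PropositionalEquality.refl
pathAdjℕ-sym (suc zero) (suc zero) = Relation.Binary.PropositionalEquality.refl
pathAdjℕ-sym (suc zero) (suc (suc j)) = pathAdjℕ-sym zero (suc j)
pathAdjℕ-sym (suc (suc i)) (suc zero) = pathAdjℕ-sym (suc i) zero
pathAdjℕ-sym (suc (suc i)) (suc (suc j)) = pathAdjℕ-sym (suc i) (suc j)

pathAdjℕ-irr : ∀ i → pathAdjℕ i i ≡ false
pathAdjℕ-irr zero = Relation.Binary.PropositionalEquality.refl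
pathAdjℕ-irr (suc zero) = Relation.Binary.PropositionalEquality.refl
pathAdjℕ-irr (suc (suc i)) = pathAdjℕ-irr (suc i)

pathGraph : (t : ℕ) → Graph t
pathGraph t = record
  { adj = λ i j → pathAdjℕ (toℕ i) (toℕ j)
  ; sym = λ i j → pathAdjℕ-sym (toℕ i) (toℕ j)
  ; irrefl = λ i → pathAdjℕ-irr (toℕ i)
  }

CycNext : (m : ℕ) → Fin m → Fin m → Set
CycNext m i j = (suc (toℕ i) ≡ toℕ j) ⊎ (suc (toℕ i) ≡ m × toℕ j ≡ 0)

record Cycle {n} (G : Graph n) (m : ℕ) : Set where
  field
    len≥3 : 3 ≤ m
    vert  : Fin m → Fin n
    inj   : Injective _≡_ _≡_ vert
    edges : ∀ i j → CycNext m i j → Adj G (vert i) (vert j)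

open Cycle public

HasChord : ∀ {n} {G : Graph n} {m} → Cycle G m → Set
HasChord {G = G} {m} C =
  ∃[ i ] ∃[ j ] (i ≢ j × ¬ CycNext m i j × ¬ CycNext m j i × Adj G (vert C i) (vert C j))

ChordedCycle : ∀ {n} → Graph n → ℕ → Set
ChordedCycle G m = Σ (Cycle G m) HasChord

ChordedPancyclic : ∀ {n} → Graph n → Set
ChordedPancyclic {n} G = ∀ m → 4 ≤ m → m ≤ n → ChordedCycle G m

{-# OPTIONS --safe #-}
module Submission where

-- Hamiltonicity.  Let v be a vertex off a cycle C.  If v has two non-consecutive neighbours a, b on C,
-- then the neighbours of a along C are adjacent, as are those of b (no claw, v not insertable); follow C
-- from a and from b up to the first non-neighbours u of a and u′ of b, reached from w and w′.  Every edge
-- missing from the paths u w a v b b⁺ (if a ≁ b) and u w a b w′ u′ (if a ~ b) would let v be absorbed into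
-- C, so one of them is an induced P₆.  If no vertex off C has two neighbours on C, a shortest detour of C
-- through the outside together with its end edges on C is already an induced P₆ or lengthens C.
--
-- Shortening.  Nine consecutive vertices of a cycle always admit a path with the same ends through exactly
-- eight of them, so cycles of all lengths from n down to 8 exist; from length 7 on, a chordless cycle
-- contains P₆.  Chorded cycles of lengths 4, 5, 6, 7 are found inside cycles of lengths 10, 11, 13, 8.
-- These are finite statements on at most 13 vertices, proved by decision trees on adjacencies whose leaves
-- exhibit a claw, a P₆ or the cycle sought; the trees are checked by evaluation.

open import Defs
open import Data.Bool using (Bool; true; false; T; _∧_; _∨_; not)
open import Data.Bool.Properties as Bool using (¬-not; T-∧; T-∨; T-≡)
open import Data.Empty using (⊥; ⊥-elim)
open import Data.Fin using (Fin; zero; suc; toℕ; fromℕ<; inject≤)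
open import Data.Fin.Patterns
import Data.Fin.Properties as Fin
open import Data.List using (List; []; _∷_; _++_; [_]; length; lookup; map; applyUpTo)
open import Data.List.Membership.Propositional using (_∈_; _∉_)
open import Data.List.Membership.Propositional.Properties using (∈-++⁺ˡ; ∈-++⁺ʳ; ∈-lookup; ∈-map⁻)
open import Data.List.Properties using (++-identityʳ; length-++; length-map)
open import Data.List.Relation.Binary.Permutation.Propositional
  using (_↭_; ↭-refl; ↭-reflexive; ↭-sym; ↭-trans; prep; ↭⇒↭ₛ)
open import Data.List.Relation.Binary.Permutation.Propositional.Properties
  using (++⁺; ++-comm; shift; ∈-resp-↭; ↭-length; ++-commutativeMonoid)
import Data.List.Relation.Binary.Permutation.Setoid.Properties as ↭ₛ
open import Data.List.Relation.Unary.All as All using (All; []; _∷_)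
import Data.List.Relation.Unary.All.Properties as All
open import Data.List.Relation.Unary.AllPairs using ([]; _∷_)
open import Data.List.Relation.Unary.Any as Any using (here; there)
open import Data.List.Relation.Unary.Any.Properties using (lookup-index)
open import Data.List.Relation.Unary.Unique.Propositional using (Unique)
import Data.List.Relation.Unary.Unique.Propositional.Properties as Unique
open import Data.Nat using (ℕ; zero; suc; _≤_; _<_; _+_; _∸_; z≤n; s≤s; _<ᵇ_; _≡ᵇ_)
import Data.Nat.Properties as ℕ
open import Data.List.Relation.Unary.Unique.DecPropositional ℕ._≟_ using (unique?)
open import Data.Product using (_×_; _,_; ∃-syntax; proj₁; proj₂; uncurry)
open import Data.Sum using (_⊎_; inj₁; inj₂)
open import Data.Unit using (tt)
open import Data.Vec using ([]; _∷_)
open import Function using (_∘_; Injective)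
open import Function.Bundles using (Equivalence)
open Equivalence using (to)
open import Relation.Binary.Definitions using (tri<; tri≈; tri>)
open import Relation.Binary.PropositionalEquality
  using (_≡_; _≢_; refl; cong; subst; subst₂; trans; module ≡-Reasoning)
  renaming (sym to ≡-sym; setoid to ≡-setoid)
open import Relation.Nullary using (¬_; Dec; does; yes; no; contradiction)
open import Relation.Nullary.Decidable
  using (_×-dec_; _⊎-dec_; _→-dec_; ¬?; from-yes; toWitness; isYes≗does; decidable-stable)

-- Every argument plays on one alternative: a pair of vertices is adjacent, and the edge reroutes a
-- cycle, or it is not, and the pair helps to make six vertices induce a path. The non-neighbour u
-- keeps the beginning of that path induced; the stretch before u consists of neighbours of a, so
-- that w can be taken out of it and what remains still ends in a neighbour of a.
--
-- No longest cycle is chosen. Growth starts from an edge, regarded as a cycle of length two, and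
-- every step yields a strictly longer cycle.
--
-- Shortening has to be local, because n is unbounded while a decision tree is finite: only a window
-- of nine vertices is touched, and this is why it stops at length 8. A chordless cycle of length at
-- most six contains no induced P₆, so for lengths 4, 5 and 6 the chord has to be found together
-- with the cycle. At length 7 the chord would come for free, but the cycle itself is out of reach
-- of the window.

Unique-resp-↭ : ∀ {A : Set} {xs ys : List A} → xs ↭ ys → Unique xs → Unique ys
Unique-resp-↭ {A} p = ↭ₛ.Unique-resp-↭ (≡-setoid A) (↭⇒↭ₛ p)

head≢ : ∀ {A : Set} {x y : A} {xs} → Unique (x ∷ xs) → y ∈ xs → x ≢ y
head≢ (x∉xs ∷ _) = All.lookup x∉xs

++≢ : ∀ {A : Set} {x y : A} {xs ys} → Unique (xs ++ ys) → x ∈ xs → y ∈ ys → x ≢ y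
++≢ {xs = _ ∷ xs} u       (here refl) y∈ = head≢ u (∈-++⁺ʳ xs y∈)
++≢ {xs = _ ∷ _}  (_ ∷ u) (there x∈)  y∈ = ++≢ u x∈ y∈

Unique-++⁻ : ∀ {A : Set} (xs : List A) {ys} → Unique (xs ++ ys) → Unique xs × Unique ys
Unique-++⁻ []       u        = [] , u
Unique-++⁻ (x ∷ xs) (x∉ ∷ u) with ux , uy ← Unique-++⁻ xs u = (All.++⁻ˡ xs x∉ ∷ ux) , uy

lookup-injective : ∀ {A : Set} {xs : List A} → Unique xs → Injective _≡_ _≡_ (lookup xs)
lookup-injective {xs = _ ∷ _} _       {zero}  {zero}  _ = refl
lookup-injective {xs = _ ∷ _} u       {zero}  {suc j} e = contradiction e (head≢ u (∈-lookup j))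
lookup-injective {xs = _ ∷ _} u       {suc i} {zero}  e = contradiction (≡-sym e) (head≢ u (∈-lookup i))
lookup-injective {xs = _ ∷ _} (_ ∷ u) {suc i} {suc j} e = cong suc (lookup-injective u e)

module _ {n : ℕ} where

  Unique-length≤ : {xs : List (Fin n)} → Unique xs → length xs ≤ n
  Unique-length≤ u = Fin.injective⇒≤ (lookup-injective u)

  -- Pigeonhole: if every vertex occurred in `xs`, the position of its occurrence would inject
  -- `Fin n` into a smaller set.
  ∃-∉ : (xs : List (Fin n)) → length xs < n → ∃[ v ] v ∉ xs
  ∃-∉ xs xs<n with Fin.any? (λ v → ¬? (Any.any? (v Fin.≟_) xs))
  ... | yes found = found
  ... | no none = contradiction (Fin.injective⇒≤ {f = Any.index ∘ all∈} index-injective) (ℕ.<⇒≱ xs<n)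
    where
    all∈ : ∀ v → v ∈ xs
    all∈ v = decidable-stable (Any.any? (v Fin.≟_) xs) (λ v∉ → none (v , v∉))
    index-injective : Injective _≡_ _≡_ (Any.index ∘ all∈)
    index-injective {u} {v} e = trans (lookup-index (all∈ u))
      (trans (cong (lookup xs) e) (≡-sym (lookup-index (all∈ v))))

lastOf : ∀ {A : Set} → A → List A → A
lastOf x []       = x
lastOf _ (x ∷ xs) = lastOf x xs

-- Lookup is made total by a default `d`, so that the vertices of a path can be named by plain
-- natural numbers, as in the certificates; the bounds are carried by separate hypotheses.
at : ∀ {A : Set} → A → List A → ℕ → A
at d []       _       = d
at d (x ∷ _)  zero    = x
at d (_ ∷ xs) (suc i) = at d xs i

at-∈ : ∀ {A : Set} {d : A} {xs i} → i < length xs → at d xs i ∈ xs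
at-∈ {xs = _ ∷ _} {zero}  _         = here refl
at-∈ {xs = _ ∷ _} {suc i} (s≤s i<n) = there (at-∈ i<n)

at-injective : ∀ {A : Set} {d : A} {xs i j} → Unique xs → i < length xs → j < length xs →
               at d xs i ≡ at d xs j → i ≡ j
at-injective {xs = _ ∷ _} {zero}  {zero}  _       _         _         _ = refl
at-injective {xs = _ ∷ _} {zero}  {suc j} u       _         (s≤s j<n) e = contradiction e (head≢ u (at-∈ j<n))
at-injective {xs = _ ∷ _} {suc i} {zero}  u       (s≤s i<n) _         e =
  contradiction (≡-sym e) (head≢ u (at-∈ i<n))
at-injective {xs = _ ∷ _} {suc i} {suc j} (_ ∷ u) (s≤s i<n) (s≤s j<n) e = cong suc (at-injective u i<n j<n e)

at-map : ∀ {A B : Set} (f : A → B) d xs i → at (f d) (map f xs) i ≡ f (at d xs i)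
at-map f d []       i       = refl
at-map f d (x ∷ xs) zero    = refl
at-map f d (x ∷ xs) (suc i) = at-map f d xs i

Unique-map : ∀ {A : Set} {K} {f : ℕ → A} → (∀ {i j} → i < K → j < K → f i ≡ f j → i ≡ j) →
             ∀ {is} → All (_< K) is → Unique is → Unique (map f is)
Unique-map f-inj []         []         = []
Unique-map f-inj (i<K ∷ <K) (i∉ ∷ u) =
  All.map⁺ (All.zipWith (λ (j<K , i≢j) e → i≢j (f-inj i<K j<K e)) (<K , i∉)) ∷ Unique-map f-inj <K u

-- No two vertices of P₆ have the same neighbourhood, so a map into a graph that preserves adjacency
-- and non-adjacency is injective of itself. The leaves of a claw are twins, which is why claws come
-- with explicit inequalities below.
path-twin-free : ∀ i j → (∀ k → adj (pathGraph 6) i k ≡ adj (pathGraph 6) j k) → i ≡ j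
path-twin-free = from-yes (Fin.all? λ i → Fin.all? λ j →
  Fin.all? (λ k → adj (pathGraph 6) i k Bool.≟ adj (pathGraph 6) j k) →-dec (i Fin.≟ j))

-- Paths, closed paths, and the first non-neighbour along a path.

module Paths {n : ℕ} (G : Graph n) where

  infix 4 _~_

  _~_ : Fin n → Fin n → Set
  _~_ = Adj G

  ~-sym : ∀ {u v} → u ~ v → v ~ u
  ~-sym {u} {v} e = trans (sym G v u) e

  ~-irrefl : ∀ {v} → ¬ v ~ v
  ~-irrefl {v} e with trans (≡-sym e) (irrefl G v)
  ... | ()

  ~⇒≢ : ∀ {u v} → u ~ v → u ≢ v
  ~⇒≢ e refl = ~-irrefl e

  _~?_ : ∀ u v → Dec (u ~ v)
  u ~? v = adj G u v Bool.≟ true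

  ≁⇒false : ∀ {u v} → ¬ u ~ v → adj G u v ≡ false
  ≁⇒false = ¬-not

  data Trail : Fin n → Fin n → List (Fin n) → Set where
    [-] : ∀ {x} → Trail x x [ x ]
    _∷_ : ∀ {x y z ys} → x ~ y → Trail y z ys → Trail x z (x ∷ ys)

  -- A path is remembered up to the order of its vertices, so that reversing it changes nothing but
  -- its ends.
  Path : Fin n → Fin n → List (Fin n) → Set
  Path u v xs = ∃[ ys ] (ys ↭ xs × Trail u v ys)

  trail : ∀ {u v xs} → Trail u v xs → Path u v xs
  trail t = _ , ↭-refl , t

  ⟨_⟩ : ∀ v → Path v v [ v ]
  ⟨ v ⟩ = trail [-]

  reorder : ∀ {u v xs ys} → xs ↭ ys → Path u v xs → Path u v ys
  reorder p (zs , q , t) = zs , ↭-trans q p , t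

  Trail-++ : ∀ {u v w z xs ys} → Trail u v xs → v ~ w → Trail w z ys → Trail u z (xs ++ ys)
  Trail-++ [-]     e t = e ∷ t
  Trail-++ (d ∷ s) e t = d ∷ Trail-++ s e t

  infixr 5 _─⟨_⟩─_

  _─⟨_⟩─_ : ∀ {u v w z xs ys} → Path u v xs → v ~ w → Path w z ys → Path u z (xs ++ ys)
  (_ , p , s) ─⟨ e ⟩─ (_ , q , t) = _ , ++⁺ p q , Trail-++ s e t

  Trail-reverse : ∀ {u v xs} → Trail u v xs → Path v u xs
  Trail-reverse [-]             = trail [-]
  Trail-reverse {xs = x ∷ xs} (e ∷ t) = reorder (++-comm xs [ x ]) (Trail-reverse t ─⟨ ~-sym e ⟩─ ⟨ x ⟩)

  rev : ∀ {u v xs} → Path u v xs → Path v u xs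
  rev (_ , p , t) = reorder p (Trail-reverse t)

  Trail-first∈ : ∀ {u v xs} → Trail u v xs → u ∈ xs
  Trail-first∈ [-]     = here refl
  Trail-first∈ (_ ∷ _) = here refl

  first∈ : ∀ {u v xs} → Path u v xs → u ∈ xs
  first∈ (_ , p , t) = ∈-resp-↭ p (Trail-first∈ t)

  last∈ : ∀ {u v xs} → Path u v xs → v ∈ xs
  last∈ p = first∈ (rev p)

  -- An edge counts as closed: this degenerate cycle of length two is where the growth of cycles
  -- starts. A single vertex does not count, as there are no loops.
  Closed : List (Fin n) → Set
  Closed xs = ∃[ u ] ∃[ v ] (Path u v xs × v ~ u)

  Closed-resp-↭ : ∀ {xs ys} → xs ↭ ys → Closed xs → Closed ys
  Closed-resp-↭ p (u , v , s , e) = u , v , reorder p s , e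

  -- When w has to be visited elsewhere, the rest of the stretch from s can still be closed up through c:
  -- it ends in a neighbour of c again.
  data Lead (c : Fin n) (s w : Fin n) : List (Fin n) → Set where
    single : s ≡ w → Lead c s w [ w ]
    longer : ∀ {w⁻ xs} → Path s w⁻ xs → w⁻ ~ w → c ~ w⁻ → Lead c s w (xs ++ [ w ])

  lead-path : ∀ {c s w xs} → Lead c s w xs → Path s w xs
  lead-path (single refl)    = ⟨ _ ⟩
  lead-path (longer p e _) = p ─⟨ e ⟩─ ⟨ _ ⟩

  record Exit (c s t : Fin n) (xs : List (Fin n)) : Set where
    constructor exit
    field
      {w u}       : Fin n
      {near far}  : List (Fin n)
      lead        : Lead c s w near
      rest        : Path u t far
      w~u         : w ~ u
      c~w         : c ~ w
      c≁u         : ¬ c ~ u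
      covers      : near ++ far ↭ xs

  extend-lead : ∀ {c s s′ w xs} → s ~ s′ → c ~ s → Lead c s′ w xs → Lead c s w (s ∷ xs)
  extend-lead e c~s (single refl)        = longer ⟨ _ ⟩ e c~s
  extend-lead e c~s (longer p d c~w⁻) = longer (⟨ _ ⟩ ─⟨ e ⟩─ p) d c~w⁻

  -- When `c` is adjacent to the whole trail, only its adjacency to the far end `t` is kept: it is
  -- enough to move `c` to that end.
  Trail-exit : ∀ {c s t xs} → c ~ s → Trail s t xs → c ~ t ⊎ Exit c s t xs
  Trail-exit c~s [-] = inj₁ c~s
  Trail-exit {c} c~s (_∷_ {y = y} e t) with c ~? y
  ... | no c≁y = inj₂ (exit (single refl) (trail t) e c~s c≁y ↭-refl)
  ... | yes c~y with Trail-exit c~y t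
  ...   | inj₁ c~t = inj₁ c~t
  ...   | inj₂ (exit l r d c~w c≁u p) = inj₂ (exit (extend-lead e c~s l) r d c~w c≁u (prep _ p))

  first-exit : ∀ {c s t xs} → c ~ s → Path s t xs → c ~ t ⊎ Exit c s t xs
  first-exit c~s (ys , p , t) with Trail-exit c~s t
  ... | inj₁ c~t = inj₁ c~t
  ... | inj₂ (exit l r d c~w c≁u q) = inj₂ (exit l r d c~w c≁u (↭-trans q p))

  -- Symmetry and irreflexivity reduce the comparison to ordered pairs. The order is a Boolean test,
  -- whose truth computes to an empty type at concrete vertices in the wrong order, so that case
  -- lists need only mention the pairs in increasing order.
  ordered-agree : ∀ {k} (H : Graph k) (f : Fin k → Fin n) →
                  (∀ i j → T (toℕ i <ᵇ toℕ j) → adj G (f i) (f j) ≡ adj H i j) →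
                  ∀ i j → adj H i j ≡ adj G (f i) (f j)
  ordered-agree H f h i j with Fin.<-cmp i j
  ... | tri< i<j _ _ = ≡-sym (h i j (ℕ.<⇒<ᵇ i<j))
  ... | tri≈ _ refl _ = trans (irrefl H i) (≡-sym (irrefl G (f i)))
  ... | tri> _ _ j<i = trans (sym H i j) (trans (≡-sym (h j i (ℕ.<⇒<ᵇ j<i))) (sym G (f j) (f i)))

  ordered-injective : ∀ {k} (f : Fin k → Fin n) → (∀ i j → T (toℕ i <ᵇ toℕ j) → f i ≢ f j) →
                      Injective _≡_ _≡_ f
  ordered-injective f h {i} {j} e with Fin.<-cmp i j
  ... | tri< i<j _ _ = ⊥-elim (h i j (ℕ.<⇒<ᵇ i<j) e)
  ... | tri≈ _ i≡j _ = i≡j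
  ... | tri> _ _ j<i = ⊥-elim (h j i (ℕ.<⇒<ᵇ j<i) (≡-sym e))

-- Forbidden induced subgraphs as case distinctions.

module Chords {n : ℕ} (G : Graph n) (claw-free : Free claw G) (P₆-free : Free (pathGraph 6) G) where

  open Paths G

  -- The goal `R` is arbitrary because some of the chords lead to a new cycle and others are absurd;
  -- both kinds enter the same case distinction.
  claw-chord : ∀ {R : Set} {c x y z} → c ~ x → c ~ y → c ~ z → x ≢ y → x ≢ z → y ≢ z →
               (x ~ y → R) → (x ~ z → R) → (y ~ z → R) → R
  claw-chord {c = c} {x} {y} {z} cx cy cz x≢y x≢z y≢z f g h with x ~? y | x ~? z | y ~? z
  ... | yes e | _ | _ = f e
  ... | no _ | yes e | _ = g e
  ... | no _ | no _ | yes e = h e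
  ... | no xy | no xz | no yz = ⊥-elim (claw-free (emb , emb-inj , emb-adj))
    where
    emb : Fin 4 → Fin n
    emb 0F = c
    emb 1F = x
    emb 2F = y
    emb 3F = z
    emb-inj : Injective _≡_ _≡_ emb
    emb-inj = ordered-injective emb λ where
      0F 1F _ → ~⇒≢ cx
      0F 2F _ → ~⇒≢ cy
      0F 3F _ → ~⇒≢ cz
      1F 2F _ → x≢y
      1F 3F _ → x≢z
      2F 3F _ → y≢z
    emb-adj : ∀ i j → adj claw i j ≡ adj G (emb i) (emb j)
    emb-adj = ordered-agree claw emb λ where
      0F 1F _ → cx
      0F 2F _ → cy
      0F 3F _ → cz
      1F 2F _ → ≁⇒false xy
      1F 3F _ → ≁⇒false xz
      2F 3F _ → ≁⇒false yz

  -- Distinctness comes out of the adjacencies: once all ten chords are absent, they are exactly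
  -- those of the path, and `path-twin-free` separates the vertices. Configurations in which some of
  -- the six vertices coincide are covered in this way without being mentioned.
  P₆-chord : ∀ {R : Set} {x0 x1 x2 x3 x4 x5} →
    x0 ~ x1 → x1 ~ x2 → x2 ~ x3 → x3 ~ x4 → x4 ~ x5 →
    (x0 ~ x2 → R) → (x0 ~ x3 → R) → (x0 ~ x4 → R) → (x0 ~ x5 → R) → (x1 ~ x3 → R) →
    (x1 ~ x4 → R) → (x1 ~ x5 → R) → (x2 ~ x4 → R) → (x2 ~ x5 → R) → (x3 ~ x5 → R) → R
  P₆-chord {R} {x0} {x1} {x2} {x3} {x4} {x5} e01 e12 e23 e34 e45
    k02 k03 k04 k05 k13 k14 k15 k24 k25 k35
    with x0 ~? x2 | x0 ~? x3 | x0 ~? x4 | x0 ~? x5 | x1 ~? x3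
       | x1 ~? x4 | x1 ~? x5 | x2 ~? x4 | x2 ~? x5 | x3 ~? x5
  ... | yes e | _ | _ | _ | _ | _ | _ | _ | _ | _ = k02 e
  ... | no _ | yes e | _ | _ | _ | _ | _ | _ | _ | _ = k03 e
  ... | no _ | no _ | yes e | _ | _ | _ | _ | _ | _ | _ = k04 e
  ... | no _ | no _ | no _ | yes e | _ | _ | _ | _ | _ | _ = k05 e
  ... | no _ | no _ | no _ | no _ | yes e | _ | _ | _ | _ | _ = k13 e
  ... | no _ | no _ | no _ | no _ | no _ | yes e | _ | _ | _ | _ = k14 e
  ... | no _ | no _ | no _ | no _ | no _ | no _ | yes e | _ | _ | _ = k15 e
  ... | no _ | no _ | no _ | no _ | no _ | no _ | no _ | yes e | _ | _ = k24 e
  ... | no _ | no _ | no _ | no _ | no _ | no _ | no _ | no _ | yes e | _ = k25 e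
  ... | no _ | no _ | no _ | no _ | no _ | no _ | no _ | no _ | no _ | yes e = k35 e
  ... | no n02 | no n03 | no n04 | no n05 | no n13 | no n14 | no n15 | no n24 | no n25 | no n35 =
    ⊥-elim (P₆-free (emb , emb-inj , emb-adj))
    where
    emb : Fin 6 → Fin n
    emb 0F = x0
    emb 1F = x1
    emb 2F = x2
    emb 3F = x3
    emb 4F = x4
    emb 5F = x5
    emb-adj : ∀ i j → adj (pathGraph 6) i j ≡ adj G (emb i) (emb j)
    emb-adj = ordered-agree (pathGraph 6) emb λ where
      0F 1F _ → e01
      0F 2F _ → ≁⇒false n02
      0F 3F _ → ≁⇒false n03
      0F 4F _ → ≁⇒false n04
      0F 5F _ → ≁⇒false n05
      1F 2F _ → e12
      1F 3F _ → ≁⇒false n13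
      1F 4F _ → ≁⇒false n14
      1F 5F _ → ≁⇒false n15
      2F 3F _ → e23
      2F 4F _ → ≁⇒false n24
      2F 5F _ → ≁⇒false n25
      3F 4F _ → e34
      3F 5F _ → ≁⇒false n35
      4F 5F _ → e45
    emb-inj : Injective _≡_ _≡_ emb
    emb-inj {i} {j} e = path-twin-free i j λ k →
      trans (emb-adj i k) (trans (cong (λ v → adj G v (emb k)) e) (≡-sym (emb-adj j k)))

-- Absorbing a vertex that has two neighbours on the cycle.

module Detour {n : ℕ} (G : Graph n) (claw-free : Free claw G) (P₆-free : Free (pathGraph 6) G) where

  open Paths G
  open Chords G claw-free P₆-free
  open import Algebra.Solver.CommutativeMonoid (++-commutativeMonoid {A = Fin n})
    using (Expr; var; _⊕_; ⟦_⟧; normalise; Env)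
  open import Algebra.Solver.CommutativeMonoid.Normal (++-commutativeMonoid {A = Fin n})
    using (⟦_⟧⇓; correct)

  -- Lists up to permutation form a commutative monoid under concatenation. A rerouted cycle visits
  -- the same segments in another order, so comparing vertex sets becomes an equality of normal
  -- forms that `refl` decides.
  rearrange : ∀ {k} (e₁ e₂ : Expr k) → normalise e₁ ≡ normalise e₂ → (ρ : Env k) → ⟦ e₁ ⟧ ρ ↭ ⟦ e₂ ⟧ ρ
  rearrange e₁ e₂ eq ρ = ↭-trans (↭-sym (correct e₁ ρ))
    (↭-trans (↭-reflexive (cong (λ nf → ⟦ nf ⟧⇓ ρ) eq)) (correct e₂ ρ))

  private
    -- One variable per segment, at a fixed position; the total number is left open so that the same
    -- names serve for families of five to eight segments.
    ′v = λ {k} → var {suc k} 0F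
    ′a = λ {k} → var {2 + k} 1F
    ′b = λ {k} → var {3 + k} 2F
    ′P = λ {k} → var {4 + k} 3F
    ′Q = λ {k} → var {5 + k} 4F
    ′D = λ {k} → var {6 + k} 5F
    ′w = λ {k} → var {7 + k} 6F

  -- The cycle runs a, s … w, u … t, b, s′ … t′ and back to a, where u is the first non-neighbour of a.
  module Half {v a b s t s′ t′ w u : Fin n} {P Q D : List (Fin n)}
    (lead : Lead a s w P) (rest : Path u t Q) (pD : Path s′ t′ D)
    (v~a : v ~ a) (v~b : v ~ b) (a~s : a ~ s) (t~b : t ~ b) (b~s′ : b ~ s′) (t′~a : t′ ~ a)
    (t′~s : t′ ~ s) (w~u : w ~ u) (a~w : a ~ w)
    (unique : Unique (v ∷ a ∷ b ∷ (P ++ Q) ++ D)) where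

    private
      near : Path s w P
      near = lead-path lead

      Result : List (Fin n) → Set
      Result R = Closed (v ∷ a ∷ b ∷ (R ++ Q) ++ D)

      tour : ∀ {x y xs R} → Path x y xs → y ~ x → xs ↭ v ∷ a ∷ b ∷ (R ++ Q) ++ D → Result R
      tour p e q = _ , _ , reorder q p , e

      order : ∀ R (e : Expr 6) → normalise e ≡ normalise (′v ⊕ ′a ⊕ ′b ⊕ (′P ⊕ ′Q) ⊕ ′D) →
              ⟦ e ⟧ ([ v ] ∷ [ a ] ∷ [ b ] ∷ R ∷ Q ∷ D ∷ []) ↭ v ∷ a ∷ b ∷ (R ++ Q) ++ D
      order R e eq = rearrange e (′v ⊕ ′a ⊕ ′b ⊕ (′P ⊕ ′Q) ⊕ ′D) eq ([ v ] ∷ [ a ] ∷ [ b ] ∷ R ∷ Q ∷ D ∷ [])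

      order⁻ : ∀ P⁻ (e : Expr 7) → normalise e ≡ normalise (′v ⊕ ′a ⊕ ′b ⊕ ((′P ⊕ ′w) ⊕ ′Q) ⊕ ′D) →
               ⟦ e ⟧ ([ v ] ∷ [ a ] ∷ [ b ] ∷ P⁻ ∷ Q ∷ D ∷ [ w ] ∷ []) ↭
               v ∷ a ∷ b ∷ ((P⁻ ++ [ w ]) ++ Q) ++ D
      order⁻ P⁻ e eq = rearrange e (′v ⊕ ′a ⊕ ′b ⊕ ((′P ⊕ ′w) ⊕ ′Q) ⊕ ′D) eq
                      ([ v ] ∷ [ a ] ∷ [ b ] ∷ P⁻ ∷ Q ∷ D ∷ [ w ] ∷ [])

    -- The edge `t′ ~ s` passes over `a` and frees it: `a` and `v` move together to the gap between
    -- `w` and `u`.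
    v~u⇒closed : v ~ u → Result P
    v~u⇒closed e =
      tour (near ─⟨ ~-sym a~w ⟩─ ⟨ a ⟩ ─⟨ ~-sym v~a ⟩─ ⟨ v ⟩ ─⟨ e ⟩─ rest ─⟨ t~b ⟩─ ⟨ b ⟩ ─⟨ b~s′ ⟩─ pD)
        t′~s (order P (′P ⊕ ′a ⊕ ′v ⊕ ′Q ⊕ ′b ⊕ ′D) refl)

    v~s′⇒closed : v ~ s′ → Result P
    v~s′⇒closed e =
      tour (⟨ a ⟩ ─⟨ a~s ⟩─ near ─⟨ w~u ⟩─ rest ─⟨ t~b ⟩─ ⟨ b ⟩ ─⟨ ~-sym v~b ⟩─ ⟨ v ⟩ ─⟨ e ⟩─ pD)
        t′~a (order P (′a ⊕ ′P ⊕ ′Q ⊕ ′b ⊕ ′v ⊕ ′D) refl)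

    u~s′⇒closed : u ~ s′ → Result P
    u~s′⇒closed e =
      tour (⟨ a ⟩ ─⟨ ~-sym v~a ⟩─ ⟨ v ⟩ ─⟨ v~b ⟩─ ⟨ b ⟩ ─⟨ ~-sym t~b ⟩─ rev rest ─⟨ e ⟩─ pD ─⟨ t′~s ⟩─ near)
        (~-sym a~w) (order P (′a ⊕ ′v ⊕ ′b ⊕ ′Q ⊕ ′D ⊕ ′P) refl)

    a~s′⇒closed : a ~ s′ → Result P
    a~s′⇒closed e =
      tour (near ─⟨ w~u ⟩─ rest ─⟨ t~b ⟩─ ⟨ b ⟩ ─⟨ ~-sym v~b ⟩─ ⟨ v ⟩ ─⟨ v~a ⟩─ ⟨ a ⟩ ─⟨ e ⟩─ pD)
        t′~s (order P (′P ⊕ ′Q ⊕ ′b ⊕ ′v ⊕ ′a ⊕ ′D) refl)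

    -- Here `w` is used up as the link to `s′`, so the stretch from `s` has to close up at `w⁻`
    -- instead, by `a ~ w⁻`. If `w` is `s`, nothing of the stretch is left and the old edge `t′ ~ a`
    -- closes the cycle.
    w~s′⇒closed : w ~ s′ → Result P
    w~s′⇒closed e = go lead
      where
      go : ∀ {R} → Lead a s w R → Result R
      go (single refl) =
        tour (⟨ a ⟩ ─⟨ ~-sym v~a ⟩─ ⟨ v ⟩ ─⟨ v~b ⟩─ ⟨ b ⟩ ─⟨ ~-sym t~b ⟩─ rev rest ─⟨ ~-sym w~u ⟩─
              ⟨ w ⟩ ─⟨ e ⟩─ pD)
          t′~a (order [ w ] (′a ⊕ ′v ⊕ ′b ⊕ ′Q ⊕ ′P ⊕ ′D) refl)
      go (longer {xs = P⁻} p w⁻~w a~w⁻) =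
        tour (⟨ a ⟩ ─⟨ ~-sym v~a ⟩─ ⟨ v ⟩ ─⟨ v~b ⟩─ ⟨ b ⟩ ─⟨ ~-sym t~b ⟩─ rev rest ─⟨ ~-sym w~u ⟩─
              ⟨ w ⟩ ─⟨ e ⟩─ pD ─⟨ t′~s ⟩─ p)
          (~-sym a~w⁻)
          (order⁻ P⁻ (′a ⊕ ′v ⊕ ′b ⊕ ′Q ⊕ ′w ⊕ ′D ⊕ ′P) refl)

    v~w⇒closed : v ~ w → Result P
    v~w⇒closed e = go lead
      where
      go : ∀ {R} → Lead a s w R → Result R
      go (single refl) =
        tour (⟨ v ⟩ ─⟨ e ⟩─ ⟨ w ⟩ ─⟨ w~u ⟩─ rest ─⟨ t~b ⟩─ ⟨ b ⟩ ─⟨ b~s′ ⟩─ pD ─⟨ t′~a ⟩─ ⟨ a ⟩)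
          (~-sym v~a) (order [ w ] (′v ⊕ ′P ⊕ ′Q ⊕ ′b ⊕ ′D ⊕ ′a) refl)
      go (longer {xs = P⁻} p w⁻~w a~w⁻) =
        tour (p ─⟨ ~-sym a~w⁻ ⟩─ ⟨ a ⟩ ─⟨ ~-sym v~a ⟩─ ⟨ v ⟩ ─⟨ e ⟩─ ⟨ w ⟩ ─⟨ w~u ⟩─ rest ─⟨ t~b ⟩─
              ⟨ b ⟩ ─⟨ b~s′ ⟩─ pD)
          t′~s
          (order⁻ P⁻ (′P ⊕ ′a ⊕ ′v ⊕ ′w ⊕ ′Q ⊕ ′b ⊕ ′D) refl)

    private
      segments : Unique ((P ++ Q) ++ D)
      segments = Unique.drop⁺ 3 unique

      v≢ : ∀ {x} → x ∈ (P ++ Q) ++ D → v ≢ x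
      v≢ x∈ = head≢ unique (there (there x∈))

    -- A claw at `b` with leaves `v`, `u`, `s′` trades the edge for one of three that are already
    -- treated. For `u = t` the edge lies on the cycle from the outset, so this degenerate case is
    -- settled here as well.
    u~b⇒closed : u ~ b → Result P
    u~b⇒closed e = claw-chord (~-sym v~b) (~-sym e) b~s′
      (v≢ (∈-++⁺ˡ u∈)) (v≢ (∈-++⁺ʳ (P ++ Q) (first∈ pD))) (++≢ segments u∈ (first∈ pD))
      v~u⇒closed v~s′⇒closed u~s′⇒closed
      where
      u∈ : u ∈ P ++ Q
      u∈ = ∈-++⁺ʳ P (first∈ rest)

    w~b⇒closed : w ~ b → Result P
    w~b⇒closed e = claw-chord (~-sym v~b) (~-sym e) b~s′
      (v≢ (∈-++⁺ˡ w∈)) (v≢ (∈-++⁺ʳ (P ++ Q) (first∈ pD))) (++≢ segments w∈ (first∈ pD))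
      v~w⇒closed v~s′⇒closed w~s′⇒closed
      where
      w∈ : w ∈ P ++ Q
      w∈ = ∈-++⁺ˡ (last∈ near)

  -- The cycle runs a, s … w, u … t, b, s′ … w′, u′ … t′ and back to a.
  module Cross {v a b s t s′ t′ w u w′ u′ : Fin n} {P Q P′ Q′ : List (Fin n)}
    (near : Path s w P) (rest : Path u t Q) (lead′ : Lead b s′ w′ P′) (rest′ : Path u′ t′ Q′)
    (v~a : v ~ a) (v~b : v ~ b) (t~b : t ~ b) (b~s′ : b ~ s′)
    (t′~s : t′ ~ s) (t~s′ : t ~ s′) (a~w : a ~ w) (w′~u′ : w′ ~ u′) (b~w′ : b ~ w′) where

    private
      ′Q′ = λ {k} → var {8 + k} 7F

      order : ∀ P′ → (e : Expr 8) →
              normalise e ≡ normalise (′v ⊕ ′a ⊕ ′b ⊕ (′P ⊕ ′Q) ⊕ (′D ⊕ ′w) ⊕ ′Q′) →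
              ⟦ e ⟧ ([ v ] ∷ [ a ] ∷ [ b ] ∷ P ∷ Q ∷ P′ ∷ [ w′ ] ∷ Q′ ∷ []) ↭
              v ∷ a ∷ b ∷ (P ++ Q) ++ (P′ ++ [ w′ ]) ++ Q′
      order P′ e eq = rearrange e (′v ⊕ ′a ⊕ ′b ⊕ (′P ⊕ ′Q) ⊕ (′D ⊕ ′w) ⊕ ′Q′) eq
        ([ v ] ∷ [ a ] ∷ [ b ] ∷ P ∷ Q ∷ P′ ∷ [ w′ ] ∷ Q′ ∷ [])

    -- Again `w′` is taken out of its stretch. What remains of it, `s′` up to the predecessor of
    -- `w′`, is visited between `b` and `t`: entered through the adjacency of `b` to that
    -- predecessor, and left through `s′ ~ t`.
    u~w′⇒closed : u ~ w′ → Closed (v ∷ a ∷ b ∷ (P ++ Q) ++ P′ ++ Q′)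
    u~w′⇒closed e = go lead′
      where
      go : ∀ {R} → Lead b s′ w′ R → Closed (v ∷ a ∷ b ∷ (P ++ Q) ++ R ++ Q′)
      -- `′D` stands for the empty list here. It is present only to make the normal forms agree, and
      -- is put in front, where it vanishes by computation.
      go (single refl) = _ , _ , reorder (order [] (′D ⊕ ′v ⊕ ′b ⊕ ′Q ⊕ ′w ⊕ ′Q′ ⊕ ′P ⊕ ′a) refl)
        (⟨ v ⟩ ─⟨ v~b ⟩─ ⟨ b ⟩ ─⟨ ~-sym t~b ⟩─ rev rest ─⟨ e ⟩─ ⟨ w′ ⟩ ─⟨ w′~u′ ⟩─ rest′ ─⟨ t′~s ⟩─
         near ─⟨ ~-sym a~w ⟩─ ⟨ a ⟩) , ~-sym v~a
      go (longer {xs = R} p _ b~w⁻) = _ , _ , reorder (order R (′v ⊕ ′b ⊕ ′D ⊕ ′Q ⊕ ′w ⊕ ′Q′ ⊕ ′P ⊕ ′a) refl)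
        (⟨ v ⟩ ─⟨ v~b ⟩─ ⟨ b ⟩ ─⟨ b~w⁻ ⟩─ rev p ─⟨ ~-sym t~s′ ⟩─ rev rest ─⟨ e ⟩─ ⟨ w′ ⟩ ─⟨ w′~u′ ⟩─
         rest′ ─⟨ t′~s ⟩─ near ─⟨ ~-sym a~w ⟩─ ⟨ a ⟩) , ~-sym v~a

    u~u′⇒closed : u ~ u′ → Closed (v ∷ a ∷ b ∷ (P ++ Q) ++ P′ ++ Q′)
    u~u′⇒closed e = _ , _ , reorder
      -- `′D` and `′w` stand for the unbroken lists `P′` and `Q′`.
      (rearrange (′v ⊕ ′b ⊕ ′D ⊕ ′Q ⊕ ′w ⊕ ′P ⊕ ′a) (′v ⊕ ′a ⊕ ′b ⊕ (′P ⊕ ′Q) ⊕ ′D ⊕ ′w) refl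
        ([ v ] ∷ [ a ] ∷ [ b ] ∷ P ∷ Q ∷ P′ ∷ Q′ ∷ []))
      (⟨ v ⟩ ─⟨ v~b ⟩─ ⟨ b ⟩ ─⟨ b~w′ ⟩─ rev (lead-path lead′) ─⟨ ~-sym t~s′ ⟩─ rev rest ─⟨ e ⟩─
       rest′ ─⟨ t′~s ⟩─ near ─⟨ ~-sym a~w ⟩─ ⟨ a ⟩) , ~-sym v~a

  -- The edges `t′ ~ s` and `t ~ s′` won from the two claws are what makes rerouting possible: they
  -- let the cycle pass over `a` or `b`, which can then be visited elsewhere, next to `v`.
  insert-between : ∀ {v a b s t s′ t′ A D} → Path s t A → Path s′ t′ D →
    v ~ a → v ~ b → a ~ s → t ~ b → b ~ s′ → t′ ~ a → Unique (v ∷ a ∷ b ∷ A ++ D) →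
    Closed (v ∷ a ∷ b ∷ A ++ D)
  insert-between {v} {a} {b} {s} {t} {s′} {t′} {A} {D} pA pD v~a v~b a~s t~b b~s′ t′~a unique =
    claw-chord (~-sym v~a) a~s (~-sym t′~a) (v≢ (∈-++⁺ˡ (first∈ pA))) (v≢ (∈-++⁺ʳ A (last∈ pD)))
      (++≢ segments (first∈ pA) (last∈ pD))
      (λ v~s → tour (′v ⊕ ′A ⊕ ′b ⊕ ′D′ ⊕ ′a) refl
        (⟨ v ⟩ ─⟨ v~s ⟩─ pA ─⟨ t~b ⟩─ ⟨ b ⟩ ─⟨ b~s′ ⟩─ pD ─⟨ t′~a ⟩─ ⟨ a ⟩) (~-sym v~a))
      (λ v~t′ → tour (′a ⊕ ′A ⊕ ′b ⊕ ′D′ ⊕ ′v) refl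
        (⟨ a ⟩ ─⟨ a~s ⟩─ pA ─⟨ t~b ⟩─ ⟨ b ⟩ ─⟨ b~s′ ⟩─ pD ─⟨ ~-sym v~t′ ⟩─ ⟨ v ⟩) v~a)
      λ s~t′ →
    claw-chord (~-sym v~b) (~-sym t~b) b~s′ (v≢ (∈-++⁺ˡ (last∈ pA))) (v≢ (∈-++⁺ʳ A (first∈ pD)))
      (++≢ segments (last∈ pA) (first∈ pD))
      (λ v~t → tour (′a ⊕ ′A ⊕ ′v ⊕ ′b ⊕ ′D′) refl
        (⟨ a ⟩ ─⟨ a~s ⟩─ pA ─⟨ ~-sym v~t ⟩─ ⟨ v ⟩ ─⟨ v~b ⟩─ ⟨ b ⟩ ─⟨ b~s′ ⟩─ pD) t′~a)
      (λ v~s′ → tour (′a ⊕ ′A ⊕ ′b ⊕ ′v ⊕ ′D′) refl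
        (⟨ a ⟩ ─⟨ a~s ⟩─ pA ─⟨ t~b ⟩─ ⟨ b ⟩ ─⟨ ~-sym v~b ⟩─ ⟨ v ⟩ ─⟨ v~s′ ⟩─ pD) t′~a)
      λ t~s′ → exits (~-sym s~t′) t~s′ (first-exit a~s pA) (first-exit b~s′ pD)
    where
    ′A ′D′ : Expr 5
    ′A = var 3F
    ′D′ = var 4F

    segments : Unique (A ++ D)
    segments = Unique.drop⁺ 3 unique

    v≢ : ∀ {x} → x ∈ A ++ D → v ≢ x
    v≢ x∈ = head≢ unique (there (there x∈))

    Result : Set
    Result = Closed (v ∷ a ∷ b ∷ A ++ D)

    tour : (e : Expr 5) → normalise e ≡ normalise (′v ⊕ ′a ⊕ ′b ⊕ ′A ⊕ ′D′) →
           ∀ {x y} → Path x y (⟦ e ⟧ ([ v ] ∷ [ a ] ∷ [ b ] ∷ A ∷ D ∷ [])) → y ~ x → Result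
    tour e eq p y~x = _ , _ , reorder (rearrange e (′v ⊕ ′a ⊕ ′b ⊕ ′A ⊕ ′D′) eq
      ([ v ] ∷ [ a ] ∷ [ b ] ∷ A ∷ D ∷ [])) p , y~x

    exits : t′ ~ s → t ~ s′ → a ~ t ⊎ Exit a s t A → b ~ t′ ⊎ Exit b s′ t′ D → Result
    -- With `a ~ t`, both `a` and `v` fit between `t` and `b`, and `t′ ~ s` closes the gap left by
    -- `a`.
    exits t′~s t~s′ (inj₁ a~t) _ =
      tour (′A ⊕ ′a ⊕ ′v ⊕ ′b ⊕ ′D′) refl
        (pA ─⟨ ~-sym a~t ⟩─ ⟨ a ⟩ ─⟨ ~-sym v~a ⟩─ ⟨ v ⟩ ─⟨ v~b ⟩─ ⟨ b ⟩ ─⟨ b~s′ ⟩─ pD) t′~s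
    exits t′~s t~s′ (inj₂ _) (inj₁ b~t′) =
      tour (′D′ ⊕ ′b ⊕ ′v ⊕ ′a ⊕ ′A) refl
        (pD ─⟨ ~-sym b~t′ ⟩─ ⟨ b ⟩ ─⟨ ~-sym v~b ⟩─ ⟨ v ⟩ ─⟨ v~a ⟩─ ⟨ a ⟩ ─⟨ a~s ⟩─ pA) t~s′
    exits t′~s t~s′ (inj₂ (exit {w} {u} {P} {Q} lead rest w~u a~w a≁u PQ↭A))
                    (inj₂ (exit {w′} {u′} {P′} {Q′} lead′ rest′ w′~u′ b~w′ b≁u′ PQ↭D)) with a ~? b
    ... | no a≁b =
      P₆-chord (~-sym w~u) (~-sym a~w) (~-sym v~a) v~b b~s′
        (λ u~a → ⊥-elim (a≁u (~-sym u~a)))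
        (widen ∘ H.v~u⇒closed ∘ ~-sym) (widen ∘ H.u~b⇒closed) (widen ∘ H.u~s′⇒closed)
        (widen ∘ H.v~w⇒closed ∘ ~-sym)
        (widen ∘ H.w~b⇒closed) (widen ∘ H.w~s′⇒closed) (⊥-elim ∘ a≁b) (widen ∘ H.a~s′⇒closed)
        (widen ∘ H.v~s′⇒closed)
      where
      ↭₁ : v ∷ a ∷ b ∷ A ++ D ↭ v ∷ a ∷ b ∷ (P ++ Q) ++ D
      ↭₁ = prep v (prep a (prep b (++⁺ (↭-sym PQ↭A) ↭-refl)))
      widen : Closed (v ∷ a ∷ b ∷ (P ++ Q) ++ D) → Result
      widen = Closed-resp-↭ (↭-sym ↭₁)
      module H = Half lead rest pD v~a v~b a~s t~b b~s′ t′~a t′~s w~u a~w (Unique-resp-↭ ↭₁ unique)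
    ... | yes a~b =
      P₆-chord (~-sym w~u) (~-sym a~w) a~b b~w′ w′~u′
        (λ u~a → ⊥-elim (a≁u (~-sym u~a)))
        (widen ∘ H.u~b⇒closed) (cross ∘ C.u~w′⇒closed) (cross ∘ C.u~u′⇒closed)
        (widen ∘ H.w~b⇒closed)
        -- The edge `w ~ w′` is not turned into a cycle directly: a claw at `w` with leaves `a`,
        -- `u`, `w′` exchanges it for `a ~ w′` or `u ~ w′`, since `a ~ u` is excluded.
        (λ w~w′ → claw-chord (~-sym a~w) w~u w~w′
          (head≢ (Unique.drop⁺ 1 unique) (there (∈-++⁺ˡ u∈)))
          (head≢ (Unique.drop⁺ 1 unique) (there (∈-++⁺ʳ A w′∈)))
          (++≢ segments u∈ w′∈)
          (⊥-elim ∘ a≁u) (widen′ ∘ H′.w~b⇒closed ∘ ~-sym) (cross ∘ C.u~w′⇒closed))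
        (λ w~u′ → cross′ (C′.u~w′⇒closed (~-sym w~u′)))
        (widen′ ∘ H′.w~b⇒closed ∘ ~-sym) (widen′ ∘ H′.u~b⇒closed ∘ ~-sym)
        (⊥-elim ∘ b≁u′)
      where
      u∈ : u ∈ A
      u∈ = ∈-resp-↭ PQ↭A (∈-++⁺ʳ P (first∈ rest))
      w′∈ : w′ ∈ D
      w′∈ = ∈-resp-↭ PQ↭D (∈-++⁺ˡ (last∈ (lead-path lead′)))
      ↭₁ : v ∷ a ∷ b ∷ A ++ D ↭ v ∷ a ∷ b ∷ (P ++ Q) ++ D
      ↭₁ = prep v (prep a (prep b (++⁺ (↭-sym PQ↭A) ↭-refl)))
      swapped : v ∷ a ∷ b ∷ A ++ D ↭ v ∷ b ∷ a ∷ D ++ A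
      swapped = rearrange (′v ⊕ ′a ⊕ ′b ⊕ ′A ⊕ ′D′) (′v ⊕ ′b ⊕ ′a ⊕ ′D′ ⊕ ′A) refl
        ([ v ] ∷ [ a ] ∷ [ b ] ∷ A ∷ D ∷ [])
      ↭₂ : v ∷ a ∷ b ∷ A ++ D ↭ v ∷ b ∷ a ∷ (P′ ++ Q′) ++ A
      ↭₂ = ↭-trans swapped (prep v (prep b (prep a (++⁺ (↭-sym PQ↭D) ↭-refl))))
      widen : Closed (v ∷ a ∷ b ∷ (P ++ Q) ++ D) → Result
      widen = Closed-resp-↭ (↭-sym ↭₁)
      widen′ : Closed (v ∷ b ∷ a ∷ (P′ ++ Q′) ++ A) → Result
      widen′ = Closed-resp-↭ (↭-sym ↭₂)
      cross : Closed (v ∷ a ∷ b ∷ (P ++ Q) ++ P′ ++ Q′) → Result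
      cross = Closed-resp-↭ (prep v (prep a (prep b (++⁺ PQ↭A PQ↭D))))
      cross′ : Closed (v ∷ b ∷ a ∷ (P′ ++ Q′) ++ P ++ Q) → Result
      cross′ = Closed-resp-↭ (↭-trans (prep v (prep b (prep a (++⁺ PQ↭D PQ↭A)))) (↭-sym swapped))
      module H = Half lead rest pD v~a v~b a~s t~b b~s′ t′~a t′~s w~u a~w (Unique-resp-↭ ↭₁ unique)
      -- The configuration is symmetric under exchanging `a` and its arc with `b` and its arc; the
      -- chords that start from `w′` or `u′` are read off the mirrored modules.
      module H′ = Half lead′ rest′ pA v~b v~a b~s′ t′~a a~s t~b t~s′ w′~u′ b~w′ (Unique-resp-↭ ↭₂ unique)
      module C = Cross (lead-path lead) rest lead′ rest′ v~a v~b t~b b~s′ t′~s t~s′ a~w w′~u′ b~w′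
      module C′ = Cross (lead-path lead′) rest′ lead rest v~b v~a t′~a a~s t~s′ t′~s b~w′ w~u a~w

-- Cutting cycles open, and detours through the outside.

module Attach {n : ℕ} (G : Graph n) (claw-free : Free claw G) (P₆-free : Free (pathGraph 6) G) where

  open Paths G
  open Chords G claw-free P₆-free
  open Detour G claw-free P₆-free
  open import Algebra.Solver.CommutativeMonoid (++-commutativeMonoid {A = Fin n})
    using (var; Expr; _⊕_; ⟦_⟧; normalise)

  data Position (s t y : Fin n) (xs : List (Fin n)) : Set where
    only    : s ≡ y → Position s t y xs
    initial : ∀ {s′ zs} → s ≡ y → y ~ s′ → Path s′ t zs → y ∷ zs ↭ xs → Position s t y xs
    final   : ∀ {t′ zs} → t ≡ y → Path s t′ zs → t′ ~ y → y ∷ zs ↭ xs → Position s t y xs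
    inner   : ∀ {t′ s′ ys zs} → Path s t′ ys → t′ ~ y → y ~ s′ → Path s′ t zs → y ∷ ys ++ zs ↭ xs →
              Position s t y xs

  Trail-locate : ∀ {s t y xs} → Trail s t xs → y ∈ xs → Position s t y xs
  Trail-locate [-]     (here refl) = only refl
  Trail-locate (e ∷ p) (here refl) = initial refl e (trail p) ↭-refl
  Trail-locate {y = y} (_∷_ {x = x} e p) (there y∈) with Trail-locate p y∈
  ... | initial refl d q r = inner ⟨ _ ⟩ e d q (↭-trans (shift x [ y ] _) (prep x r))
  ... | final refl q d r = final refl (⟨ _ ⟩ ─⟨ e ⟩─ q) d (↭-trans (shift x [ y ] _) (prep x r))
  ... | inner q c d q′ r = inner (⟨ _ ⟩ ─⟨ e ⟩─ q) c d q′ (↭-trans (shift x [ y ] _) (prep x r))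
  Trail-locate (e ∷ [-]) (there y∈) | only refl = final refl ⟨ _ ⟩ e (shift _ [ _ ] [])
  Trail-locate (e ∷ (d ∷ p)) (there y∈) | only refl =
    inner ⟨ _ ⟩ e d (trail p) (shift _ [ _ ] _)

  locate : ∀ {s t y xs} → Path s t xs → y ∈ xs → Position s t y xs
  locate (_ , p , t) y∈ with Trail-locate t (∈-resp-↭ (↭-sym p) y∈)
  ... | only e          = only e
  ... | initial e d q r = initial e d q (↭-trans r p)
  ... | final e q d r   = final e q d (↭-trans r p)
  ... | inner q c d q′ r = inner q c d q′ (↭-trans r p)

  start : ∀ {P : Fin n → Set} {u w} → Walk G P u w → P u
  start (here p)     = p
  start (step p _ _) = p

  record Rotation (x : Fin n) (C : List (Fin n)) : Set where
    constructor rotation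
    field
      {s t} : Fin n
      {A}   : List (Fin n)
      arc   : Path s t A
      x~s   : x ~ s
      t~x   : t ~ x
      covers : x ∷ A ↭ C

  rotate : ∀ {x C} → Closed C → x ∈ C → Rotation x C
  rotate (_ , _ , p , v~u) x∈ with locate p x∈
  ... | initial refl d q r    = rotation q d v~u r
  ... | final refl q d r      = rotation q v~u d r
  ... | inner {ys = ys} {zs = zs} q c d q′ r =
    rotation (q′ ─⟨ v~u ⟩─ q) d c (↭-trans (prep _ (++-comm zs ys)) r)
  rotate (_ , _ , (_ , _ , [-]) , v~u) x∈ | only refl = ⊥-elim (~-irrefl v~u)
  -- `only` says no more than that `x` is the first vertex, and then the rest of the trail is the
  -- arc.
  rotate (_ , _ , (_ , r , (e ∷ t)) , v~u) x∈ | only refl = rotation (trail t) e v~u r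

  Longer : List (Fin n) → Set
  Longer C = ∃[ L ] (Unique L × Closed L × length C < length L)

  grow : ∀ {v C} X → Unique (v ∷ X ++ C) → Closed (v ∷ X ++ C) → Longer C
  grow {v} {C} X u c = v ∷ X ++ C , u , c ,
    s≤s (subst (length C ≤_) (≡-sym (length-++ X)) (ℕ.m≤n+m (length C) (length X)))

  extend-unique : ∀ {v : Fin n} {xs} → v ∉ xs → Unique xs → Unique (v ∷ xs)
  extend-unique {xs = xs} v∉ u = All.¬Any⇒All¬ xs v∉ ∷ u

  ∉-∷ : ∀ {v x : Fin n} {xs} → v ≢ x → v ∉ xs → v ∉ x ∷ xs
  ∉-∷ v≢x v∉ (here v≡x) = v≢x v≡x
  ∉-∷ v≢x v∉ (there v∈) = v∉ v∈

  insert-after : ∀ {x s t p q A C X} → Path s t A → t ~ x → Path p q X → x ~ p → q ~ s → x ∷ A ↭ C →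
                 Closed (X ++ C)
  insert-after {x} {A = A} {X = X} pA t~x pX x~p q~s cov = _ , _ ,
    reorder (↭-trans (rearrange (var 0F ⊕ var 2F ⊕ var 1F) (var 2F ⊕ var 0F ⊕ var 1F) refl
              ([ x ] ∷ A ∷ X ∷ [])) (++⁺ (↭-refl {x = X}) cov))
      (⟨ x ⟩ ─⟨ x~p ⟩─ pX ─⟨ q~s ⟩─ pA) , t~x

  -- If `x` and `y` are consecutive, `v` goes between them; otherwise both arcs are nonempty and
  -- `insert-between` applies. From here on an outside vertex may be assumed to have at most one
  -- neighbour on the cycle.
  two-neighbours : ∀ {v x y C} → Closed C → Unique C → v ∉ C → x ∈ C → y ∈ C → x ≢ y →
                   v ~ x → v ~ y → Longer C
  two-neighbours {v} {x} {y} {C} closed unique v∉ x∈ y∈ x≢y v~x v~y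
    with rotate closed x∈
  ... | rotation {s} {t} {A} pA x~s t~x cov with ∈-resp-↭ (↭-sym cov) y∈
  ...   | here y≡x = contradiction (≡-sym y≡x) x≢y
  ...   | there y∈A with locate pA y∈A
  ...     | only refl = grow [] (extend-unique v∉ unique) (insert-after pA t~x ⟨ v ⟩ (~-sym v~x) v~y cov)
  ...     | initial refl _ _ _ =
    grow [] (extend-unique v∉ unique) (insert-after pA t~x ⟨ v ⟩ (~-sym v~x) v~y cov)
  ...     | final refl _ _ _ =
    grow [] (extend-unique v∉ unique) (insert-after (rev pA) (~-sym x~s) ⟨ v ⟩ (~-sym v~x) v~y cov)
  ...     | inner pB t′~y y~s′ pD r =
    grow [] (extend-unique v∉ unique) (Closed-resp-↭ (prep v cov′)
      (insert-between pB pD v~x v~y x~s t′~y y~s′ t~x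
        (Unique-resp-↭ (prep v (↭-sym cov′)) (extend-unique v∉ unique))))
    where
    cov′ = ↭-trans (prep x r) cov

  module Attached {C : List (Fin n)} (closed : Closed C) (unique : Unique C)
                  {x s t : Fin n} {A : List (Fin n)} (arc : Path s t A)
                  (x~s : x ~ s) (t~x : t ~ x) (covers : x ∷ A ↭ C) where

    private
      two : ∀ {v a b} → v ∉ C → a ∈ C → b ∈ C → a ≢ b → v ~ a → v ~ b → Longer C
      two = two-neighbours closed unique

      x∈ : x ∈ C
      x∈ = ∈-resp-↭ covers (here refl)

      A⊆ : ∀ {y} → y ∈ A → y ∈ C
      A⊆ y∈ = ∈-resp-↭ covers (there y∈)

      x≢ : ∀ {y} → y ∈ A → x ≢ y
      x≢ = head≢ (Unique-resp-↭ (↭-sym covers) unique)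

      s∈ = first∈ arc
      t∈ = last∈ arc

      unique₂ : ∀ {v₁ v₂} → v₁ ∉ C → v₂ ∉ C → v₁ ≢ v₂ → Unique (v₁ ∷ v₂ ∷ C)
      unique₂ v₁∉ v₂∉ v₁≢v₂ = extend-unique (∉-∷ v₁≢v₂ v₁∉) (extend-unique v₂∉ unique)

      unique₃ : ∀ {v₁ v₂ v₃} → v₁ ∉ C → v₂ ∉ C → v₃ ∉ C → v₁ ≢ v₂ → v₁ ≢ v₃ → v₂ ≢ v₃ →
                Unique (v₁ ∷ v₂ ∷ v₃ ∷ C)
      unique₃ v₁∉ v₂∉ v₃∉ v₁≢v₂ v₁≢v₃ v₂≢v₃ =
        extend-unique (∉-∷ v₁≢v₂ (∉-∷ v₁≢v₃ v₁∉)) (unique₂ v₂∉ v₃∉ v₂≢v₃)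

      insert-s : ∀ {v X q} → Unique (v ∷ X ++ C) → Path v q (v ∷ X) → x ~ v → q ~ s → Longer C
      insert-s {X = X} u p x~v q~s = grow X u (insert-after arc t~x p x~v q~s covers)

      insert-t : ∀ {v X q} → Unique (v ∷ X ++ C) → Path v q (v ∷ X) → x ~ v → q ~ t → Longer C
      insert-t {X = X} u p x~v q~t = grow X u (insert-after (rev arc) (~-sym x~s) p x~v q~t covers)

    -- The cycle runs x, s … t′, y, s′ … t and back to x; X is a path outside it from x to y.
    module Inner {y t′ s′ B D} (pB : Path s t′ B) (t′~y : t′ ~ y) (y~s′ : y ~ s′) (pD : Path s′ t D)
                 (covers′ : y ∷ B ++ D ↭ A)
                 {p q X} (pX : Path p q (p ∷ X)) (x~p : x ~ p) (q~y : q ~ y) (p∉ : p ∉ C) (q∉ : q ∉ C)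
                 (uX : Unique (p ∷ X ++ C)) where

      unique-A : Unique (y ∷ B ++ D)
      unique-A = Unique-resp-↭ (↭-sym covers′) (Unique.drop⁺ 1 (Unique-resp-↭ (↭-sym covers) unique))

      B⊆ : ∀ {z} → z ∈ B → z ∈ A
      B⊆ z∈ = ∈-resp-↭ covers′ (there (∈-++⁺ˡ z∈))

      D⊆ : ∀ {z} → z ∈ D → z ∈ A
      D⊆ z∈ = ∈-resp-↭ covers′ (there (∈-++⁺ʳ B z∈))

      y∈ : y ∈ A
      y∈ = ∈-resp-↭ covers′ (here refl)

      y≢s : y ≢ s
      y≢s = head≢ unique-A (∈-++⁺ˡ (first∈ pB))

      y≢s′ : y ≢ s′
      y≢s′ = head≢ unique-A (∈-++⁺ʳ B (first∈ pD))

      private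
        tour : (e : Expr 5) →
               normalise e ≡ normalise (var 0F ⊕ var 1F ⊕ var 2F ⊕ var 3F ⊕ var 4F) → ∀ {u v} →
               Path u v (⟦ e ⟧ ((p ∷ X) ∷ [ x ] ∷ [ y ] ∷ B ∷ D ∷ [])) → v ~ u → Longer C
        tour e eq path v~u = grow X uX (_ , _ , reorder (↭-trans
            (rearrange e (var 0F ⊕ var 1F ⊕ var 2F ⊕ var 3F ⊕ var 4F) eq
              ((p ∷ X) ∷ [ x ] ∷ [ y ] ∷ B ∷ D ∷ []))
            (++⁺ (↭-refl {x = p ∷ X}) (↭-trans (prep x covers′) covers))) path , v~u)

        -- In the claw at `x` with leaves `p`, `t`, `s`, an edge from `p` would give it a second
        -- neighbour on the cycle. There remains `t ~ s`, by which the cycle can pass over `x`.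
        bridge-x : (t ~ s → Longer C) → Longer C
        bridge-x f = claw-chord x~p (~-sym t~x) x~s
          (λ { refl → p∉ (A⊆ (D⊆ (last∈ pD))) }) (λ { refl → p∉ (A⊆ (B⊆ (first∈ pB))) })
          (λ t≡s → ++≢ (Unique.drop⁺ 1 unique-A) (first∈ pB) (last∈ pD) (≡-sym t≡s))
          (two p∉ x∈ (A⊆ t∈) (x≢ t∈) (~-sym x~p)) (two p∉ x∈ (A⊆ s∈) (x≢ s∈) (~-sym x~p)) f

        bridge-y : (s′ ~ t′ → Longer C) → Longer C
        bridge-y f = claw-chord (~-sym q~y) y~s′ (~-sym t′~y)
          (λ { refl → q∉ (A⊆ (D⊆ (first∈ pD))) }) (λ { refl → q∉ (A⊆ (B⊆ (last∈ pB))) })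
          (λ s′≡t′ → ++≢ (Unique.drop⁺ 1 unique-A) (last∈ pB) (first∈ pD) (≡-sym s′≡t′))
          (two q∉ (A⊆ y∈) (A⊆ (D⊆ (first∈ pD))) y≢s′ q~y)
          (two q∉ (A⊆ y∈) (A⊆ (B⊆ (last∈ pB))) (head≢ unique-A (∈-++⁺ˡ (last∈ pB))) q~y)
          f

      s~y⇒longer : s ~ y → Longer C
      s~y⇒longer e = bridge-y λ s′~t′ →
        tour (var 3F ⊕ var 2F ⊕ var 0F ⊕ var 1F ⊕ var 4F) refl
          (rev pB ─⟨ e ⟩─ ⟨ y ⟩ ─⟨ ~-sym q~y ⟩─ rev pX ─⟨ ~-sym x~p ⟩─ ⟨ x ⟩ ─⟨ ~-sym t~x ⟩─ rev pD) s′~t′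

      x~s′⇒longer : x ~ s′ → Longer C
      x~s′⇒longer e = bridge-x λ t~s →
        tour (var 3F ⊕ var 2F ⊕ var 0F ⊕ var 1F ⊕ var 4F) refl
          (pB ─⟨ t′~y ⟩─ ⟨ y ⟩ ─⟨ ~-sym q~y ⟩─ rev pX ─⟨ ~-sym x~p ⟩─ ⟨ x ⟩ ─⟨ e ⟩─ pD) t~s

      s~s′⇒longer : s ~ s′ → Longer C
      s~s′⇒longer e =
        tour (var 1F ⊕ var 0F ⊕ var 2F ⊕ var 3F ⊕ var 4F) refl
          (⟨ x ⟩ ─⟨ x~p ⟩─ pX ─⟨ q~y ⟩─ ⟨ y ⟩ ─⟨ ~-sym t′~y ⟩─ rev pB ─⟨ e ⟩─ pD) t~x

      -- A claw at `x` with leaves `s`, `p`, `y`: two of its chords give `p` a second neighbour on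
      -- the cycle, and the third is `s ~ y`.
      x~y⇒longer : x ~ y → Longer C
      x~y⇒longer e = claw-chord x~s x~p e
        (λ { refl → p∉ (A⊆ (B⊆ (first∈ pB))) }) (y≢s ∘ ≡-sym) (λ { refl → p∉ (A⊆ y∈) })
        (two p∉ x∈ (A⊆ s∈) (x≢ s∈) (~-sym x~p) ∘ ~-sym)
        s~y⇒longer
        (two p∉ x∈ (A⊆ y∈) (x≢ y∈) (~-sym x~p))

    -- A detour may return to the cycle after one, two or three outside vertices. One vertex has two
    -- neighbours on the cycle. Two leave room in a P₆ for a cycle edge at both ends,
    -- `s x v₁ v₂ y s′`; three for one at the start only, `s x v₁ v₂ v₃ y`. With four,
    -- `s x v₁ v₂ v₃ v₄` has six vertices before the cycle is reached again, so the list ends at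
    -- `hit₃`.
    hit₁ : ∀ {v y} → v ∉ C → x ~ v → y ∈ A → v ~ y → Longer C
    hit₁ v∉ x~v y∈ = two v∉ x∈ (A⊆ y∈) (x≢ y∈) (~-sym x~v)

    hit₂ : ∀ {v₁ v₂ y} → v₁ ∉ C → v₂ ∉ C → x ~ v₁ → v₁ ~ v₂ → ¬ x ~ v₂ → y ∈ A → v₂ ~ y → Longer C
    hit₂ {v₁} {v₂} {y} v₁∉ v₂∉ x~v₁ v₁~v₂ x≁v₂ y∈ v₂~y with locate arc y∈
    ... | only refl          = insert-s (unique₂ v₁∉ v₂∉ (~⇒≢ v₁~v₂)) (trail (v₁~v₂ ∷ [-])) x~v₁ v₂~y
    ... | initial refl _ _ _ = insert-s (unique₂ v₁∉ v₂∉ (~⇒≢ v₁~v₂)) (trail (v₁~v₂ ∷ [-])) x~v₁ v₂~y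
    ... | final refl _ _ _   = insert-t (unique₂ v₁∉ v₂∉ (~⇒≢ v₁~v₂)) (trail (v₁~v₂ ∷ [-])) x~v₁ v₂~y
    ... | inner pB t′~y y~s′ pD r =
      P₆-chord (~-sym x~s) x~v₁ v₁~v₂ v₂~y y~s′
        (hit₁ v₁∉ x~v₁ s∈ ∘ ~-sym)
        (λ s~v₂ → insert-s (unique₂ v₁∉ v₂∉ (~⇒≢ v₁~v₂)) (trail (v₁~v₂ ∷ [-])) x~v₁ (~-sym s~v₂))
        s~y⇒longer s~s′⇒longer (⊥-elim ∘ x≁v₂)
        x~y⇒longer x~s′⇒longer (hit₁ v₁∉ x~v₁ y∈) (hit₁ v₁∉ x~v₁ (D⊆ (first∈ pD)))
        (two v₂∉ (A⊆ y∈) (A⊆ (D⊆ (first∈ pD))) y≢s′ v₂~y)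
      where
      open Inner pB t′~y y~s′ pD r (trail (v₁~v₂ ∷ [-])) x~v₁ v₂~y v₁∉ v₂∉ (unique₂ v₁∉ v₂∉ (~⇒≢ v₁~v₂))
        hiding (y∈)

    hit₃ : ∀ {v₁ v₂ v₃ y} → v₁ ∉ C → v₂ ∉ C → v₃ ∉ C → x ~ v₁ → v₁ ~ v₂ → v₂ ~ v₃ →
           ¬ x ~ v₂ → ¬ x ~ v₃ → ¬ v₁ ~ v₃ → y ∈ A → v₃ ~ y → Longer C
    hit₃ {v₁} {v₂} {v₃} {y} v₁∉ v₂∉ v₃∉ x~v₁ v₁~v₂ v₂~v₃ x≁v₂ x≁v₃ v₁≁v₃ y∈ v₃~y = go (locate arc y∈)
      where
      u₃ : Unique (v₁ ∷ v₂ ∷ v₃ ∷ C)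
      u₃ = unique₃ v₁∉ v₂∉ v₃∉ (~⇒≢ v₁~v₂) (λ { refl → x≁v₃ x~v₁ }) (~⇒≢ v₂~v₃)
      p₃ : Path v₁ v₃ (v₁ ∷ v₂ ∷ v₃ ∷ [])
      p₃ = trail (v₁~v₂ ∷ v₂~v₃ ∷ [-])
      go : Position s t y A → Longer C
      go (only refl)          = insert-s u₃ p₃ x~v₁ v₃~y
      go (initial refl _ _ _) = insert-s u₃ p₃ x~v₁ v₃~y
      go (final refl _ _ _)   = insert-t u₃ p₃ x~v₁ v₃~y
      go (inner pB t′~y y~s′ pD r) =
        P₆-chord (~-sym x~s) x~v₁ v₁~v₂ v₂~v₃ v₃~y
          (hit₁ v₁∉ x~v₁ s∈ ∘ ~-sym)
          (hit₂ v₁∉ v₂∉ x~v₁ v₁~v₂ x≁v₂ s∈ ∘ ~-sym)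
          (insert-s u₃ p₃ x~v₁ ∘ ~-sym)
          s~y⇒longer (⊥-elim ∘ x≁v₂)
          (⊥-elim ∘ x≁v₃) x~y⇒longer (⊥-elim ∘ v₁≁v₃) (hit₁ v₁∉ x~v₁ y∈)
          (hit₂ v₁∉ v₂∉ x~v₁ v₁~v₂ x≁v₂ y∈)
        where
        open Inner pB t′~y y~s′ pD r p₃ x~v₁ v₃~y v₁∉ v₃∉ u₃ hiding (y∈)

    private
      _∈? : ∀ v → Dec (v ∈ C)
      v ∈? = Any.any? (v Fin.≟_) C

      in-arc : ∀ {y} → y ∈ C → y ≢ x → y ∈ A
      in-arc y∈ y≢x with ∈-resp-↭ (↭-sym covers) y∈
      ... | here y≡x = contradiction y≡x y≢x
      ... | there y∈A = y∈A

    mutual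

      -- The walk is consumed edge by edge, while all that is remembered is an induced path from `x`
      -- to the current vertex. A new vertex adjacent to an earlier one cuts that path short, and so
      -- does a repeated one, since it is adjacent to the predecessor of its earlier occurrence. The
      -- walk avoids `x`, so where it meets the cycle it meets the arc.
      leave₁ : ∀ {v₁ z} → Walk G (_≢ x) v₁ z → z ∈ C → v₁ ∉ C → x ~ v₁ → Longer C
      leave₁ (here _) z∈ v₁∉ _ = contradiction z∈ v₁∉
      leave₁ (step {v = v₂} _ v₁~v₂ w) z∈ v₁∉ x~v₁ with v₂ ∈?
      ... | yes v₂∈ = hit₁ v₁∉ x~v₁ (in-arc v₂∈ (start w)) v₁~v₂
      ... | no v₂∉ with x ~? v₂
      ...   | yes x~v₂ = leave₁ w z∈ v₂∉ x~v₂
      ...   | no x≁v₂ = leave₂ w z∈ v₁∉ v₂∉ x~v₁ v₁~v₂ x≁v₂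

      leave₂ : ∀ {v₁ v₂ z} → Walk G (_≢ x) v₂ z → z ∈ C → v₁ ∉ C → v₂ ∉ C →
               x ~ v₁ → v₁ ~ v₂ → ¬ x ~ v₂ → Longer C
      leave₂ (here _) z∈ _ v₂∉ _ _ _ = contradiction z∈ v₂∉
      leave₂ {v₁} (step {v = v₃} _ v₂~v₃ w) z∈ v₁∉ v₂∉ x~v₁ v₁~v₂ x≁v₂ with v₃ ∈?
      ... | yes v₃∈ = hit₂ v₁∉ v₂∉ x~v₁ v₁~v₂ x≁v₂ (in-arc v₃∈ (start w)) v₂~v₃
      ... | no v₃∉ with x ~? v₃ | v₁ ~? v₃
      ...   | yes x~v₃ | _ = leave₁ w z∈ v₃∉ x~v₃
      ...   | no x≁v₃ | yes v₁~v₃ = leave₂ w z∈ v₁∉ v₃∉ x~v₁ v₁~v₃ x≁v₃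
      ...   | no x≁v₃ | no v₁≁v₃ = leave₃ w z∈ v₁∉ v₂∉ v₃∉ x~v₁ v₁~v₂ v₂~v₃ x≁v₂ x≁v₃ v₁≁v₃

      leave₃ : ∀ {v₁ v₂ v₃ z} → Walk G (_≢ x) v₃ z → z ∈ C → v₁ ∉ C → v₂ ∉ C → v₃ ∉ C →
               x ~ v₁ → v₁ ~ v₂ → v₂ ~ v₃ → ¬ x ~ v₂ → ¬ x ~ v₃ → ¬ v₁ ~ v₃ → Longer C
      leave₃ (here _) z∈ _ _ v₃∉ _ _ _ _ _ _ = contradiction z∈ v₃∉
      leave₃ {v₁} {v₂} (step {v = v₄} _ v₃~v₄ w) z∈ v₁∉ v₂∉ v₃∉ x~v₁ v₁~v₂ v₂~v₃ x≁v₂ x≁v₃ v₁≁v₃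
        with v₄ ∈?
      ... | yes v₄∈ =
        hit₃ v₁∉ v₂∉ v₃∉ x~v₁ v₁~v₂ v₂~v₃ x≁v₂ x≁v₃ v₁≁v₃ (in-arc v₄∈ (start w)) v₃~v₄
      ... | no v₄∉ with x ~? v₄ | v₁ ~? v₄ | v₂ ~? v₄
      ...   | yes x~v₄ | _ | _ = leave₁ w z∈ v₄∉ x~v₄
      ...   | no x≁v₄ | yes v₁~v₄ | _ = leave₂ w z∈ v₁∉ v₄∉ x~v₁ v₁~v₄ x≁v₄
      ...   | no x≁v₄ | no v₁≁v₄ | yes v₂~v₄ =
        leave₃ w z∈ v₁∉ v₂∉ v₄∉ x~v₁ v₁~v₂ v₂~v₄ x≁v₂ x≁v₄ v₁≁v₄
      ...   | no x≁v₄ | no v₁≁v₄ | no v₂≁v₄ =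
        P₆-chord (~-sym x~s) x~v₁ v₁~v₂ v₂~v₃ v₃~v₄
          (hit₁ v₁∉ x~v₁ s∈ ∘ ~-sym)
          (hit₂ v₁∉ v₂∉ x~v₁ v₁~v₂ x≁v₂ s∈ ∘ ~-sym)
          (hit₃ v₁∉ v₂∉ v₃∉ x~v₁ v₁~v₂ v₂~v₃ x≁v₂ x≁v₃ v₁≁v₃ s∈ ∘ ~-sym)
          -- The edge `s ~ v₄` lets the four outside vertices be spliced in between `x` and `s` as
          -- they stand.
          (λ s~v₄ → insert-s
            (extend-unique (∉-∷ (~⇒≢ v₁~v₂) (∉-∷ (λ { refl → x≁v₃ x~v₁ }) (∉-∷ (λ { refl → x≁v₄ x~v₁ }) v₁∉)))
              (unique₃ v₂∉ v₃∉ v₄∉ (~⇒≢ v₂~v₃) (λ { refl → v₁≁v₄ v₁~v₂ }) (~⇒≢ v₃~v₄)))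
            (trail (v₁~v₂ ∷ v₂~v₃ ∷ v₃~v₄ ∷ [-])) x~v₁ (~-sym s~v₄))
          (⊥-elim ∘ x≁v₂) (⊥-elim ∘ x≁v₃) (⊥-elim ∘ x≁v₄) (⊥-elim ∘ v₁≁v₃) (⊥-elim ∘ v₁≁v₄)
          (⊥-elim ∘ v₂≁v₄)

-- Growing a cycle until it spans the graph.

module Hamiltonicity {n : ℕ} (G : Graph n) (claw-free : Free claw G) (P₆-free : Free (pathGraph 6) G)
                     (two-connected : TwoConnected G) where

  open Paths G
  open Attach G claw-free P₆-free

  enter : ∀ {P : Fin n → Set} {u w} {C : List (Fin n)} → Walk G P u w → u ∉ C → w ∈ C →
          ∃[ v ] ∃[ x ] (v ∉ C × x ∈ C × x ~ v)
  enter (here _) u∉ w∈ = contradiction w∈ u∉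
  enter {C = C} (step {u} {v} _ e w) u∉ w∈ with Any.any? (v Fin.≟_) C
  ... | yes v∈ = u , v , u∉ , v∈ , ~-sym e
  ... | no v∉  = enter w v∉ w∈

  -- Connectedness supplies an edge from some `x` on the cycle to a vertex `v` off it. Since
  -- deleting `x` does not disconnect the graph, a walk from `v` leads to the cycle neighbour `s` of
  -- `x` without using `x`, and along it a detour is found.
  lengthen : ∀ {C} → Unique C → Closed C → length C < n → Longer C
  lengthen {C} unique closed@(_ , _ , p , _) C<n
    with z , z∉ ← ∃-∉ C C<n
    with v , x , v∉ , x∈ , x~v ← enter (proj₁ (proj₂ two-connected) z _ _ _) z∉ (first∈ p)
    with rotation arc x~s t~x covers ← rotate closed x∈ =
    leave₁ (proj₂ (proj₂ two-connected) x v _ (λ { refl → v∉ x∈ }) (~⇒≢ x~s ∘ ≡-sym))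
      (∈-resp-↭ covers (there (first∈ arc))) v∉ x~v
    where open Attached closed unique arc x~s t~x covers

  Spanning : Set
  Spanning = ∃[ L ] (Unique L × Closed L × length L ≡ n)

  -- The number `k` bounds how many vertices are still missing and serves as fuel; one lengthening
  -- may gain several vertices, hence an inequality as invariant.
  lengthen-repeatedly : ∀ k {C} → Unique C → Closed C → n ≤ k + length C → Spanning
  lengthen-repeatedly k {C} u c n≤ with length C ℕ.<? n
  ... | no C≮n = C , u , c , ℕ.≤-antisym (Unique-length≤ u) (ℕ.≮⇒≥ C≮n)
  lengthen-repeatedly zero    u c n≤ | yes C<n = contradiction n≤ (ℕ.<⇒≱ C<n)
  lengthen-repeatedly (suc k) u c n≤ | yes C<n with lengthen u c C<n
  ... | L , u′ , c′ , C<L = lengthen-repeatedly k u′ c′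
    (ℕ.≤-trans n≤ (ℕ.≤-trans (ℕ.≤-reflexive (≡-sym (ℕ.+-suc k _))) (ℕ.+-monoʳ-≤ k C<L)))

  edge : ∃[ u ] ∃[ v ] (u ~ v)
  edge = from-three G two-connected
    where
    -- Stated for a fresh `m`, because matching on `3 ≤ m` has to refine it to expose two distinct
    -- vertices. A walk between them has at least one edge.
    from-three : ∀ {m} (H : Graph m) → TwoConnected H → ∃[ u ] ∃[ v ] Adj H u v
    from-three H (s≤s (s≤s _) , connected , _) with connected 0F 1F _ _
    ... | step _ e _ = _ , _ , e

  spanning : Spanning
  spanning with u , v , e ← edge =
    lengthen-repeatedly n {u ∷ v ∷ []} ((~⇒≢ e ∷ []) ∷ [] ∷ [])
      (u , v , trail (e ∷ [-]) , ~-sym e) (ℕ.m≤m+n n _)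

-- Decision trees: their format, their verification and the trees themselves.

-- The vertices are numbered along a path or cycle.  In found k x xs the vertices x ∷ xs form the path or
-- cycle sought, with a chord from x to the vertex at position k if one is required.
data Certificate : Set where
  split : ℕ → ℕ → Certificate → Certificate → Certificate
  claw-at : ℕ → ℕ → ℕ → ℕ → Certificate
  P₆-at : ℕ → ℕ → ℕ → ℕ → ℕ → ℕ → Certificate
  found : ℕ → ℕ → List ℕ → Certificate

steps : ℕ → List ℕ → List (ℕ × ℕ)
steps x []       = []
steps x (y ∷ ys) = (x , y) ∷ steps y ys

record Target : Set₁ where
  field
    Accept   : ℕ → ℕ → List ℕ → Set
    accept?  : ∀ k x xs → Dec (Accept k x xs)
    required : ℕ → ℕ → List ℕ → List (ℕ × ℕ)

module Check (K : ℕ) (target : Target) where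

  open Target target

  matches : ℕ → ℕ → ℕ × ℕ → Bool
  matches u v (x , y) = (u ≡ᵇ x) ∧ (v ≡ᵇ y) ∨ (u ≡ᵇ y) ∧ (v ≡ᵇ x)

  mem : List (ℕ × ℕ) → ℕ → ℕ → Bool
  mem []       u v = false
  mem (p ∷ ps) u v = matches u v p ∨ mem ps u v

  -- For the leaves of a claw. Different numbers below `K` name different vertices, as the numbering
  -- is injective there.
  apart : ℕ → ℕ → Bool
  apart u v = (u <ᵇ K) ∧ (v <ᵇ K) ∧ not (u ≡ᵇ v)

  mem-all : List (ℕ × ℕ) → List (ℕ × ℕ) → Bool
  mem-all E []             = true
  mem-all E ((u , v) ∷ ps) = mem E u v ∧ mem-all E ps

  star : ℕ → ℕ → ℕ → ℕ → List (ℕ × ℕ)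
  star a b c d = (a , b) ∷ (a , c) ∷ (a , d) ∷ []

  triple : ℕ → ℕ → ℕ → List (ℕ × ℕ)
  triple b c d = (b , c) ∷ (b , d) ∷ (c , d) ∷ []

  chords : ℕ → ℕ → ℕ → ℕ → ℕ → ℕ → List (ℕ × ℕ)
  chords a b c d e f =
    (a , c) ∷ (a , d) ∷ (a , e) ∷ (a , f) ∷ (b , d) ∷ (b , e) ∷ (b , f) ∷ (c , e) ∷ (c , f) ∷ (d , f) ∷ []

  -- `E` and `N` hold the pairs known to be adjacent and non-adjacent on the current branch; of the
  -- two subtrees of a `split`, the left one is for adjacency.
  check : (E N : List (ℕ × ℕ)) → Certificate → Bool
  check E N (split u v c d) = check ((u , v) ∷ E) N c ∧ check E ((u , v) ∷ N) d
  check E N (claw-at a b c d) =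
    mem-all E (star a b c d) ∧ mem-all N (triple b c d) ∧
    apart b c ∧ apart b d ∧ apart c d
  check E N (P₆-at a b c d e f) =
    mem-all E (steps a (b ∷ c ∷ d ∷ e ∷ f ∷ [])) ∧
    mem-all N (chords a b c d e f)
  check E N (found k x xs) = does (accept? k x xs) ∧ mem-all E (required k x xs)

  module Sound {n : ℕ} (G : Graph n) (claw-free : Free claw G) (P₆-free : Free (pathGraph 6) G)
               (f : ℕ → Fin n) (f-inj : ∀ {i j} → i < K → j < K → f i ≡ f j → i ≡ j) where

    open Paths G
    open Chords G claw-free P₆-free

    Edge NonEdge : ℕ → ℕ → Set
    Edge u v = f u ~ f v
    NonEdge u v = ¬ f u ~ f v

    module _ (P : ℕ → ℕ → Set) (P-sym : ∀ u v → P u v → P v u) where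

      matches-sound : ∀ u v p → T (matches u v p) → uncurry P p → P u v
      matches-sound u v (x , y) t Pxy with to T-∨ t
      ... | inj₁ t₁ with to T-∧ t₁
      ...   | tu , tv with refl ← ℕ.≡ᵇ⇒≡ u x tu | refl ← ℕ.≡ᵇ⇒≡ v y tv = Pxy
      matches-sound u v (x , y) t Pxy | inj₂ t₂ with to T-∧ t₂
      ...   | tu , tv with refl ← ℕ.≡ᵇ⇒≡ u y tu | refl ← ℕ.≡ᵇ⇒≡ v x tv = P-sym x y Pxy

      mem-sound : ∀ {ps} → All (uncurry P) ps → ∀ u v → T (mem ps u v) → P u v
      mem-sound {p ∷ ps} (Pp ∷ Pps) u v t with to (T-∨ {matches u v p}) t
      ... | inj₁ t₁ = matches-sound u v p t₁ Pp
      ... | inj₂ t₂ = mem-sound Pps u v t₂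

      mem-all-sound : ∀ {qs} → All (uncurry P) qs → ∀ ps → T (mem-all qs ps) → All (uncurry P) ps
      mem-all-sound Pqs [] _ = []
      mem-all-sound {qs} Pqs ((u , v) ∷ ps) t with t₁ , t₂ ← to (T-∧ {mem qs u v}) t =
        mem-sound Pqs u v t₁ ∷ mem-all-sound Pqs ps t₂

    apart-sound : ∀ {u v} → T (apart u v) → f u ≢ f v
    apart-sound {u} {v} t fu≡fv
      with tu , t′ ← to (T-∧ {u <ᵇ K}) t
      with tv , t″ ← to (T-∧ {v <ᵇ K}) t′
      with refl ← f-inj (ℕ.<ᵇ⇒< u K tu) (ℕ.<ᵇ⇒< v K tv) fu≡fv = subst T (cong not (to T-≡ (ℕ.≡⇒≡ᵇ u u refl))) t″

    Outcome : Set
    Outcome = ∃[ k ] ∃[ x ] ∃[ xs ] (Accept k x xs × All (uncurry Edge) (required k x xs))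

    -- Only the branch dictated by the actual adjacencies of `G` is followed. It cannot end at a
    -- claw or a P₆, so it ends at a `found` leaf.
    check-sound : ∀ {E N} → All (uncurry Edge) E → All (uncurry NonEdge) N → ∀ c → T (check E N c) → Outcome
    check-sound {E} {N} AE AN = go
      where
      in-E : ∀ ps → T (mem-all E ps) → All (uncurry Edge) ps
      in-E = mem-all-sound Edge (λ _ _ → ~-sym) AE

      in-N : ∀ ps → T (mem-all N ps) → All (uncurry NonEdge) ps
      in-N = mem-all-sound NonEdge (λ _ _ → _∘ ~-sym) AN

      go : ∀ c → T (check E N c) → Outcome
      go (split u v c d) t with f u ~? f v | to (T-∧ {check ((u , v) ∷ E) N c}) t
      ... | yes u~v | t₁ , _ = check-sound (u~v ∷ AE) AN c t₁
      ... | no u≁v  | _ , t₂ = check-sound AE (u≁v ∷ AN) d t₂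
      go (claw-at a b c d) t
        with tE , t₁ ← to (T-∧ {mem-all E (star a b c d)}) t
        with tN , t₂ ← to (T-∧ {mem-all N (triple b c d)}) t₁
        with bc≢ , t₃ ← to (T-∧ {apart b c}) t₂
        with bd≢ , cd≢ ← to (T-∧ {apart b d}) t₃
        with ab ∷ ac ∷ ad ∷ [] ← in-E (star a b c d) tE
        with bc ∷ bd ∷ cd ∷ [] ← in-N (triple b c d) tN =
        claw-chord ab ac ad (apart-sound bc≢) (apart-sound bd≢) (apart-sound cd≢)
          (⊥-elim ∘ bc) (⊥-elim ∘ bd) (⊥-elim ∘ cd)
      go (P₆-at a b c d e f) t
        with tE , tN ← to (T-∧ {mem-all E (steps a (b ∷ c ∷ d ∷ e ∷ f ∷ []))}) t
        with ab ∷ bc ∷ cd ∷ de ∷ ef ∷ [] ← in-E (steps a (b ∷ c ∷ d ∷ e ∷ f ∷ [])) tE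
        with ac ∷ ad ∷ ae ∷ af ∷ bd ∷ be ∷ bf ∷ ce ∷ cf ∷ df ∷ [] ← in-N (chords a b c d e f) tN =
        P₆-chord ab bc cd de ef (⊥-elim ∘ ac) (⊥-elim ∘ ad) (⊥-elim ∘ ae) (⊥-elim ∘ af) (⊥-elim ∘ bd)
          (⊥-elim ∘ be) (⊥-elim ∘ bf) (⊥-elim ∘ ce) (⊥-elim ∘ cf) (⊥-elim ∘ df)
      go (found k x xs) t with ta , tr ← to (T-∧ {does (accept? k x xs)}) t =
        k , x , xs , toWitness (subst T (≡-sym (isYes≗does (accept? k x xs))) ta) , in-E (required k x xs) tr

-- The window of nine vertices is numbered 0 to 8 and keeps both ends, while one inner vertex is
-- dropped: one start plus seven further vertices. The chord position is ignored.
shortcut : Target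
shortcut = record
  { Accept   = λ _ x xs → Unique (x ∷ xs) × All (_< 9) (x ∷ xs) × x ≡ 0 × lastOf x xs ≡ 8 × length xs ≡ 7
  ; accept?  = λ _ x xs → unique? (x ∷ xs) ×-dec All.all? (ℕ._<? 9) (x ∷ xs) ×-dec x ℕ.≟ 0 ×-dec
                          lastOf x xs ℕ.≟ 8 ×-dec length xs ℕ.≟ 7
  ; required = λ _ → steps
  }

-- A cycle can be written starting at an end of its chord, so one position `k` describes the chord.
-- The bounds on `k` exclude the two cyclic neighbours of position 0, the second being the last
-- position `L - 1`.
chorded : (K L : ℕ) → Target
chorded K L = record
  { Accept   = λ k x xs → Unique (x ∷ xs) × All (_< K) (x ∷ xs) × length (x ∷ xs) ≡ L × 2 ≤ k × suc k < L
  ; accept?  = λ k x xs → unique? (x ∷ xs) ×-dec All.all? (ℕ._<? K) (x ∷ xs) ×-dec length (x ∷ xs) ℕ.≟ L ×-dec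
                          2 ℕ.≤? k ×-dec suc k ℕ.<? L
  ; required = λ k x xs → (lastOf x xs , x) ∷ (x , at x (x ∷ xs) k) ∷ steps x xs
  }

-- Here `K` is the last index, one less than the number of vertices. Pairs at distance two that
-- reach across the starting point are left out of `span-pairs`.
cycle-edges span-pairs : ℕ → List (ℕ × ℕ)
cycle-edges K = (K , 0) ∷ applyUpTo (λ i → i , suc i) K
span-pairs K = applyUpTo (λ i → i , 2 + i) (K ∸ 1)

-- The first seven splits are the pairs at distance two, where an edge skips a single vertex at
-- once. The remainder of the tree may therefore use all of them as non-edges.
shortcut-certificate : Certificate
shortcut-certificate =
  split 6 8 (found 0 0 (1 ∷ 2 ∷ 3 ∷ 4 ∷ 5 ∷ 6 ∷ 8 ∷ [])) (split 5 7 (found 0 0 (1 ∷ 2 ∷ 3 ∷ 4 ∷ 5 ∷ 7 ∷ 8 ∷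
  [])) (split 4 6 (found 0 0 (1 ∷ 2 ∷ 3 ∷ 4 ∷ 6 ∷ 7 ∷ 8 ∷ [])) (split 3 5 (found 0 0 (1 ∷ 2 ∷ 3 ∷ 5 ∷ 6 ∷ 7 ∷
  8 ∷ [])) (split 2 4 (found 0 0 (1 ∷ 2 ∷ 4 ∷ 5 ∷ 6 ∷ 7 ∷ 8 ∷ [])) (split 1 3 (found 0 0 (1 ∷ 3 ∷ 4 ∷ 5 ∷ 6 ∷
  7 ∷ 8 ∷ [])) (split 0 2 (found 0 0 (2 ∷ 3 ∷ 4 ∷ 5 ∷ 6 ∷ 7 ∷ 8 ∷ [])) (split 3 6 (split 2 6 (split 3 7 (split
  1 5 (found 0 0 (1 ∷ 5 ∷ 4 ∷ 3 ∷ 6 ∷ 7 ∷ 8 ∷ [])) (split 2 5 (claw-at 2 1 3 5) (split 1 4 (claw-at 4 1 3 5)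
  (split 0 4 (found 0 0 (4 ∷ 5 ∷ 6 ∷ 2 ∷ 3 ∷ 7 ∷ 8 ∷ [])) (split 0 5 (found 0 0 (5 ∷ 4 ∷ 3 ∷ 2 ∷ 6 ∷ 7 ∷ 8 ∷
  [])) (split 0 3 (claw-at 3 0 2 4) (P₆-at 0 1 2 3 4 5))))))) (claw-at 6 3 5 7)) (claw-at 3 2 4 6)) (split 2 6
  (split 1 6 (split 3 8 (found 0 0 (1 ∷ 2 ∷ 6 ∷ 5 ∷ 4 ∷ 3 ∷ 8 ∷ [])) (split 4 7 (found 0 0 (1 ∷ 2 ∷ 6 ∷ 5 ∷ 4
  ∷ 7 ∷ 8 ∷ [])) (split 3 7 (claw-at 7 3 6 8) (split 5 8 (found 0 0 (1 ∷ 6 ∷ 2 ∷ 3 ∷ 4 ∷ 5 ∷ 8 ∷ [])) (split 4 8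
  (claw-at 4 3 5 8) (P₆-at 3 4 5 6 7 8)))))) (claw-at 2 1 3 6)) (split 2 5 (claw-at 5 2 4 6) (split 1 5 (split 0 5
  (split 2 7 (found 0 0 (1 ∷ 5 ∷ 4 ∷ 3 ∷ 2 ∷ 7 ∷ 8 ∷ [])) (split 4 7 (found 0 0 (5 ∷ 1 ∷ 2 ∷ 3 ∷ 4 ∷ 7 ∷ 8 ∷
  [])) (split 3 7 (claw-at 3 2 4 7) (P₆-at 2 3 4 5 6 7)))) (claw-at 1 0 2 5)) (split 1 4 (claw-at 4 1 3 5) (split 1
  6 (split 1 7 (split 0 4 (found 0 0 (4 ∷ 3 ∷ 2 ∷ 1 ∷ 6 ∷ 7 ∷ 8 ∷ [])) (split 0 3 (claw-at 3 0 2 4) (split 0 5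
  (found 0 0 (5 ∷ 4 ∷ 3 ∷ 2 ∷ 1 ∷ 7 ∷ 8 ∷ [])) (P₆-at 0 1 2 3 4 5)))) (claw-at 6 1 5 7)) (P₆-at 1 2 3 4 5
  6)))))))))))))

-- A chorded 4-cycle is a pair of triangles with a common edge. The triangle 0 1 2 is given, and the
-- first four splits ask whether 3 or 9, its neighbours along the cycle, is adjacent to a second
-- vertex of it.
spanned-certificate-4 : Certificate
spanned-certificate-4 =
  split 0 3 (found 2 0 (1 ∷ 2 ∷ 3 ∷ [])) (split 2 9 (found 2 0 (1 ∷ 2 ∷ 9 ∷ [])) (split 1 3 (found 2 1 (3 ∷ 2
  ∷ 0 ∷ [])) (split 1 9 (found 2 0 (2 ∷ 1 ∷ 9 ∷ [])) (split 0 4 (split 1 4 (found 2 0 (2 ∷ 1 ∷ 4 ∷ [])) (split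
  4 9 (split 3 9 (found 2 4 (3 ∷ 9 ∷ 0 ∷ [])) (split 5 9 (found 2 4 (5 ∷ 9 ∷ 0 ∷ [])) (split 0 8 (found 2 0 (4
  ∷ 9 ∷ 8 ∷ [])) (split 0 5 (found 2 0 (5 ∷ 4 ∷ 9 ∷ [])) (split 3 5 (split 2 5 (found 2 3 (4 ∷ 5 ∷ 2 ∷ []))
  (split 3 6 (found 2 3 (4 ∷ 5 ∷ 6 ∷ [])) (split 4 6 (found 2 4 (6 ∷ 5 ∷ 3 ∷ [])) (split 0 6 (split 1 6 (found
  2 0 (2 ∷ 1 ∷ 6 ∷ [])) (claw-at 0 1 4 6)) (split 2 6 (claw-at 2 0 3 6) (split 6 9 (split 6 8 (found 2 6 (7 ∷ 8 ∷
  9 ∷ [])) (claw-at 9 0 6 8)) (P₆-at 6 5 3 2 0 9))))))) (claw-at 4 0 3 5)))))) (claw-at 0 1 4 9))) (split 0 5 (split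
  2 5 (found 2 0 (1 ∷ 2 ∷ 5 ∷ [])) (split 1 5 (found 2 0 (2 ∷ 1 ∷ 5 ∷ [])) (split 5 9 (split 4 9 (found 2 5 (4
  ∷ 9 ∷ 0 ∷ [])) (split 0 6 (found 2 0 (6 ∷ 5 ∷ 9 ∷ [])) (split 4 6 (split 3 6 (found 2 4 (5 ∷ 6 ∷ 3 ∷ []))
  (split 3 5 (found 2 4 (6 ∷ 5 ∷ 3 ∷ [])) (split 4 7 (found 2 4 (5 ∷ 6 ∷ 7 ∷ [])) (split 5 7 (found 2 5 (7 ∷ 6
  ∷ 4 ∷ [])) (split 2 6 (claw-at 2 0 3 6) (split 1 4 (claw-at 4 1 3 5) (split 2 7 (split 0 7 (found 2 0 (1 ∷ 2 ∷ 7
  ∷ [])) (split 1 7 (found 2 1 (7 ∷ 2 ∷ 0 ∷ [])) (split 3 7 (P₆-at 1 0 5 4 3 7) (claw-at 2 0 3 7)))) (split 0 7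
  (claw-at 0 2 5 7) (split 3 7 (split 2 4 (split 1 7 (split 7 9 (split 3 9 (found 2 7 (8 ∷ 9 ∷ 3 ∷ [])) (claw-at 7
  1 3 9)) (P₆-at 7 1 2 4 5 9)) (P₆-at 1 0 5 4 3 7)) (claw-at 3 2 4 7)) (P₆-at 3 2 0 5 6 7)))))))))) (claw-at 5 0 4
  6)))) (claw-at 0 1 5 9)))) (split 2 5 (split 3 5 (found 2 3 (4 ∷ 5 ∷ 2 ∷ [])) (claw-at 2 0 3 5)) (split 0 6
  (split 1 6 (found 2 0 (2 ∷ 1 ∷ 6 ∷ [])) (split 6 9 (split 5 9 (found 2 6 (5 ∷ 9 ∷ 0 ∷ [])) (split 7 9 (found
  2 6 (7 ∷ 9 ∷ 0 ∷ [])) (split 0 8 (found 2 0 (6 ∷ 9 ∷ 8 ∷ [])) (split 0 7 (found 2 0 (7 ∷ 6 ∷ 9 ∷ [])) (split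
  5 7 (split 5 8 (found 2 5 (6 ∷ 7 ∷ 8 ∷ [])) (split 2 8 (split 3 8 (split 2 7 (found 2 2 (3 ∷ 8 ∷ 7 ∷ []))
  (claw-at 8 2 7 9)) (claw-at 2 0 3 8)) (split 2 7 (claw-at 7 2 5 8) (P₆-at 2 0 9 8 7 5)))) (claw-at 6 0 5 7))))))
  (claw-at 0 1 6 9))) (split 2 6 (split 3 6 (split 3 5 (found 2 3 (5 ∷ 6 ∷ 2 ∷ [])) (split 2 7 (found 2 2 (3 ∷ 6
  ∷ 7 ∷ [])) (split 3 7 (found 2 3 (7 ∷ 6 ∷ 2 ∷ [])) (split 2 4 (found 2 2 (4 ∷ 3 ∷ 6 ∷ [])) (split 5 7 (split
  4 7 (found 2 5 (6 ∷ 7 ∷ 4 ∷ [])) (split 0 7 (split 7 9 (found 2 7 (8 ∷ 9 ∷ 0 ∷ [])) (claw-at 0 2 7 9)) (P₆-at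
  0 2 3 4 5 7))) (claw-at 6 2 5 7)))))) (claw-at 2 0 3 6)) (split 0 7 (split 1 7 (found 2 0 (2 ∷ 1 ∷ 7 ∷ []))
  (split 7 9 (found 2 7 (8 ∷ 9 ∷ 0 ∷ [])) (claw-at 0 1 7 9))) (split 2 7 (split 3 7 (split 4 7 (found 2 3 (4 ∷ 7
  ∷ 2 ∷ [])) (split 2 8 (found 2 2 (3 ∷ 7 ∷ 8 ∷ [])) (split 2 4 (found 2 2 (4 ∷ 3 ∷ 7 ∷ [])) (split 6 8 (split
  5 7 (found 2 6 (8 ∷ 7 ∷ 5 ∷ [])) (split 6 9 (found 2 6 (7 ∷ 8 ∷ 9 ∷ [])) (split 7 9 (found 2 7 (9 ∷ 8 ∷ 6 ∷
  [])) (split 4 6 (split 5 9 (split 4 9 (found 2 4 (6 ∷ 5 ∷ 9 ∷ [])) (P₆-at 4 5 9 0 2 7)) (P₆-at 5 6 7 2 0 9))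
  (P₆-at 0 2 7 6 5 4))))) (claw-at 7 2 6 8))))) (claw-at 2 0 3 7)) (split 2 8 (split 7 9 (split 0 8 (found 2 0 (1
  ∷ 2 ∷ 8 ∷ [])) (split 3 8 (split 6 9 (found 2 7 (8 ∷ 9 ∷ 6 ∷ [])) (split 3 7 (found 2 3 (7 ∷ 8 ∷ 2 ∷ []))
  (split 3 9 (found 2 3 (9 ∷ 8 ∷ 2 ∷ [])) (split 2 4 (found 2 2 (4 ∷ 3 ∷ 8 ∷ [])) (split 3 6 (split 4 6 (found
  2 4 (5 ∷ 6 ∷ 3 ∷ [])) (claw-at 3 2 4 6)) (P₆-at 3 2 0 9 7 6)))))) (claw-at 2 0 3 8))) (claw-at 8 2 7 9)) (split 0
  8 (split 5 7 (split 4 7 (found 2 5 (6 ∷ 7 ∷ 4 ∷ [])) (split 4 6 (found 2 5 (7 ∷ 6 ∷ 4 ∷ [])) (split 5 8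
  (found 2 5 (6 ∷ 7 ∷ 8 ∷ [])) (split 6 8 (found 2 6 (8 ∷ 7 ∷ 5 ∷ [])) (split 4 8 (claw-at 8 0 4 7) (split 2 4
  (P₆-at 4 2 0 8 7 6) (P₆-at 2 0 8 7 5 4))))))) (split 5 8 (claw-at 8 0 5 7) (split 6 8 (split 3 7 (split 3 5
  (claw-at 3 2 5 7) (split 3 6 (found 2 6 (8 ∷ 7 ∷ 3 ∷ [])) (P₆-at 0 2 3 7 6 5))) (split 3 8 (claw-at 8 0 3 7)
  (split 3 5 (P₆-at 5 3 2 0 8 7) (split 3 6 (claw-at 6 3 5 7) (P₆-at 3 2 0 8 6 5))))) (P₆-at 2 0 8 7 6 5))))
  (split 6 8 (split 5 8 (found 2 6 (7 ∷ 8 ∷ 5 ∷ [])) (split 6 9 (found 2 6 (7 ∷ 8 ∷ 9 ∷ [])) (split 5 9 (claw-at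
  9 0 5 8) (P₆-at 2 0 9 8 6 5)))) (split 6 9 (claw-at 9 0 6 8) (split 7 9 (split 3 8 (split 3 6 (claw-at 3 2 6 8)
  (split 3 7 (found 2 7 (9 ∷ 8 ∷ 3 ∷ [])) (P₆-at 0 2 3 8 7 6))) (split 3 9 (claw-at 9 0 3 8) (split 3 6 (P₆-at 6
  3 2 0 9 8) (split 3 7 (claw-at 7 3 6 8) (P₆-at 3 2 0 9 7 6))))) (P₆-at 2 0 9 8 7 6))))))))))))))))

span-free-certificate-4 : Certificate
span-free-certificate-4 =
  split 1 4 (split 0 4 (split 1 5 (found 2 1 (5 ∷ 4 ∷ 0 ∷ [])) (claw-at 4 1 3 5)) (claw-at 1 0 2 4)) (split 1 5
  (split 1 6 (split 0 5 (found 2 1 (6 ∷ 5 ∷ 0 ∷ [])) (split 2 5 (found 2 1 (2 ∷ 5 ∷ 6 ∷ [])) (claw-at 1 0 2 5)))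
  (claw-at 5 1 4 6)) (split 2 5 (claw-at 2 1 3 5) (split 2 6 (split 2 7 (split 1 6 (found 2 2 (7 ∷ 6 ∷ 1 ∷ []))
  (split 3 6 (found 2 2 (3 ∷ 6 ∷ 7 ∷ [])) (claw-at 2 1 3 6))) (claw-at 6 2 5 7)) (split 3 6 (claw-at 3 2 4 6) (split
  1 6 (split 0 6 (split 1 7 (found 2 1 (7 ∷ 6 ∷ 0 ∷ [])) (claw-at 6 1 5 7)) (claw-at 1 0 2 6)) (P₆-at 1 2 3 4 5
  6))))))

-- The first three splits are the edges that close five consecutive vertices of the 11-cycle, among
-- them 0, 1 and 2, into a 5-cycle with chord 0 2.
spanned-certificate-5 : Certificate
spanned-certificate-5 =
  split 0 4 (found 2 0 (1 ∷ 2 ∷ 3 ∷ 4 ∷ [])) (split 3 10 (found 2 0 (1 ∷ 2 ∷ 3 ∷ 10 ∷ [])) (split 2 9 (found 2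
  0 (1 ∷ 2 ∷ 9 ∷ 10 ∷ [])) (split 1 4 (found 3 1 (4 ∷ 3 ∷ 2 ∷ 0 ∷ [])) (split 1 9 (found 2 0 (2 ∷ 1 ∷ 9 ∷ 10 ∷
  [])) (split 0 3 (split 0 5 (found 2 0 (2 ∷ 3 ∷ 4 ∷ 5 ∷ [])) (split 4 10 (found 2 0 (2 ∷ 3 ∷ 4 ∷ 10 ∷ []))
  (split 3 9 (found 2 0 (2 ∷ 3 ∷ 9 ∷ 10 ∷ [])) (split 1 10 (found 2 0 (3 ∷ 2 ∷ 1 ∷ 10 ∷ [])) (split 1 3 (split
  1 5 (found 3 1 (5 ∷ 4 ∷ 3 ∷ 0 ∷ [])) (split 0 6 (split 3 6 (found 2 0 (1 ∷ 2 ∷ 3 ∷ 6 ∷ [])) (split 4 6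
  (found 2 0 (1 ∷ 3 ∷ 4 ∷ 6 ∷ [])) (split 3 5 (found 2 0 (1 ∷ 3 ∷ 5 ∷ 6 ∷ [])) (split 1 6 (found 2 0 (2 ∷ 3 ∷
  1 ∷ 6 ∷ [])) (split 6 10 (split 5 10 (split 5 9 (found 3 6 (5 ∷ 9 ∷ 10 ∷ 0 ∷ [])) (split 6 9 (found 3 6 (7 ∷
  8 ∷ 9 ∷ 10 ∷ [])) (split 0 9 (claw-at 0 1 6 9) (claw-at 10 0 5 9)))) (P₆-at 1 3 4 5 6 10)) (claw-at 0 1 6 10))))))
  (split 4 6 (split 1 6 (found 3 1 (6 ∷ 4 ∷ 3 ∷ 0 ∷ [])) (split 3 7 (found 2 4 (5 ∷ 6 ∷ 7 ∷ 3 ∷ [])) (split 4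
  8 (found 2 4 (5 ∷ 6 ∷ 7 ∷ 8 ∷ [])) (split 5 8 (found 3 5 (8 ∷ 7 ∷ 6 ∷ 4 ∷ [])) (split 0 8 (split 3 8 (found
  2 0 (1 ∷ 2 ∷ 3 ∷ 8 ∷ [])) (split 1 8 (found 2 0 (1 ∷ 8 ∷ 9 ∷ 10 ∷ [])) (split 1 7 (found 2 0 (2 ∷ 1 ∷ 7 ∷ 8
  ∷ [])) (split 0 7 (found 2 0 (7 ∷ 8 ∷ 9 ∷ 10 ∷ [])) (split 7 9 (found 2 8 (7 ∷ 9 ∷ 10 ∷ 0 ∷ [])) (split 0 9
  (split 4 9 (found 2 0 (1 ∷ 3 ∷ 4 ∷ 9 ∷ [])) (split 6 9 (found 3 8 (7 ∷ 6 ∷ 9 ∷ 0 ∷ [])) (split 4 7 (P₆-at 1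
  3 4 7 8 9) (split 6 8 (split 3 6 (found 2 0 (1 ∷ 3 ∷ 6 ∷ 8 ∷ [])) (P₆-at 7 6 4 3 0 9)) (P₆-at 1 0 8 7 6
  4))))) (claw-at 8 0 7 9))))))) (split 3 8 (claw-at 3 0 4 8) (split 8 10 (split 5 10 (claw-at 10 0 5 8) (split 1 8
  (found 2 8 (9 ∷ 10 ∷ 0 ∷ 1 ∷ [])) (split 0 7 (found 2 8 (9 ∷ 10 ∷ 0 ∷ 7 ∷ [])) (split 6 10 (found 2 8 (9 ∷
  10 ∷ 6 ∷ 7 ∷ [])) (split 6 8 (P₆-at 1 0 10 8 6 4) (split 3 5 (split 1 7 (claw-at 7 1 6 8) (split 4 7 (found 2
  4 (7 ∷ 6 ∷ 5 ∷ 3 ∷ [])) (split 7 10 (P₆-at 1 0 10 7 6 4) (P₆-at 0 10 8 7 6 4)))) (P₆-at 5 4 3 0 10 8)))))))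
  (split 4 9 (claw-at 9 4 8 10) (split 0 9 (split 0 7 (found 3 0 (7 ∷ 8 ∷ 9 ∷ 10 ∷ [])) (split 7 10 (found 3 9
  (8 ∷ 7 ∷ 10 ∷ 0 ∷ [])) (split 4 7 (P₆-at 8 7 4 3 0 10) (split 6 10 (claw-at 6 4 7 10) (split 7 9 (split 1 7
  (P₆-at 4 3 1 7 9 10) (split 3 6 (split 6 9 (found 2 0 (1 ∷ 3 ∷ 6 ∷ 9 ∷ [])) (P₆-at 1 0 9 7 6 4)) (P₆-at 7 6
  4 3 0 10))) (P₆-at 4 3 0 9 8 7)))))) (P₆-at 4 3 0 10 9 8)))))))))) (split 3 6 (claw-at 3 0 4 6) (split 6 10
  (split 1 6 (found 2 0 (2 ∷ 1 ∷ 6 ∷ 10 ∷ [])) (split 6 9 (found 3 6 (7 ∷ 8 ∷ 9 ∷ 10 ∷ [])) (split 5 10 (split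
  4 9 (P₆-at 1 3 4 9 10 6) (split 5 9 (claw-at 5 4 6 9) (split 3 5 (found 2 0 (1 ∷ 3 ∷ 5 ∷ 10 ∷ [])) (P₆-at 1 3
  4 5 10 9)))) (P₆-at 1 0 10 6 5 4)))) (split 5 10 (claw-at 5 4 6 10) (split 1 6 (P₆-at 4 5 6 1 0 10) (split 3 5
  (split 3 7 (found 2 3 (4 ∷ 5 ∷ 6 ∷ 7 ∷ [])) (split 4 7 (found 3 4 (7 ∷ 6 ∷ 5 ∷ 3 ∷ [])) (split 0 7 (split 7
  10 (found 3 7 (8 ∷ 9 ∷ 10 ∷ 0 ∷ [])) (claw-at 0 3 7 10)) (split 7 10 (P₆-at 4 3 0 10 7 6) (split 5 7 (split 1
  7 (P₆-at 4 5 7 1 0 10) (split 3 8 (found 2 3 (4 ∷ 5 ∷ 7 ∷ 8 ∷ [])) (split 4 8 (found 3 4 (8 ∷ 7 ∷ 5 ∷ 3 ∷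
  [])) (split 5 9 (found 2 5 (6 ∷ 7 ∷ 8 ∷ 9 ∷ [])) (split 6 9 (found 3 6 (9 ∷ 8 ∷ 7 ∷ 5 ∷ [])) (split 7 9
  (P₆-at 1 3 5 7 9 10) (split 0 9 (split 1 8 (claw-at 8 1 7 9) (split 4 9 (P₆-at 1 0 9 4 5 6) (split 5 8 (split
  0 8 (found 2 0 (1 ∷ 3 ∷ 5 ∷ 8 ∷ [])) (P₆-at 4 3 0 9 8 7)) (P₆-at 1 3 5 7 8 9)))) (P₆-at 6 5 3 0 10 9))))))))
  (P₆-at 7 6 5 3 0 10)))))) (P₆-at 6 5 4 3 0 10))))))))) (claw-at 0 1 3 10)))))) (split 0 5 (split 3 5 (found 2
  0 (1 ∷ 2 ∷ 3 ∷ 5 ∷ [])) (split 2 4 (found 2 0 (1 ∷ 2 ∷ 4 ∷ 5 ∷ [])) (split 2 6 (found 2 0 (1 ∷ 2 ∷ 6 ∷ 5 ∷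
  [])) (split 2 5 (found 3 2 (3 ∷ 4 ∷ 5 ∷ 0 ∷ [])) (split 2 10 (split 5 10 (found 2 0 (1 ∷ 2 ∷ 10 ∷ 5 ∷ []))
  (split 0 9 (found 2 0 (1 ∷ 2 ∷ 10 ∷ 9 ∷ [])) (split 4 10 (found 3 2 (3 ∷ 4 ∷ 10 ∷ 0 ∷ [])) (split 3 9 (found
  3 2 (3 ∷ 9 ∷ 10 ∷ 0 ∷ [])) (split 5 9 (found 2 0 (2 ∷ 10 ∷ 9 ∷ 5 ∷ [])) (split 4 9 (claw-at 4 3 5 9) (P₆-at 3
  4 5 0 10 9))))))) (split 5 10 (split 4 9 (found 3 5 (4 ∷ 9 ∷ 10 ∷ 0 ∷ [])) (split 7 10 (found 3 5 (6 ∷ 7 ∷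
  10 ∷ 0 ∷ [])) (split 6 9 (found 3 5 (6 ∷ 9 ∷ 10 ∷ 0 ∷ [])) (split 0 7 (found 3 0 (7 ∷ 6 ∷ 5 ∷ 10 ∷ []))
  (split 3 9 (claw-at 3 2 4 9) (split 4 6 (split 6 10 (found 2 5 (4 ∷ 6 ∷ 10 ∷ 0 ∷ [])) (split 4 10 (found 2 5
  (6 ∷ 4 ∷ 10 ∷ 0 ∷ [])) (split 0 6 (found 3 0 (6 ∷ 4 ∷ 5 ∷ 10 ∷ [])) (split 3 7 (found 2 4 (5 ∷ 6 ∷ 7 ∷ 3 ∷
  [])) (split 2 7 (claw-at 2 0 3 7) (split 3 6 (P₆-at 7 6 3 2 0 10) (P₆-at 6 4 3 2 0 10))))))) (split 0 6 (split
  5 9 (claw-at 5 4 6 9) (split 4 10 (found 2 0 (6 ∷ 5 ∷ 4 ∷ 10 ∷ [])) (P₆-at 2 3 4 5 10 9))) (claw-at 5 0 4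
  6)))))))) (claw-at 0 2 5 10))))))) (split 2 5 (split 3 5 (split 0 6 (found 2 0 (1 ∷ 2 ∷ 5 ∷ 6 ∷ [])) (split 5
  10 (found 2 0 (1 ∷ 2 ∷ 5 ∷ 10 ∷ [])) (split 1 6 (found 3 1 (6 ∷ 5 ∷ 2 ∷ 0 ∷ [])) (split 1 5 (found 3 2 (3 ∷
  4 ∷ 5 ∷ 1 ∷ [])) (split 1 3 (found 3 2 (5 ∷ 4 ∷ 3 ∷ 1 ∷ [])) (split 2 6 (found 3 2 (3 ∷ 4 ∷ 5 ∷ 6 ∷ []))
  (split 4 6 (found 2 4 (6 ∷ 5 ∷ 2 ∷ 3 ∷ [])) (split 2 4 (split 2 7 (found 2 2 (3 ∷ 5 ∷ 6 ∷ 7 ∷ [])) (split 3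
  7 (found 3 3 (7 ∷ 6 ∷ 5 ∷ 2 ∷ [])) (split 3 6 (found 3 2 (3 ∷ 6 ∷ 5 ∷ 4 ∷ [])) (split 6 9 (split 3 9 (found
  3 3 (9 ∷ 6 ∷ 5 ∷ 2 ∷ [])) (split 5 9 (found 3 6 (7 ∷ 8 ∷ 9 ∷ 5 ∷ [])) (split 6 10 (found 3 6 (7 ∷ 8 ∷ 9 ∷ 10
  ∷ [])) (split 0 9 (P₆-at 1 0 9 6 5 3) (P₆-at 0 10 9 6 5 3))))) (split 5 9 (claw-at 5 2 6 9) (split 0 9 (split
  3 9 (P₆-at 1 0 9 3 5 6) (split 2 8 (found 2 0 (1 ∷ 2 ∷ 8 ∷ 9 ∷ [])) (split 1 8 (found 3 0 (1 ∷ 8 ∷ 9 ∷ 10 ∷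
  [])) (split 0 7 (found 3 0 (7 ∷ 8 ∷ 9 ∷ 10 ∷ [])) (split 7 9 (P₆-at 3 2 0 9 7 6) (split 3 8 (claw-at 8 3 7 9)
  (split 5 7 (split 0 8 (split 1 7 (P₆-at 3 2 1 7 8 9) (split 5 8 (found 2 0 (1 ∷ 2 ∷ 5 ∷ 8 ∷ [])) (P₆-at 1 0
  8 7 5 3))) (P₆-at 3 2 0 9 8 7)) (P₆-at 7 6 5 2 0 9)))))))) (split 6 10 (claw-at 10 0 6 9) (split 3 9 (P₆-at 0
  10 9 3 5 6) (split 2 10 (split 2 8 (found 3 2 (8 ∷ 9 ∷ 10 ∷ 0 ∷ [])) (split 0 8 (found 2 0 (2 ∷ 10 ∷ 9 ∷ 8 ∷
  [])) (split 7 10 (split 7 9 (split 0 7 (found 2 0 (1 ∷ 2 ∷ 10 ∷ 7 ∷ [])) (split 5 7 (found 3 2 (5 ∷ 7 ∷ 10 ∷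
  0 ∷ [])) (P₆-at 0 2 5 6 7 9))) (claw-at 10 2 7 9)) (split 7 9 (P₆-at 3 2 10 9 7 6) (split 3 8 (claw-at 8 3 7 9)
  (split 5 7 (split 0 7 (P₆-at 3 2 0 7 8 9) (split 8 10 (split 5 8 (found 3 2 (5 ∷ 8 ∷ 10 ∷ 0 ∷ [])) (P₆-at 0
  2 5 7 8 9)) (P₆-at 3 2 10 9 8 7))) (P₆-at 7 6 5 2 10 9))))))) (P₆-at 6 5 2 0 10 9)))))))))) (claw-at 5 2 4
  6))))))))) (claw-at 2 0 3 5)) (split 0 6 (split 3 6 (found 2 0 (1 ∷ 2 ∷ 3 ∷ 6 ∷ [])) (split 2 7 (found 2 0 (1
  ∷ 2 ∷ 7 ∷ 6 ∷ [])) (split 1 7 (found 2 0 (2 ∷ 1 ∷ 7 ∷ 6 ∷ [])) (split 0 7 (split 1 8 (found 3 0 (1 ∷ 8 ∷ 7 ∷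
  6 ∷ [])) (split 1 6 (found 2 0 (2 ∷ 1 ∷ 6 ∷ 7 ∷ [])) (split 5 8 (found 3 6 (5 ∷ 8 ∷ 7 ∷ 0 ∷ [])) (split 8 10
  (found 2 0 (6 ∷ 7 ∷ 8 ∷ 10 ∷ [])) (split 7 9 (found 2 0 (6 ∷ 7 ∷ 9 ∷ 10 ∷ [])) (split 6 9 (found 3 6 (9 ∷ 8
  ∷ 7 ∷ 0 ∷ [])) (split 5 10 (found 2 0 (7 ∷ 6 ∷ 5 ∷ 10 ∷ [])) (split 0 8 (found 2 0 (7 ∷ 8 ∷ 9 ∷ 10 ∷ []))
  (split 7 10 (found 3 7 (8 ∷ 9 ∷ 10 ∷ 0 ∷ [])) (split 1 10 (split 6 8 (claw-at 6 0 5 8) (split 5 7 (claw-at 7 0 5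
  8) (split 6 10 (claw-at 6 5 7 10) (P₆-at 1 10 9 8 7 6)))) (claw-at 0 1 7 10))))))))))) (split 5 7 (split 0 8
  (found 2 6 (5 ∷ 7 ∷ 8 ∷ 0 ∷ [])) (split 7 10 (found 2 6 (5 ∷ 7 ∷ 10 ∷ 0 ∷ [])) (split 5 10 (found 2 6 (7 ∷ 5
  ∷ 10 ∷ 0 ∷ [])) (split 3 7 (found 2 5 (6 ∷ 7 ∷ 3 ∷ 4 ∷ [])) (split 5 9 (found 2 5 (6 ∷ 7 ∷ 8 ∷ 9 ∷ []))
  (split 6 9 (found 3 6 (9 ∷ 8 ∷ 7 ∷ 5 ∷ [])) (split 7 9 (split 3 9 (claw-at 9 3 7 10) (split 0 9 (found 2 6 (5
  ∷ 7 ∷ 9 ∷ 0 ∷ [])) (split 6 10 (found 3 6 (7 ∷ 9 ∷ 10 ∷ 0 ∷ [])) (split 2 10 (split 2 6 (claw-at 2 3 6 10)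
  (P₆-at 3 2 0 6 7 9)) (P₆-at 2 0 10 9 7 5))))) (split 2 8 (claw-at 8 2 7 9) (split 2 6 (split 6 10 (found 2 0
  (1 ∷ 2 ∷ 6 ∷ 10 ∷ [])) (split 4 6 (found 3 2 (3 ∷ 4 ∷ 6 ∷ 0 ∷ [])) (split 3 5 (found 3 2 (3 ∷ 5 ∷ 6 ∷ 0 ∷
  [])) (split 4 10 (claw-at 4 3 5 10) (P₆-at 3 4 5 6 0 10))))) (split 0 9 (claw-at 0 2 6 9) (split 6 8 (split 3 9
  (P₆-at 7 6 0 2 3 9) (split 3 8 (claw-at 8 3 6 9) (P₆-at 3 2 0 6 8 9))) (P₆-at 2 0 6 7 8 9)))))))))))) (claw-at 6
  0 5 7)))))) (split 2 6 (split 3 6 (found 3 3 (4 ∷ 5 ∷ 6 ∷ 2 ∷ [])) (claw-at 2 0 3 6)) (split 0 7 (split 2 8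
  (found 2 0 (1 ∷ 2 ∷ 8 ∷ 7 ∷ [])) (split 0 8 (found 2 0 (7 ∷ 8 ∷ 9 ∷ 10 ∷ [])) (split 0 9 (found 3 0 (7 ∷ 8 ∷
  9 ∷ 10 ∷ [])) (split 7 9 (found 2 7 (8 ∷ 9 ∷ 10 ∷ 0 ∷ [])) (split 8 10 (found 2 8 (9 ∷ 10 ∷ 0 ∷ 7 ∷ []))
  (split 6 8 (split 6 10 (found 2 7 (8 ∷ 6 ∷ 10 ∷ 0 ∷ [])) (split 4 8 (found 2 6 (7 ∷ 8 ∷ 4 ∷ 5 ∷ [])) (split
  5 9 (found 2 6 (7 ∷ 8 ∷ 9 ∷ 5 ∷ [])) (split 5 10 (claw-at 10 0 5 9) (split 6 9 (split 5 7 (found 2 6 (9 ∷ 8 ∷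
  7 ∷ 5 ∷ [])) (claw-at 6 5 7 9)) (split 5 8 (split 2 10 (split 4 10 (found 3 2 (3 ∷ 4 ∷ 10 ∷ 0 ∷ [])) (split 4
  9 (found 2 5 (6 ∷ 8 ∷ 9 ∷ 4 ∷ [])) (P₆-at 0 10 9 8 5 4))) (P₆-at 2 0 10 9 8 6)) (P₆-at 0 10 9 8 6 5)))))))
  (claw-at 7 0 6 8))))))) (split 3 7 (split 3 5 (found 2 3 (4 ∷ 5 ∷ 6 ∷ 7 ∷ [])) (split 3 6 (found 3 3 (4 ∷ 5 ∷
  6 ∷ 7 ∷ [])) (split 4 6 (found 2 4 (5 ∷ 6 ∷ 7 ∷ 3 ∷ [])) (split 4 7 (found 3 4 (5 ∷ 6 ∷ 7 ∷ 3 ∷ [])) (split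
  5 7 (found 2 5 (6 ∷ 7 ∷ 3 ∷ 4 ∷ [])) (split 2 4 (split 2 7 (claw-at 2 0 4 7) (P₆-at 0 2 3 7 6 5)) (P₆-at 0 2 3
  4 5 6))))))) (split 2 7 (claw-at 2 0 3 7) (split 2 8 (split 7 9 (split 0 9 (found 2 0 (1 ∷ 2 ∷ 8 ∷ 9 ∷ []))
  (split 0 8 (found 2 0 (2 ∷ 8 ∷ 9 ∷ 10 ∷ [])) (split 2 10 (found 3 2 (8 ∷ 9 ∷ 10 ∷ 0 ∷ [])) (split 3 8 (split
  3 9 (found 2 9 (7 ∷ 8 ∷ 2 ∷ 3 ∷ [])) (split 6 10 (found 2 7 (8 ∷ 9 ∷ 10 ∷ 6 ∷ [])) (split 7 10 (split 3 6
  (found 3 3 (6 ∷ 7 ∷ 8 ∷ 2 ∷ [])) (P₆-at 3 2 0 10 7 6)) (P₆-at 3 2 0 10 9 7)))) (claw-at 2 0 3 8))))) (claw-at 8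
  2 7 9)) (split 0 8 (split 3 8 (claw-at 8 0 3 7) (split 1 8 (found 2 0 (1 ∷ 8 ∷ 9 ∷ 10 ∷ [])) (split 1 7 (found
  2 0 (2 ∷ 1 ∷ 7 ∷ 8 ∷ [])) (split 7 9 (found 2 8 (7 ∷ 9 ∷ 10 ∷ 0 ∷ [])) (split 0 9 (split 3 9 (found 2 0 (1 ∷
  2 ∷ 3 ∷ 9 ∷ [])) (split 6 9 (found 3 8 (7 ∷ 6 ∷ 9 ∷ 0 ∷ [])) (split 3 6 (P₆-at 7 6 3 2 0 9) (split 6 8
  (split 5 9 (found 3 8 (6 ∷ 5 ∷ 9 ∷ 0 ∷ [])) (split 4 8 (found 2 6 (7 ∷ 8 ∷ 4 ∷ 5 ∷ [])) (split 4 7 (found 2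
  6 (8 ∷ 7 ∷ 4 ∷ 5 ∷ [])) (split 1 3 (P₆-at 4 3 1 0 8 7) (split 2 4 (split 3 5 (P₆-at 6 5 3 2 0 9) (split 5 8
  (split 1 5 (found 3 1 (5 ∷ 4 ∷ 2 ∷ 0 ∷ [])) (P₆-at 1 0 8 5 4 3)) (P₆-at 3 2 0 8 6 5))) (P₆-at 4 3 2 0 8
  7)))))) (P₆-at 3 2 0 8 7 6))))) (claw-at 8 0 7 9)))))) (split 1 3 (split 1 7 (claw-at 1 0 3 7) (split 2 4 (found
  3 1 (3 ∷ 4 ∷ 2 ∷ 0 ∷ [])) (split 1 10 (found 3 0 (2 ∷ 3 ∷ 1 ∷ 10 ∷ [])) (split 1 5 (found 2 1 (2 ∷ 3 ∷ 4 ∷ 5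
  ∷ [])) (split 4 6 (split 1 6 (found 2 1 (2 ∷ 3 ∷ 4 ∷ 6 ∷ [])) (split 4 8 (found 2 4 (5 ∷ 6 ∷ 7 ∷ 8 ∷ []))
  (split 3 8 (claw-at 3 2 4 8) (split 1 8 (claw-at 1 0 3 8) (split 4 7 (P₆-at 0 2 3 4 7 8) (split 3 6 (split 6 8
  (split 6 10 (found 2 6 (7 ∷ 8 ∷ 9 ∷ 10 ∷ [])) (split 7 10 (found 3 7 (10 ∷ 9 ∷ 8 ∷ 6 ∷ [])) (P₆-at 7 6 3 1 0
  10))) (P₆-at 0 1 3 6 7 8)) (P₆-at 0 1 3 4 6 7))))))) (split 3 6 (claw-at 3 2 4 6) (split 1 6 (claw-at 1 0 3 6)
  (split 3 5 (split 5 7 (split 3 8 (found 2 3 (4 ∷ 5 ∷ 7 ∷ 8 ∷ [])) (split 5 9 (found 2 5 (6 ∷ 7 ∷ 8 ∷ 9 ∷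
  [])) (split 6 9 (found 3 6 (9 ∷ 8 ∷ 7 ∷ 5 ∷ [])) (split 1 8 (claw-at 1 0 3 8) (split 3 9 (claw-at 3 1 5 9)
  (split 5 8 (split 0 9 (P₆-at 6 5 3 1 0 9) (P₆-at 0 1 3 5 8 9)) (P₆-at 0 2 3 5 7 8))))))) (P₆-at 0 1 3 5 6
  7)) (P₆-at 0 2 3 4 5 6))))))))) (split 1 10 (split 0 9 (found 2 0 (2 ∷ 1 ∷ 10 ∷ 9 ∷ [])) (split 5 9 (split 5
  7 (found 2 5 (6 ∷ 7 ∷ 8 ∷ 9 ∷ [])) (split 5 8 (found 3 5 (6 ∷ 7 ∷ 8 ∷ 9 ∷ [])) (split 6 8 (found 2 6 (7 ∷ 8
  ∷ 9 ∷ 5 ∷ [])) (split 6 9 (found 3 6 (7 ∷ 8 ∷ 9 ∷ 5 ∷ [])) (split 7 9 (found 2 7 (8 ∷ 9 ∷ 5 ∷ 6 ∷ []))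
  (split 6 10 (claw-at 10 0 6 9) (split 7 10 (claw-at 10 0 7 9) (split 5 10 (split 8 10 (claw-at 10 0 5 8) (P₆-at 0
  10 9 8 7 6)) (P₆-at 0 10 9 5 6 7))))))))) (split 5 10 (claw-at 10 0 5 9) (split 6 9 (split 5 7 (found 3 6 (9 ∷
  8 ∷ 7 ∷ 5 ∷ [])) (split 6 10 (found 3 6 (7 ∷ 8 ∷ 9 ∷ 10 ∷ [])) (split 8 10 (found 2 8 (10 ∷ 9 ∷ 6 ∷ 7 ∷ []))
  (split 7 9 (split 6 8 (split 2 10 (split 4 10 (found 3 2 (3 ∷ 4 ∷ 10 ∷ 0 ∷ [])) (split 3 9 (found 3 2 (3 ∷ 9
  ∷ 10 ∷ 0 ∷ [])) (split 4 9 (found 2 6 (7 ∷ 9 ∷ 4 ∷ 5 ∷ [])) (split 4 7 (found 2 6 (8 ∷ 7 ∷ 4 ∷ 5 ∷ []))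
  (split 7 10 (found 3 6 (7 ∷ 10 ∷ 9 ∷ 8 ∷ [])) (split 2 4 (P₆-at 5 4 2 10 9 7) (P₆-at 4 3 2 10 9 7)))))))
  (P₆-at 2 0 10 9 6 5)) (claw-at 9 6 8 10)) (claw-at 6 5 7 9))))) (split 6 10 (claw-at 10 0 6 9) (split 3 5 (split 3
  9 (claw-at 3 2 5 9) (split 2 10 (split 3 6 (split 7 9 (P₆-at 0 2 3 6 7 9) (split 7 10 (claw-at 10 0 7 9) (P₆-at
  7 6 3 2 10 9))) (P₆-at 6 5 3 2 10 9)) (P₆-at 5 3 2 0 10 9))) (split 4 10 (claw-at 4 3 5 10) (split 2 10 (split
  3 9 (found 3 2 (3 ∷ 9 ∷ 10 ∷ 0 ∷ [])) (split 4 9 (claw-at 4 3 5 9) (split 3 6 (P₆-at 5 6 3 2 10 9) (split 2 4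
  (split 4 6 (split 4 8 (found 2 4 (5 ∷ 6 ∷ 7 ∷ 8 ∷ [])) (split 5 8 (found 3 5 (8 ∷ 7 ∷ 6 ∷ 4 ∷ [])) (split 6
  8 (P₆-at 0 2 4 6 8 9) (split 8 10 (split 3 8 (P₆-at 0 2 3 8 7 6) (split 4 7 (split 7 10 (found 3 2 (4 ∷ 7 ∷
  10 ∷ 0 ∷ [])) (P₆-at 0 10 8 7 4 3)) (P₆-at 0 2 4 6 7 8))) (P₆-at 5 4 2 10 9 8))))) (P₆-at 6 5 4 2 10 9))
  (P₆-at 5 4 3 2 10 9))))) (split 2 4 (split 4 9 (claw-at 4 2 5 9) (P₆-at 5 4 2 0 10 9)) (P₆-at 5 4 3 2 0
  10)))))))))) (split 2 10 (claw-at 2 1 3 10) (split 0 9 (split 3 9 (found 2 0 (1 ∷ 2 ∷ 3 ∷ 9 ∷ [])) (split 1 8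
  (found 3 0 (1 ∷ 8 ∷ 9 ∷ 10 ∷ [])) (split 7 10 (found 3 9 (8 ∷ 7 ∷ 10 ∷ 0 ∷ [])) (split 4 8 (split 4 10
  (found 3 9 (8 ∷ 4 ∷ 10 ∷ 0 ∷ [])) (split 4 7 (found 3 4 (5 ∷ 6 ∷ 7 ∷ 8 ∷ [])) (split 5 8 (found 3 5 (6 ∷ 7 ∷
  8 ∷ 4 ∷ [])) (split 2 4 (claw-at 4 2 5 8) (split 8 10 (claw-at 8 4 7 10) (split 3 8 (P₆-at 1 2 3 8 9 10) (P₆-at
  0 2 3 4 8 7))))))) (split 4 9 (claw-at 9 0 4 8) (split 3 8 (P₆-at 1 0 9 8 3 4) (split 7 9 (split 2 4 (split 5
  9 (found 2 7 (8 ∷ 9 ∷ 5 ∷ 6 ∷ [])) (split 5 8 (found 2 7 (9 ∷ 8 ∷ 5 ∷ 6 ∷ [])) (P₆-at 5 4 2 0 9 8))) (P₆-at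
  4 3 2 0 9 8)) (P₆-at 3 2 0 9 8 7)))))))) (split 7 9 (split 5 9 (found 2 7 (8 ∷ 9 ∷ 5 ∷ 6 ∷ [])) (split 6 10
  (found 2 7 (8 ∷ 9 ∷ 10 ∷ 6 ∷ [])) (split 5 10 (claw-at 10 0 5 9) (split 6 9 (P₆-at 2 0 10 9 6 5) (split 7 10
  (split 5 7 (split 3 6 (found 2 5 (7 ∷ 6 ∷ 3 ∷ 4 ∷ [])) (P₆-at 3 2 0 10 7 6)) (P₆-at 2 0 10 7 6 5)) (P₆-at 2
  0 10 9 7 6)))))) (split 7 10 (claw-at 10 0 7 9) (split 8 10 (split 3 8 (claw-at 8 3 7 10) (P₆-at 3 2 0 10 8 7))
  (P₆-at 2 0 10 9 8 7))))))))))))))))))))))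

span-free-certificate-5 : Certificate
span-free-certificate-5 =
  split 5 9 (split 5 8 (found 3 5 (6 ∷ 7 ∷ 8 ∷ 9 ∷ [])) (split 6 9 (found 3 6 (7 ∷ 8 ∷ 9 ∷ 5 ∷ [])) (split 4 9
  (split 5 10 (split 0 5 (found 2 5 (4 ∷ 9 ∷ 10 ∷ 0 ∷ [])) (split 0 6 (found 2 5 (9 ∷ 10 ∷ 0 ∷ 6 ∷ [])) (split
  0 8 (found 2 9 (5 ∷ 10 ∷ 0 ∷ 8 ∷ [])) (split 6 10 (found 2 5 (6 ∷ 10 ∷ 9 ∷ 4 ∷ [])) (split 7 10 (found 3 5
  (6 ∷ 7 ∷ 10 ∷ 9 ∷ [])) (split 0 7 (claw-at 7 0 6 8) (P₆-at 0 10 5 6 7 8))))))) (claw-at 9 5 8 10)) (claw-at 5 4 6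
  9)))) (split 6 9 (claw-at 6 5 7 9) (split 5 8 (claw-at 8 5 7 9) (split 6 10 (split 7 10 (found 3 7 (8 ∷ 9 ∷ 10 ∷
  6 ∷ [])) (split 5 10 (split 4 9 (found 2 5 (6 ∷ 10 ∷ 9 ∷ 4 ∷ [])) (split 4 7 (found 2 5 (10 ∷ 6 ∷ 7 ∷ 4 ∷
  [])) (split 4 8 (claw-at 8 4 7 9) (P₆-at 4 5 6 7 8 9)))) (claw-at 6 5 7 10))) (split 7 10 (claw-at 7 6 8 10)
  (split 5 10 (split 4 10 (split 3 9 (found 2 4 (5 ∷ 10 ∷ 9 ∷ 3 ∷ [])) (split 4 8 (found 2 4 (5 ∷ 10 ∷ 9 ∷ 8 ∷
  [])) (split 4 7 (found 3 4 (7 ∷ 6 ∷ 5 ∷ 10 ∷ [])) (split 4 9 (claw-at 4 3 5 9) (P₆-at 4 5 6 7 8 9))))) (claw-at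
  5 4 6 10)) (P₆-at 5 6 7 8 9 10))))))

-- As for length 5, the tree opens with the edges that close six consecutive vertices containing 0,
-- 1 and 2; there are now four of them.
spanned-certificate-6 : Certificate
spanned-certificate-6 =
  split 0 5 (found 2 0 (1 ∷ 2 ∷ 3 ∷ 4 ∷ 5 ∷ [])) (split 4 12 (found 2 0 (1 ∷ 2 ∷ 3 ∷ 4 ∷ 12 ∷ [])) (split 3 11
  (found 2 0 (1 ∷ 2 ∷ 3 ∷ 11 ∷ 12 ∷ [])) (split 2 10 (found 2 0 (1 ∷ 2 ∷ 10 ∷ 11 ∷ 12 ∷ [])) (split 1 5 (found
  4 1 (5 ∷ 4 ∷ 3 ∷ 2 ∷ 0 ∷ [])) (split 1 10 (found 2 0 (2 ∷ 1 ∷ 10 ∷ 11 ∷ 12 ∷ [])) (split 0 3 (split 2 5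
  (found 2 0 (1 ∷ 2 ∷ 5 ∷ 4 ∷ 3 ∷ [])) (split 0 6 (found 2 0 (2 ∷ 3 ∷ 4 ∷ 5 ∷ 6 ∷ [])) (split 5 12 (found 2 0
  (2 ∷ 3 ∷ 4 ∷ 5 ∷ 12 ∷ [])) (split 4 11 (found 2 0 (2 ∷ 3 ∷ 4 ∷ 11 ∷ 12 ∷ [])) (split 3 10 (found 2 0 (2 ∷ 3
  ∷ 10 ∷ 11 ∷ 12 ∷ [])) (split 2 6 (found 4 2 (6 ∷ 5 ∷ 4 ∷ 3 ∷ 0 ∷ [])) (split 1 11 (found 2 0 (3 ∷ 2 ∷ 1 ∷ 11
  ∷ 12 ∷ [])) (split 2 11 (split 1 3 (found 2 0 (1 ∷ 3 ∷ 2 ∷ 11 ∷ 12 ∷ [])) (claw-at 2 1 3 11)) (split 0 10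
  (split 1 3 (split 4 10 (found 2 0 (1 ∷ 2 ∷ 3 ∷ 4 ∷ 10 ∷ [])) (split 3 9 (found 2 0 (1 ∷ 2 ∷ 3 ∷ 9 ∷ 10 ∷
  [])) (split 2 8 (found 2 0 (1 ∷ 2 ∷ 8 ∷ 9 ∷ 10 ∷ [])) (split 2 12 (found 2 0 (1 ∷ 2 ∷ 12 ∷ 11 ∷ 10 ∷ []))
  (split 1 9 (found 3 0 (1 ∷ 9 ∷ 10 ∷ 11 ∷ 12 ∷ [])) (split 1 8 (found 2 0 (2 ∷ 1 ∷ 8 ∷ 9 ∷ 10 ∷ [])) (split 1
  12 (found 2 0 (2 ∷ 1 ∷ 12 ∷ 11 ∷ 10 ∷ [])) (split 5 10 (found 2 0 (2 ∷ 3 ∷ 4 ∷ 5 ∷ 10 ∷ [])) (split 4 9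
  (found 2 0 (2 ∷ 3 ∷ 4 ∷ 9 ∷ 10 ∷ [])) (split 3 8 (found 2 0 (2 ∷ 3 ∷ 8 ∷ 9 ∷ 10 ∷ [])) (split 3 12 (found 2
  0 (2 ∷ 3 ∷ 12 ∷ 11 ∷ 10 ∷ [])) (split 2 9 (found 3 0 (2 ∷ 9 ∷ 10 ∷ 11 ∷ 12 ∷ [])) (split 0 8 (found 3 0 (8 ∷
  9 ∷ 10 ∷ 11 ∷ 12 ∷ [])) (split 8 11 (found 3 10 (9 ∷ 8 ∷ 11 ∷ 12 ∷ 0 ∷ [])) (split 10 12 (split 1 6 (found 4
  1 (6 ∷ 5 ∷ 4 ∷ 3 ∷ 0 ∷ [])) (split 0 7 (found 4 0 (7 ∷ 8 ∷ 9 ∷ 10 ∷ 12 ∷ [])) (split 7 12 (found 4 10 (9 ∷ 8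
  ∷ 7 ∷ 12 ∷ 0 ∷ [])) (split 7 11 (found 2 10 (12 ∷ 11 ∷ 7 ∷ 8 ∷ 9 ∷ [])) (split 2 7 (split 0 9 (found 2 0 (1
  ∷ 2 ∷ 7 ∷ 8 ∷ 9 ∷ [])) (split 8 10 (found 2 0 (1 ∷ 2 ∷ 7 ∷ 8 ∷ 10 ∷ [])) (split 7 9 (found 2 0 (1 ∷ 2 ∷ 7 ∷
  9 ∷ 10 ∷ [])) (split 7 10 (found 2 0 (1 ∷ 2 ∷ 7 ∷ 10 ∷ 12 ∷ [])) (split 3 7 (found 4 3 (4 ∷ 5 ∷ 6 ∷ 7 ∷ 2 ∷
  [])) (P₆-at 3 0 10 9 8 7)))))) (split 8 12 (split 0 11 (found 4 0 (10 ∷ 9 ∷ 8 ∷ 12 ∷ 11 ∷ [])) (claw-at 12 0 8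
  11)) (split 1 7 (split 0 9 (found 4 0 (1 ∷ 7 ∷ 8 ∷ 9 ∷ 10 ∷ [])) (split 7 9 (found 2 7 (8 ∷ 9 ∷ 10 ∷ 0 ∷ 1 ∷
  [])) (split 7 10 (found 3 7 (8 ∷ 9 ∷ 10 ∷ 0 ∷ 1 ∷ [])) (split 8 10 (found 2 8 (9 ∷ 10 ∷ 0 ∷ 1 ∷ 7 ∷ []))
  (P₆-at 2 0 10 9 8 7))))) (split 6 12 (split 6 8 (found 4 10 (9 ∷ 8 ∷ 6 ∷ 12 ∷ 0 ∷ [])) (P₆-at 1 0 12 6 7 8))
  (split 0 11 (split 5 11 (found 2 0 (1 ∷ 3 ∷ 4 ∷ 5 ∷ 11 ∷ [])) (split 6 11 (split 6 8 (found 4 10 (9 ∷ 8 ∷ 6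
  ∷ 11 ∷ 0 ∷ [])) (P₆-at 1 0 11 6 7 8)) (split 2 4 (split 0 4 (split 1 4 (split 6 10 (found 2 0 (2 ∷ 4 ∷ 5 ∷ 6
  ∷ 10 ∷ [])) (split 5 9 (found 2 0 (2 ∷ 4 ∷ 5 ∷ 9 ∷ 10 ∷ [])) (split 4 8 (found 2 0 (2 ∷ 4 ∷ 8 ∷ 9 ∷ 10 ∷
  [])) (split 9 12 (split 5 8 (P₆-at 1 4 5 8 9 12) (split 7 10 (found 3 10 (7 ∷ 8 ∷ 9 ∷ 12 ∷ 0 ∷ [])) (split 8
  10 (found 4 0 (10 ∷ 8 ∷ 9 ∷ 12 ∷ 11 ∷ [])) (split 0 9 (split 6 9 (found 2 0 (1 ∷ 4 ∷ 5 ∷ 6 ∷ 9 ∷ [])) (split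
  4 7 (found 2 0 (1 ∷ 4 ∷ 7 ∷ 8 ∷ 9 ∷ [])) (split 6 8 (P₆-at 1 0 9 8 6 5) (split 5 7 (P₆-at 8 7 5 4 0 10)
  (split 4 6 (P₆-at 8 7 6 4 0 10) (P₆-at 0 4 5 6 7 8)))))) (P₆-at 5 4 0 10 9 8))))) (split 0 9 (claw-at 0 1 9
  12) (split 6 9 (P₆-at 1 0 10 9 6 5) (split 5 8 (P₆-at 9 8 5 4 0 12) (split 8 10 (split 4 6 (split 6 8 (P₆-at
  1 0 10 8 6 5) (split 7 10 (found 2 0 (1 ∷ 4 ∷ 6 ∷ 7 ∷ 10 ∷ [])) (P₆-at 1 0 10 8 7 6))) (P₆-at 6 5 4 0 10 9))
  (P₆-at 5 4 0 10 9 8))))))))) (claw-at 0 1 4 10)) (split 4 6 (split 4 7 (split 5 9 (found 4 5 (9 ∷ 8 ∷ 7 ∷ 6 ∷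
  4 ∷ [])) (split 0 9 (split 4 8 (found 2 0 (1 ∷ 2 ∷ 4 ∷ 8 ∷ 9 ∷ [])) (P₆-at 8 7 4 2 0 11)) (P₆-at 5 4 2 0 10
  9))) (P₆-at 7 6 4 2 0 11)) (P₆-at 6 5 4 2 0 11))) (split 0 4 (claw-at 0 2 4 10) (split 9 12 (split 4 8 (P₆-at
  2 3 4 8 9 12) (split 7 10 (found 3 10 (7 ∷ 8 ∷ 9 ∷ 12 ∷ 0 ∷ [])) (split 8 10 (found 4 0 (10 ∷ 8 ∷ 9 ∷ 12 ∷
  11 ∷ [])) (split 0 9 (split 5 9 (found 2 0 (1 ∷ 3 ∷ 4 ∷ 5 ∷ 9 ∷ [])) (split 3 7 (found 2 0 (1 ∷ 3 ∷ 7 ∷ 8 ∷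
  9 ∷ [])) (split 5 8 (P₆-at 2 0 9 8 5 4) (split 4 7 (P₆-at 8 7 4 3 0 10) (split 7 9 (split 1 4 (P₆-at 5 4 1 0
  9 8) (split 3 5 (split 5 7 (P₆-at 1 0 9 7 5 4) (split 6 9 (found 2 0 (1 ∷ 3 ∷ 5 ∷ 6 ∷ 9 ∷ [])) (P₆-at 1 0 9
  7 6 5))) (P₆-at 5 4 3 0 9 8))) (P₆-at 4 3 0 9 8 7)))))) (P₆-at 4 3 0 10 9 8))))) (split 0 9 (claw-at 0 1 9 12)
  (split 5 9 (P₆-at 2 0 10 9 5 4) (split 4 8 (P₆-at 9 8 4 3 0 12) (split 8 10 (split 1 4 (P₆-at 5 4 1 0 10 9)
  (split 3 5 (split 5 8 (P₆-at 1 0 10 8 5 4) (split 6 10 (found 2 0 (1 ∷ 3 ∷ 5 ∷ 6 ∷ 10 ∷ [])) (split 3 7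
  (found 2 0 (1 ∷ 3 ∷ 7 ∷ 8 ∷ 10 ∷ [])) (split 6 8 (P₆-at 1 0 10 8 6 5) (split 5 7 (P₆-at 8 7 5 3 0 11) (split
  3 6 (P₆-at 8 7 6 3 0 11) (P₆-at 0 3 5 6 7 8))))))) (P₆-at 5 4 3 0 10 9))) (P₆-at 4 3 0 10 9 8))))))))))
  (split 7 10 (claw-at 10 0 7 11) (split 8 10 (claw-at 10 0 8 11) (split 6 11 (P₆-at 1 0 12 11 6 7) (split 3 7
  (P₆-at 8 7 3 0 12 11) (split 6 10 (claw-at 10 0 6 11) (split 5 11 (P₆-at 1 0 12 11 5 6) (split 3 6 (P₆-at 7 6
  3 0 12 11) (split 3 5 (P₆-at 6 5 3 0 10 11) (split 0 4 (split 4 6 (split 4 8 (found 2 0 (3 ∷ 4 ∷ 8 ∷ 9 ∷ 10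
  ∷ [])) (split 4 7 (P₆-at 8 7 4 0 10 11) (P₆-at 7 6 4 0 10 11))) (P₆-at 6 5 4 0 10 11)) (P₆-at 5 4 3 0 10
  11))))))))))))))))))) (claw-at 0 1 10 12)))))))))))))))) (claw-at 0 1 3 10)) (split 0 11 (split 1 3 (split 3 12
  (found 2 0 (1 ∷ 2 ∷ 3 ∷ 12 ∷ 11 ∷ [])) (split 1 9 (found 4 0 (1 ∷ 9 ∷ 10 ∷ 11 ∷ 12 ∷ [])) (split 5 11 (found
  2 0 (2 ∷ 3 ∷ 4 ∷ 5 ∷ 11 ∷ [])) (split 4 10 (found 2 0 (2 ∷ 3 ∷ 4 ∷ 10 ∷ 11 ∷ [])) (split 1 12 (found 2 0 (3
  ∷ 2 ∷ 1 ∷ 12 ∷ 11 ∷ [])) (split 0 8 (found 4 0 (8 ∷ 9 ∷ 10 ∷ 11 ∷ 12 ∷ [])) (split 8 12 (found 4 11 (10 ∷ 9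
  ∷ 8 ∷ 12 ∷ 0 ∷ [])) (split 1 6 (found 4 1 (6 ∷ 5 ∷ 4 ∷ 3 ∷ 0 ∷ [])) (split 1 4 (split 1 7 (found 2 1 (3 ∷ 4
  ∷ 5 ∷ 6 ∷ 7 ∷ [])) (split 0 4 (split 0 7 (found 2 0 (1 ∷ 4 ∷ 5 ∷ 6 ∷ 7 ∷ [])) (split 6 11 (found 2 0 (1 ∷ 4
  ∷ 5 ∷ 6 ∷ 11 ∷ [])) (split 5 10 (found 2 0 (1 ∷ 4 ∷ 5 ∷ 10 ∷ 11 ∷ [])) (split 4 9 (found 2 0 (1 ∷ 4 ∷ 9 ∷ 10
  ∷ 11 ∷ [])) (split 6 10 (P₆-at 1 0 11 10 6 5) (split 4 6 (split 7 11 (found 2 0 (1 ∷ 4 ∷ 6 ∷ 7 ∷ 11 ∷ []))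
  (split 1 8 (found 4 1 (8 ∷ 7 ∷ 6 ∷ 4 ∷ 0 ∷ [])) (split 5 9 (found 4 5 (9 ∷ 8 ∷ 7 ∷ 6 ∷ 4 ∷ [])) (split 7 10
  (P₆-at 1 0 11 10 7 6) (split 4 7 (split 5 7 (split 0 9 (found 2 0 (1 ∷ 4 ∷ 7 ∷ 8 ∷ 9 ∷ [])) (split 8 11
  (found 2 0 (1 ∷ 4 ∷ 7 ∷ 8 ∷ 11 ∷ [])) (split 9 11 (split 7 9 (P₆-at 1 0 11 9 7 5) (P₆-at 1 0 11 9 8 7))
  (P₆-at 5 4 0 11 10 9)))) (claw-at 4 0 5 7)) (P₆-at 7 6 4 0 11 10)))))) (P₆-at 6 5 4 0 11 10))))))) (split 5 10
  (split 10 12 (split 6 12 (found 4 11 (10 ∷ 5 ∷ 6 ∷ 12 ∷ 0 ∷ [])) (split 6 10 (found 4 6 (7 ∷ 8 ∷ 9 ∷ 10 ∷ 5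
  ∷ [])) (P₆-at 1 0 12 10 5 6))) (P₆-at 1 4 5 10 11 12)) (P₆-at 5 4 1 0 11 10)))) (split 0 4 (claw-at 0 1 4 11)
  (split 5 10 (P₆-at 1 0 11 10 5 4) (split 3 5 (split 0 7 (found 2 0 (1 ∷ 3 ∷ 5 ∷ 6 ∷ 7 ∷ [])) (split 6 11
  (found 2 0 (1 ∷ 3 ∷ 5 ∷ 6 ∷ 11 ∷ [])) (split 1 7 (found 4 1 (7 ∷ 6 ∷ 5 ∷ 3 ∷ 0 ∷ [])) (split 3 8 (found 2 3
  (4 ∷ 5 ∷ 6 ∷ 7 ∷ 8 ∷ [])) (split 4 8 (found 4 4 (8 ∷ 7 ∷ 6 ∷ 5 ∷ 3 ∷ [])) (split 6 10 (P₆-at 1 0 11 10 6 5)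
  (split 3 6 (split 7 11 (found 2 0 (1 ∷ 3 ∷ 6 ∷ 7 ∷ 11 ∷ [])) (split 7 12 (found 2 0 (1 ∷ 3 ∷ 6 ∷ 7 ∷ 12 ∷
  [])) (split 1 8 (found 4 1 (8 ∷ 7 ∷ 6 ∷ 3 ∷ 0 ∷ [])) (split 7 10 (P₆-at 1 0 11 10 7 6) (split 3 7 (split 4 7
  (split 8 11 (P₆-at 1 3 7 8 11 12) (split 8 10 (P₆-at 0 11 10 8 7 4) (P₆-at 8 7 3 0 11 10))) (claw-at 3 0 4 7))
  (P₆-at 7 6 3 0 11 10)))))) (P₆-at 6 5 3 0 11 10)))))))) (P₆-at 5 4 3 0 11 10))))))))))))) (claw-at 0 1 3 11))
  (split 6 12 (split 6 11 (split 3 6 (found 2 0 (1 ∷ 2 ∷ 3 ∷ 6 ∷ 12 ∷ [])) (split 4 6 (found 2 0 (2 ∷ 3 ∷ 4 ∷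
  6 ∷ 12 ∷ [])) (split 3 5 (found 2 0 (2 ∷ 3 ∷ 5 ∷ 6 ∷ 12 ∷ [])) (split 0 4 (found 2 0 (3 ∷ 4 ∷ 5 ∷ 6 ∷ 12 ∷
  [])) (split 5 11 (split 4 10 (found 2 6 (12 ∷ 11 ∷ 10 ∷ 4 ∷ 5 ∷ [])) (split 6 10 (found 4 6 (7 ∷ 8 ∷ 9 ∷ 10
  ∷ 11 ∷ [])) (split 5 10 (claw-at 5 4 6 10) (P₆-at 0 3 4 5 11 10)))) (P₆-at 0 3 4 5 6 11)))))) (claw-at 12 0 6
  11)) (split 0 4 (split 1 6 (found 4 0 (1 ∷ 6 ∷ 5 ∷ 4 ∷ 3 ∷ [])) (split 0 7 (found 2 0 (3 ∷ 4 ∷ 5 ∷ 6 ∷ 7 ∷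
  [])) (split 5 11 (found 2 0 (3 ∷ 4 ∷ 5 ∷ 11 ∷ 12 ∷ [])) (split 4 10 (found 2 0 (3 ∷ 4 ∷ 10 ∷ 11 ∷ 12 ∷ []))
  (split 1 12 (found 2 0 (4 ∷ 3 ∷ 2 ∷ 1 ∷ 12 ∷ [])) (split 1 4 (split 6 11 (P₆-at 1 0 12 11 6 5) (split 4 6
  (split 1 7 (found 4 1 (7 ∷ 6 ∷ 5 ∷ 4 ∷ 0 ∷ [])) (split 0 8 (found 2 0 (1 ∷ 4 ∷ 6 ∷ 7 ∷ 8 ∷ [])) (split 7 12
  (found 2 0 (1 ∷ 4 ∷ 6 ∷ 7 ∷ 12 ∷ [])) (split 1 8 (found 4 1 (8 ∷ 7 ∷ 6 ∷ 4 ∷ 0 ∷ [])) (split 4 9 (found 2 4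
  (5 ∷ 6 ∷ 7 ∷ 8 ∷ 9 ∷ [])) (split 5 9 (found 4 5 (9 ∷ 8 ∷ 7 ∷ 6 ∷ 4 ∷ [])) (split 7 11 (P₆-at 1 0 12 11 7 6)
  (split 4 7 (split 5 7 (split 0 9 (found 2 0 (1 ∷ 4 ∷ 7 ∷ 8 ∷ 9 ∷ [])) (split 8 12 (found 2 0 (1 ∷ 4 ∷ 7 ∷ 8
  ∷ 12 ∷ [])) (split 6 10 (found 4 6 (10 ∷ 9 ∷ 8 ∷ 7 ∷ 4 ∷ [])) (split 8 11 (P₆-at 1 0 12 11 8 7) (split 10 12
  (split 5 10 (found 4 5 (10 ∷ 9 ∷ 8 ∷ 7 ∷ 4 ∷ [])) (split 9 12 (split 4 8 (found 2 0 (1 ∷ 4 ∷ 8 ∷ 9 ∷ 12 ∷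
  [])) (P₆-at 8 7 4 0 12 11)) (P₆-at 5 4 0 12 10 9))) (P₆-at 6 4 0 12 11 10)))))) (claw-at 4 0 5 7)) (P₆-at 7 6
  4 0 12 11))))))))) (P₆-at 6 5 4 0 12 11))) (claw-at 0 1 4 12))))))) (split 4 6 (split 0 7 (found 2 0 (2 ∷ 3 ∷
  4 ∷ 6 ∷ 7 ∷ [])) (split 3 8 (found 2 4 (5 ∷ 6 ∷ 7 ∷ 8 ∷ 3 ∷ [])) (split 4 9 (found 2 4 (5 ∷ 6 ∷ 7 ∷ 8 ∷ 9 ∷
  [])) (split 7 11 (split 4 10 (found 2 4 (5 ∷ 6 ∷ 7 ∷ 11 ∷ 10 ∷ [])) (split 6 11 (found 4 7 (8 ∷ 9 ∷ 10 ∷ 11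
  ∷ 6 ∷ [])) (split 7 12 (found 4 7 (8 ∷ 9 ∷ 10 ∷ 11 ∷ 12 ∷ [])) (split 10 12 (found 2 10 (12 ∷ 11 ∷ 7 ∷ 8 ∷ 9
  ∷ [])) (split 4 7 (split 3 12 (found 4 3 (4 ∷ 7 ∷ 11 ∷ 12 ∷ 0 ∷ [])) (P₆-at 4 3 0 12 11 10)) (P₆-at 0 12 11
  7 6 4)))))) (split 7 12 (claw-at 12 0 7 11) (split 0 9 (split 0 8 (found 2 0 (8 ∷ 9 ∷ 10 ∷ 11 ∷ 12 ∷ []))
  (split 8 10 (found 2 9 (8 ∷ 10 ∷ 11 ∷ 12 ∷ 0 ∷ [])) (claw-at 9 0 8 10))) (split 3 9 (claw-at 3 0 4 9) (split 4 8
  (split 0 8 (claw-at 8 0 4 9) (split 3 5 (found 3 4 (8 ∷ 7 ∷ 6 ∷ 5 ∷ 3 ∷ [])) (split 5 10 (found 2 4 (6 ∷ 5 ∷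
  10 ∷ 9 ∷ 8 ∷ [])) (split 4 10 (found 3 4 (6 ∷ 7 ∷ 8 ∷ 9 ∷ 10 ∷ [])) (split 5 11 (P₆-at 0 3 4 5 11 10) (split
  8 10 (split 8 11 (split 3 12 (found 4 3 (4 ∷ 8 ∷ 11 ∷ 12 ∷ 0 ∷ [])) (P₆-at 5 4 3 0 12 11)) (P₆-at 0 3 4 8 10
  11)) (P₆-at 0 3 4 8 9 10))))))) (split 0 8 (split 8 11 (claw-at 8 0 7 11) (split 8 10 (found 2 8 (9 ∷ 10 ∷ 11
  ∷ 12 ∷ 0 ∷ [])) (split 9 11 (found 2 9 (10 ∷ 11 ∷ 12 ∷ 0 ∷ 8 ∷ [])) (P₆-at 3 0 8 9 10 11)))) (split 6 11
  (split 3 6 (found 2 0 (2 ∷ 3 ∷ 6 ∷ 11 ∷ 12 ∷ [])) (split 6 10 (found 4 6 (7 ∷ 8 ∷ 9 ∷ 10 ∷ 11 ∷ [])) (split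
  4 10 (claw-at 4 3 6 10) (P₆-at 0 3 4 6 11 10)))) (split 3 7 (split 4 7 (split 8 12 (found 2 0 (2 ∷ 3 ∷ 7 ∷ 8 ∷
  12 ∷ [])) (split 8 11 (P₆-at 0 12 11 8 7 4) (split 3 12 (split 9 12 (found 4 3 (7 ∷ 8 ∷ 9 ∷ 12 ∷ 0 ∷ []))
  (split 7 10 (found 4 3 (7 ∷ 10 ∷ 11 ∷ 12 ∷ 0 ∷ [])) (split 8 10 (P₆-at 0 3 7 8 10 11) (split 9 11 (P₆-at 4 3
  12 11 9 8) (split 7 9 (P₆-at 0 3 7 9 10 11) (P₆-at 0 3 7 8 9 10)))))) (P₆-at 8 7 3 0 12 11)))) (claw-at 3 0 4
  7)) (split 4 10 (split 8 10 (found 2 4 (5 ∷ 6 ∷ 7 ∷ 8 ∷ 10 ∷ [])) (P₆-at 0 3 4 10 9 8)) (split 8 12 (split 7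
  9 (found 4 8 (12 ∷ 11 ∷ 10 ∷ 9 ∷ 7 ∷ [])) (split 4 7 (P₆-at 0 3 4 7 8 9) (split 6 8 (split 3 12 (found 4 3
  (4 ∷ 6 ∷ 8 ∷ 12 ∷ 0 ∷ [])) (P₆-at 4 3 0 12 8 7)) (P₆-at 0 12 8 7 6 4)))) (split 9 12 (split 9 11 (split 3 12
  (split 7 10 (found 3 9 (12 ∷ 11 ∷ 10 ∷ 7 ∷ 8 ∷ [])) (split 6 9 (found 4 3 (4 ∷ 6 ∷ 9 ∷ 12 ∷ 0 ∷ [])) (split
  6 10 (found 2 9 (11 ∷ 10 ∷ 6 ∷ 7 ∷ 8 ∷ [])) (split 6 8 (P₆-at 0 12 9 8 6 4) (split 7 9 (split 3 6 (P₆-at 0 3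
  6 7 9 10) (P₆-at 6 4 3 12 9 8)) (P₆-at 0 12 9 8 7 6)))))) (P₆-at 4 3 0 12 9 8)) (claw-at 12 0 9 11)) (split 10
  12 (split 3 12 (split 8 10 (split 6 10 (found 4 3 (4 ∷ 6 ∷ 10 ∷ 12 ∷ 0 ∷ [])) (split 6 8 (P₆-at 0 12 10 8 6
  4) (split 7 10 (split 3 6 (P₆-at 0 3 6 7 10 11) (P₆-at 6 4 3 12 10 8)) (P₆-at 0 12 10 8 7 6)))) (P₆-at 4 3
  12 10 9 8)) (P₆-at 4 3 0 12 10 9)) (split 6 10 (P₆-at 0 12 11 10 6 4) (split 3 12 (split 7 10 (P₆-at 0 12 11
  10 7 6) (split 3 6 (P₆-at 7 6 3 12 11 10) (P₆-at 6 4 3 12 11 10))) (P₆-at 4 3 0 12 11 10))))))))))))))))))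
  (split 3 6 (claw-at 3 0 4 6) (split 5 11 (split 6 11 (split 3 12 (found 4 3 (4 ∷ 5 ∷ 11 ∷ 12 ∷ 0 ∷ [])) (P₆-at
  4 3 0 12 11 6)) (claw-at 5 4 6 11)) (split 6 11 (P₆-at 0 12 11 6 5 4) (split 7 12 (split 4 7 (claw-at 7 4 6 12)
  (split 7 11 (found 4 7 (8 ∷ 9 ∷ 10 ∷ 11 ∷ 12 ∷ [])) (split 0 7 (split 5 7 (found 2 0 (2 ∷ 3 ∷ 4 ∷ 5 ∷ 7 ∷
  [])) (P₆-at 4 5 6 7 12 11)) (claw-at 12 0 7 11)))) (split 3 7 (split 3 8 (found 4 3 (4 ∷ 5 ∷ 6 ∷ 7 ∷ 8 ∷ []))
  (split 6 8 (found 2 6 (8 ∷ 7 ∷ 3 ∷ 4 ∷ 5 ∷ [])) (claw-at 7 3 6 8))) (split 3 12 (split 3 5 (split 3 9 (found 4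
  3 (9 ∷ 10 ∷ 11 ∷ 12 ∷ 0 ∷ [])) (split 0 9 (found 2 0 (3 ∷ 12 ∷ 11 ∷ 10 ∷ 9 ∷ [])) (split 0 7 (found 2 0 (2 ∷
  3 ∷ 5 ∷ 6 ∷ 7 ∷ [])) (split 5 10 (found 4 3 (5 ∷ 10 ∷ 11 ∷ 12 ∷ 0 ∷ [])) (split 3 8 (found 2 3 (4 ∷ 5 ∷ 6 ∷
  7 ∷ 8 ∷ [])) (split 4 8 (found 4 4 (8 ∷ 7 ∷ 6 ∷ 5 ∷ 3 ∷ [])) (split 6 10 (P₆-at 0 3 5 6 10 11) (split 10 12
  (split 4 9 (found 4 3 (4 ∷ 9 ∷ 10 ∷ 12 ∷ 0 ∷ [])) (split 5 9 (found 4 3 (5 ∷ 9 ∷ 10 ∷ 12 ∷ 0 ∷ [])) (split 7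
  11 (found 2 10 (12 ∷ 11 ∷ 7 ∷ 8 ∷ 9 ∷ [])) (split 6 9 (P₆-at 0 3 5 6 9 10) (split 4 7 (P₆-at 6 7 4 3 12 11)
  (split 5 7 (split 7 10 (P₆-at 0 3 5 7 10 11) (split 9 12 (split 8 12 (found 4 3 (5 ∷ 7 ∷ 8 ∷ 12 ∷ 0 ∷ []))
  (split 7 9 (P₆-at 0 3 5 7 9 10) (P₆-at 4 3 12 9 8 7))) (P₆-at 6 5 3 12 10 9))) (P₆-at 7 6 5 3 12 11)))))))
  (P₆-at 6 5 3 12 11 10))))))))) (P₆-at 6 5 4 3 12 11)) (split 3 5 (P₆-at 6 5 3 0 12 11) (P₆-at 5 4 3 0 12
  11))))))))))))))))))))) (split 3 12 (split 0 11 (found 2 0 (1 ∷ 2 ∷ 3 ∷ 12 ∷ 11 ∷ [])) (claw-at 12 0 3 11))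
  (split 0 4 (split 3 5 (found 2 0 (1 ∷ 2 ∷ 3 ∷ 5 ∷ 4 ∷ [])) (claw-at 4 0 3 5)) (split 0 11 (split 4 11 (found 2
  0 (1 ∷ 2 ∷ 3 ∷ 4 ∷ 11 ∷ [])) (split 3 10 (found 2 0 (1 ∷ 2 ∷ 3 ∷ 10 ∷ 11 ∷ [])) (split 2 9 (found 2 0 (1 ∷ 2
  ∷ 9 ∷ 10 ∷ 11 ∷ [])) (split 1 9 (found 4 0 (1 ∷ 9 ∷ 10 ∷ 11 ∷ 12 ∷ [])) (split 0 8 (found 4 0 (8 ∷ 9 ∷ 10 ∷
  11 ∷ 12 ∷ [])) (split 8 12 (found 4 11 (10 ∷ 9 ∷ 8 ∷ 12 ∷ 0 ∷ [])) (split 3 8 (split 0 7 (found 2 0 (1 ∷ 2 ∷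
  3 ∷ 8 ∷ 7 ∷ [])) (split 3 5 (found 2 3 (4 ∷ 5 ∷ 6 ∷ 7 ∷ 8 ∷ [])) (split 3 6 (found 3 3 (4 ∷ 5 ∷ 6 ∷ 7 ∷ 8 ∷
  [])) (split 3 7 (found 4 3 (4 ∷ 5 ∷ 6 ∷ 7 ∷ 8 ∷ [])) (split 4 6 (found 2 4 (5 ∷ 6 ∷ 7 ∷ 8 ∷ 3 ∷ [])) (split
  4 7 (found 3 4 (5 ∷ 6 ∷ 7 ∷ 8 ∷ 3 ∷ [])) (split 5 7 (found 2 5 (6 ∷ 7 ∷ 8 ∷ 3 ∷ 4 ∷ [])) (split 2 5 (claw-at 2
  0 3 5) (split 2 7 (claw-at 2 0 3 7) (split 0 6 (claw-at 6 0 5 7) (split 2 6 (claw-at 2 0 3 6) (split 2 4 (P₆-at 0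
  2 4 5 6 7) (P₆-at 0 2 3 4 5 6))))))))))))) (split 2 8 (claw-at 2 0 3 8) (split 1 8 (split 1 3 (claw-at 1 0 3 8)
  (split 3 9 (found 4 1 (8 ∷ 9 ∷ 3 ∷ 2 ∷ 0 ∷ [])) (split 8 10 (found 2 8 (9 ∷ 10 ∷ 11 ∷ 0 ∷ 1 ∷ [])) (P₆-at 3
  2 1 8 9 10)))) (split 3 9 (split 0 9 (claw-at 9 0 3 8) (split 8 10 (split 0 10 (found 2 0 (1 ∷ 2 ∷ 3 ∷ 9 ∷ 10
  ∷ [])) (split 9 11 (found 2 0 (1 ∷ 2 ∷ 3 ∷ 9 ∷ 11 ∷ [])) (split 2 11 (found 4 2 (3 ∷ 9 ∷ 10 ∷ 11 ∷ 0 ∷ []))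
  (split 8 11 (split 5 8 (found 2 8 (10 ∷ 9 ∷ 3 ∷ 4 ∷ 5 ∷ [])) (split 5 9 (found 2 8 (10 ∷ 9 ∷ 5 ∷ 6 ∷ 7 ∷
  [])) (split 5 11 (claw-at 11 0 5 8) (split 4 8 (found 2 8 (11 ∷ 10 ∷ 9 ∷ 3 ∷ 4 ∷ [])) (split 4 9 (P₆-at 0 11 8
  9 4 5) (P₆-at 0 11 8 9 3 4)))))) (P₆-at 3 2 0 11 10 8))))) (claw-at 9 3 8 10))) (split 3 7 (split 0 7 (claw-at 7
  0 3 8) (split 7 12 (claw-at 7 3 8 12) (split 2 7 (found 4 3 (4 ∷ 5 ∷ 6 ∷ 7 ∷ 2 ∷ [])) (split 2 4 (found 4 3 (7
  ∷ 6 ∷ 5 ∷ 4 ∷ 2 ∷ [])) (split 4 7 (split 2 12 (split 0 10 (found 2 0 (1 ∷ 2 ∷ 12 ∷ 11 ∷ 10 ∷ [])) (split 0 9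
  (found 2 0 (2 ∷ 12 ∷ 11 ∷ 10 ∷ 9 ∷ [])) (split 4 10 (found 4 4 (10 ∷ 9 ∷ 8 ∷ 7 ∷ 3 ∷ [])) (split 7 9 (split
  2 11 (split 7 10 (found 4 2 (3 ∷ 7 ∷ 10 ∷ 11 ∷ 0 ∷ [])) (P₆-at 0 2 3 7 9 10)) (P₆-at 4 3 2 0 11 10)) (P₆-at
  0 2 3 7 8 9))))) (P₆-at 8 7 3 2 0 12)) (claw-at 3 2 4 7)))))) (split 0 7 (split 0 9 (found 3 0 (7 ∷ 8 ∷ 9 ∷ 10
  ∷ 11 ∷ [])) (split 0 10 (found 4 0 (7 ∷ 8 ∷ 9 ∷ 10 ∷ 11 ∷ [])) (split 7 9 (found 2 7 (8 ∷ 9 ∷ 10 ∷ 11 ∷ 0 ∷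
  [])) (split 7 10 (found 3 7 (8 ∷ 9 ∷ 10 ∷ 11 ∷ 0 ∷ [])) (split 8 10 (found 2 8 (9 ∷ 10 ∷ 11 ∷ 0 ∷ 7 ∷ []))
  (split 2 7 (P₆-at 3 2 7 8 9 10) (P₆-at 2 0 7 8 9 10))))))) (split 2 7 (claw-at 2 0 3 7) (split 0 6 (split 3 6
  (claw-at 6 0 3 7) (split 2 6 (found 4 2 (3 ∷ 4 ∷ 5 ∷ 6 ∷ 0 ∷ [])) (split 6 9 (found 4 0 (6 ∷ 9 ∷ 10 ∷ 11 ∷ 12
  ∷ [])) (split 0 9 (claw-at 0 2 6 9) (split 6 8 (P₆-at 3 2 0 6 8 9) (P₆-at 3 2 0 6 7 8)))))) (split 1 7 (split
  1 3 (claw-at 1 0 3 7) (split 7 10 (found 4 0 (1 ∷ 7 ∷ 10 ∷ 11 ∷ 12 ∷ [])) (split 7 9 (P₆-at 3 2 1 7 9 10)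
  (P₆-at 3 2 1 7 8 9)))) (split 1 6 (split 4 6 (found 4 1 (6 ∷ 4 ∷ 3 ∷ 2 ∷ 0 ∷ [])) (split 3 5 (found 4 1 (6 ∷
  5 ∷ 3 ∷ 2 ∷ 0 ∷ [])) (split 1 3 (found 2 1 (2 ∷ 3 ∷ 4 ∷ 5 ∷ 6 ∷ [])) (split 1 4 (found 3 1 (2 ∷ 3 ∷ 4 ∷ 5 ∷
  6 ∷ [])) (split 3 6 (found 3 3 (4 ∷ 5 ∷ 6 ∷ 1 ∷ 2 ∷ [])) (P₆-at 0 1 6 5 4 3)))))) (split 2 6 (split 3 6
  (split 7 11 (found 2 0 (1 ∷ 2 ∷ 6 ∷ 7 ∷ 11 ∷ [])) (split 7 12 (found 2 0 (1 ∷ 2 ∷ 6 ∷ 7 ∷ 12 ∷ [])) (split 6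
  10 (found 2 0 (1 ∷ 2 ∷ 6 ∷ 10 ∷ 11 ∷ [])) (split 6 11 (found 2 0 (1 ∷ 2 ∷ 6 ∷ 11 ∷ 12 ∷ [])) (split 6 12
  (found 2 0 (1 ∷ 2 ∷ 6 ∷ 12 ∷ 11 ∷ [])) (split 1 3 (found 4 2 (6 ∷ 5 ∷ 4 ∷ 3 ∷ 1 ∷ [])) (split 2 12 (split 0
  10 (found 2 0 (1 ∷ 2 ∷ 12 ∷ 11 ∷ 10 ∷ [])) (split 0 9 (found 2 0 (2 ∷ 12 ∷ 11 ∷ 10 ∷ 9 ∷ [])) (split 7 10
  (P₆-at 0 11 10 7 6 3) (split 2 11 (split 8 11 (found 4 2 (6 ∷ 7 ∷ 8 ∷ 11 ∷ 0 ∷ [])) (split 6 9 (found 4 2 (6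
  ∷ 9 ∷ 10 ∷ 11 ∷ 0 ∷ [])) (split 7 9 (P₆-at 0 2 6 7 9 10) (split 8 10 (P₆-at 3 2 11 10 8 7) (split 6 8 (P₆-at
  0 2 6 8 9 10) (P₆-at 0 2 6 7 8 9)))))) (P₆-at 7 6 2 0 11 10))))) (split 6 8 (split 0 9 (found 2 0 (1 ∷ 2 ∷ 6
  ∷ 8 ∷ 9 ∷ [])) (split 9 12 (P₆-at 3 2 0 12 9 8) (split 6 9 (split 0 10 (P₆-at 1 0 10 9 6 3) (split 9 11
  (found 2 0 (1 ∷ 2 ∷ 6 ∷ 9 ∷ 11 ∷ [])) (P₆-at 0 11 10 9 6 3))) (P₆-at 9 8 6 2 0 12)))) (P₆-at 8 7 6 2 0
  12))))))))) (claw-at 2 0 3 6)) (split 3 5 (split 5 11 (found 2 0 (1 ∷ 2 ∷ 3 ∷ 5 ∷ 11 ∷ [])) (split 1 4 (found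
  4 1 (4 ∷ 5 ∷ 3 ∷ 2 ∷ 0 ∷ [])) (split 4 8 (found 4 4 (8 ∷ 7 ∷ 6 ∷ 5 ∷ 3 ∷ [])) (split 0 9 (split 4 9 (claw-at 9
  0 4 8) (split 7 9 (split 5 9 (found 2 0 (1 ∷ 2 ∷ 3 ∷ 5 ∷ 9 ∷ [])) (split 7 10 (found 3 9 (8 ∷ 7 ∷ 10 ∷ 11 ∷
  0 ∷ [])) (split 0 10 (split 5 8 (P₆-at 1 0 9 8 5 4) (split 1 3 (P₆-at 4 3 1 0 9 8) (split 6 10 (found 3 9 (7
  ∷ 6 ∷ 10 ∷ 11 ∷ 0 ∷ [])) (split 5 10 (found 2 7 (8 ∷ 9 ∷ 10 ∷ 5 ∷ 6 ∷ [])) (split 5 7 (P₆-at 1 0 9 7 5 3)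
  (split 2 5 (P₆-at 7 6 5 2 0 10) (P₆-at 5 3 2 0 9 8))))))) (claw-at 9 0 7 10)))) (P₆-at 3 2 0 9 8 7))) (split 4
  9 (split 2 4 (split 7 9 (found 4 4 (9 ∷ 7 ∷ 6 ∷ 5 ∷ 3 ∷ [])) (split 4 7 (found 3 4 (5 ∷ 6 ∷ 7 ∷ 8 ∷ 9 ∷ []))
  (P₆-at 0 2 4 9 8 7))) (P₆-at 0 2 3 4 9 8)) (split 0 10 (split 4 10 (claw-at 10 0 4 9) (split 8 10 (split 5 10
  (found 2 0 (1 ∷ 2 ∷ 3 ∷ 5 ∷ 10 ∷ [])) (split 1 12 (found 2 0 (2 ∷ 1 ∷ 12 ∷ 11 ∷ 10 ∷ [])) (split 7 11 (found
  4 10 (9 ∷ 8 ∷ 7 ∷ 11 ∷ 0 ∷ [])) (split 10 12 (split 5 8 (P₆-at 1 0 10 8 5 4) (split 7 10 (split 1 3 (P₆-at 4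
  3 1 0 10 8) (split 6 11 (found 4 10 (8 ∷ 7 ∷ 6 ∷ 11 ∷ 0 ∷ [])) (split 5 7 (P₆-at 1 0 10 7 5 3) (split 2 5
  (split 2 11 (found 2 0 (1 ∷ 2 ∷ 11 ∷ 10 ∷ 12 ∷ [])) (P₆-at 7 6 5 2 0 11)) (P₆-at 5 3 2 0 10 8))))) (P₆-at 3
  2 0 10 8 7))) (claw-at 0 1 10 12))))) (P₆-at 3 2 0 10 9 8))) (split 9 11 (split 6 11 (found 2 9 (10 ∷ 11 ∷ 6 ∷
  7 ∷ 8 ∷ [])) (split 6 10 (found 2 9 (11 ∷ 10 ∷ 6 ∷ 7 ∷ 8 ∷ [])) (split 8 11 (split 8 10 (split 5 9 (found 2
  8 (11 ∷ 9 ∷ 5 ∷ 6 ∷ 7 ∷ [])) (split 6 9 (found 3 8 (11 ∷ 10 ∷ 9 ∷ 6 ∷ 7 ∷ [])) (split 7 11 (split 6 8 (found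
  4 7 (11 ∷ 9 ∷ 10 ∷ 8 ∷ 6 ∷ [])) (split 3 6 (P₆-at 0 2 3 6 7 8) (split 5 7 (split 2 11 (found 4 2 (3 ∷ 5 ∷ 7
  ∷ 11 ∷ 0 ∷ [])) (P₆-at 3 2 0 11 7 6)) (P₆-at 0 11 7 6 5 3)))) (split 2 11 (split 5 8 (found 4 2 (3 ∷ 5 ∷ 8 ∷
  11 ∷ 0 ∷ [])) (split 5 7 (P₆-at 0 11 8 7 5 3) (split 6 8 (split 2 5 (P₆-at 0 2 5 6 8 9) (P₆-at 5 3 2 11 8
  7)) (P₆-at 0 11 8 7 6 5)))) (P₆-at 3 2 0 11 8 7))))) (claw-at 11 0 8 10)) (split 2 11 (split 5 9 (found 4 2 (3
  ∷ 5 ∷ 9 ∷ 11 ∷ 0 ∷ [])) (split 5 10 (found 4 2 (3 ∷ 5 ∷ 10 ∷ 11 ∷ 0 ∷ [])) (split 5 8 (P₆-at 0 11 9 8 5 3)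
  (split 2 5 (split 6 9 (P₆-at 0 2 5 6 9 10) (split 6 8 (P₆-at 0 2 5 6 8 9) (P₆-at 6 5 2 11 9 8))) (P₆-at 5 3
  2 11 9 8))))) (P₆-at 3 2 0 11 9 8))))) (split 2 11 (split 6 11 (found 4 2 (3 ∷ 5 ∷ 6 ∷ 11 ∷ 0 ∷ [])) (split
  5 10 (found 4 2 (3 ∷ 5 ∷ 10 ∷ 11 ∷ 0 ∷ [])) (split 5 9 (P₆-at 0 11 10 9 5 3) (split 2 5 (split 6 10 (found 4
  2 (5 ∷ 6 ∷ 10 ∷ 11 ∷ 0 ∷ [])) (split 6 9 (P₆-at 0 2 5 6 9 10) (P₆-at 6 5 2 11 10 9))) (P₆-at 5 3 2 11 10
  9))))) (P₆-at 3 2 0 11 10 9))))))))) (split 2 5 (claw-at 2 0 3 5) (split 5 9 (split 4 9 (found 4 5 (6 ∷ 7 ∷ 8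
  ∷ 9 ∷ 4 ∷ [])) (split 4 6 (found 4 5 (9 ∷ 8 ∷ 7 ∷ 6 ∷ 4 ∷ [])) (split 5 10 (found 4 5 (6 ∷ 7 ∷ 8 ∷ 9 ∷ 10 ∷
  [])) (split 8 10 (found 2 8 (10 ∷ 9 ∷ 5 ∷ 6 ∷ 7 ∷ [])) (split 4 10 (claw-at 4 3 5 10) (split 5 8 (split 2 4
  (split 6 10 (found 3 5 (8 ∷ 7 ∷ 6 ∷ 10 ∷ 9 ∷ [])) (split 1 4 (split 0 10 (P₆-at 6 5 4 2 0 10) (split 0 9
  (found 2 0 (1 ∷ 2 ∷ 4 ∷ 5 ∷ 9 ∷ [])) (P₆-at 0 1 4 5 9 10))) (P₆-at 1 2 4 5 9 10))) (P₆-at 2 3 4 5 9 10))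
  (claw-at 9 5 8 10))))))) (split 4 9 (claw-at 4 3 5 9) (split 5 10 (split 5 7 (found 2 5 (6 ∷ 7 ∷ 8 ∷ 9 ∷ 10 ∷
  [])) (split 5 8 (found 3 5 (6 ∷ 7 ∷ 8 ∷ 9 ∷ 10 ∷ [])) (split 6 8 (found 2 6 (7 ∷ 8 ∷ 9 ∷ 10 ∷ 5 ∷ []))
  (split 6 9 (found 3 6 (7 ∷ 8 ∷ 9 ∷ 10 ∷ 5 ∷ [])) (split 7 9 (found 2 7 (8 ∷ 9 ∷ 10 ∷ 5 ∷ 6 ∷ [])) (split 4 7
  (claw-at 4 3 5 7) (split 4 8 (claw-at 4 3 5 8) (split 3 6 (claw-at 6 3 5 7) (split 4 6 (P₆-at 3 4 6 7 8 9) (P₆-at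
  3 4 5 6 7 8)))))))))) (split 4 10 (claw-at 4 3 5 10) (split 0 10 (split 2 4 (split 0 9 (split 5 8 (P₆-at 3 2 0
  9 8 5) (split 4 8 (found 2 0 (1 ∷ 2 ∷ 4 ∷ 8 ∷ 9 ∷ [])) (P₆-at 5 4 2 0 9 8))) (P₆-at 5 4 2 0 10 9)) (P₆-at 5
  4 3 2 0 10)) (split 5 11 (claw-at 11 0 5 10) (split 6 10 (split 3 6 (claw-at 6 3 5 10) (split 6 11 (found 4 6 (7
  ∷ 8 ∷ 9 ∷ 10 ∷ 11 ∷ [])) (split 4 6 (P₆-at 0 11 10 6 4 3) (P₆-at 0 11 10 6 5 4)))) (split 6 11 (claw-at 11 0 6
  10) (split 2 11 (split 2 4 (split 3 6 (P₆-at 5 6 3 2 11 10) (split 0 9 (found 2 0 (1 ∷ 2 ∷ 11 ∷ 10 ∷ 9 ∷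
  [])) (split 9 11 (split 4 6 (split 6 9 (P₆-at 0 2 4 6 9 10) (split 7 11 (found 4 2 (4 ∷ 6 ∷ 7 ∷ 11 ∷ 0 ∷
  [])) (split 4 8 (found 4 2 (4 ∷ 8 ∷ 9 ∷ 11 ∷ 0 ∷ [])) (split 6 8 (P₆-at 0 2 4 6 8 9) (split 7 9 (P₆-at 3 2
  11 9 7 6) (split 4 7 (P₆-at 0 2 4 7 8 9) (P₆-at 0 2 4 6 7 8))))))) (P₆-at 6 5 4 2 11 10)) (P₆-at 5 4 2 11 10
  9)))) (P₆-at 5 4 3 2 11 10)) (split 2 4 (P₆-at 5 4 2 0 11 10) (P₆-at 4 3 2 0 11
  10)))))))))))))))))))))))))))))) (split 2 11 (claw-at 2 0 3 11) (split 0 10 (split 3 10 (claw-at 10 0 3 11)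
  (split 4 10 (found 2 0 (1 ∷ 2 ∷ 3 ∷ 4 ∷ 10 ∷ [])) (split 3 9 (found 2 0 (1 ∷ 2 ∷ 3 ∷ 9 ∷ 10 ∷ [])) (split 2
  8 (found 2 0 (1 ∷ 2 ∷ 8 ∷ 9 ∷ 10 ∷ [])) (split 2 12 (found 2 0 (1 ∷ 2 ∷ 12 ∷ 11 ∷ 10 ∷ [])) (split 1 12
  (found 2 0 (2 ∷ 1 ∷ 12 ∷ 11 ∷ 10 ∷ [])) (split 2 9 (found 3 0 (2 ∷ 9 ∷ 10 ∷ 11 ∷ 12 ∷ [])) (split 0 8 (found
  3 0 (8 ∷ 9 ∷ 10 ∷ 11 ∷ 12 ∷ [])) (split 8 11 (found 3 10 (9 ∷ 8 ∷ 11 ∷ 12 ∷ 0 ∷ [])) (split 10 12 (split 8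
  10 (claw-at 10 0 8 11) (split 8 12 (claw-at 12 0 8 11) (split 3 8 (P₆-at 8 3 2 0 10 11) (split 1 11 (found 2 0
  (2 ∷ 1 ∷ 11 ∷ 10 ∷ 12 ∷ [])) (split 0 7 (found 4 0 (7 ∷ 8 ∷ 9 ∷ 10 ∷ 12 ∷ [])) (split 7 12 (found 4 10 (9 ∷
  8 ∷ 7 ∷ 12 ∷ 0 ∷ [])) (split 7 11 (found 2 10 (12 ∷ 11 ∷ 7 ∷ 8 ∷ 9 ∷ [])) (split 7 10 (claw-at 10 0 7 11)
  (split 0 9 (split 2 7 (P₆-at 8 7 2 0 12 11) (split 9 11 (claw-at 9 0 8 11) (split 3 7 (P₆-at 7 3 2 0 10 11)
  (split 4 9 (found 2 0 (1 ∷ 2 ∷ 3 ∷ 4 ∷ 9 ∷ [])) (split 0 6 (found 4 0 (6 ∷ 7 ∷ 8 ∷ 9 ∷ 10 ∷ [])) (split 6 10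
  (found 4 9 (8 ∷ 7 ∷ 6 ∷ 10 ∷ 0 ∷ [])) (split 7 9 (split 2 6 (found 2 0 (1 ∷ 2 ∷ 6 ∷ 7 ∷ 9 ∷ [])) (split 1 6
  (found 2 7 (8 ∷ 9 ∷ 0 ∷ 1 ∷ 6 ∷ [])) (split 5 10 (found 4 9 (7 ∷ 6 ∷ 5 ∷ 10 ∷ 0 ∷ [])) (split 6 11 (found 4
  9 (7 ∷ 6 ∷ 11 ∷ 10 ∷ 0 ∷ [])) (split 4 8 (found 2 7 (9 ∷ 8 ∷ 4 ∷ 5 ∷ 6 ∷ [])) (split 5 11 (P₆-at 1 0 10 11 5
  6) (split 4 11 (P₆-at 3 4 11 10 9 8) (split 2 4 (split 2 5 (P₆-at 6 5 2 0 10 11) (P₆-at 5 4 2 0 10 11))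
  (P₆-at 4 3 2 0 9 8))))))))) (P₆-at 3 2 0 9 8 7)))))))) (P₆-at 3 2 0 10 9 8)))))))))) (claw-at 0 1 10
  12))))))))))) (split 5 12 (split 5 11 (split 3 5 (found 2 0 (1 ∷ 2 ∷ 3 ∷ 5 ∷ 12 ∷ [])) (split 2 4 (found 2 0
  (1 ∷ 2 ∷ 4 ∷ 5 ∷ 12 ∷ [])) (split 2 5 (found 3 2 (3 ∷ 4 ∷ 5 ∷ 12 ∷ 0 ∷ [])) (split 2 12 (found 4 2 (3 ∷ 4 ∷
  5 ∷ 12 ∷ 0 ∷ [])) (split 4 11 (split 3 10 (found 2 5 (12 ∷ 11 ∷ 10 ∷ 3 ∷ 4 ∷ [])) (split 4 9 (found 2 5 (12
  ∷ 11 ∷ 10 ∷ 9 ∷ 4 ∷ [])) (split 4 10 (split 10 12 (split 9 12 (found 4 5 (12 ∷ 9 ∷ 10 ∷ 11 ∷ 4 ∷ [])) (claw-at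
  10 4 9 12)) (P₆-at 3 2 0 12 11 10)) (P₆-at 0 2 3 4 11 10)))) (P₆-at 0 2 3 4 5 11)))))) (claw-at 12 0 5 11))
  (split 1 11 (split 1 3 (claw-at 1 0 3 11) (split 4 11 (found 4 1 (11 ∷ 4 ∷ 3 ∷ 2 ∷ 0 ∷ [])) (split 3 10 (found
  4 1 (11 ∷ 10 ∷ 3 ∷ 2 ∷ 0 ∷ [])) (split 10 12 (found 2 0 (2 ∷ 1 ∷ 11 ∷ 10 ∷ 12 ∷ [])) (split 1 4 (claw-at 1 0 4
  11) (split 4 10 (P₆-at 0 12 11 10 4 3) (split 2 4 (split 0 6 (found 2 0 (1 ∷ 2 ∷ 4 ∷ 5 ∷ 6 ∷ [])) (split 1 6
  (found 4 1 (6 ∷ 5 ∷ 4 ∷ 2 ∷ 0 ∷ [])) (split 5 11 (found 4 1 (11 ∷ 5 ∷ 4 ∷ 2 ∷ 0 ∷ [])) (split 2 7 (found 2 2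
  (3 ∷ 4 ∷ 5 ∷ 6 ∷ 7 ∷ [])) (split 5 10 (P₆-at 0 1 11 10 5 4) (split 2 5 (split 0 7 (found 2 0 (1 ∷ 2 ∷ 5 ∷ 6
  ∷ 7 ∷ [])) (split 1 7 (found 4 1 (7 ∷ 6 ∷ 5 ∷ 2 ∷ 0 ∷ [])) (split 6 11 (found 4 1 (11 ∷ 6 ∷ 5 ∷ 2 ∷ 0 ∷ []))
  (split 6 10 (P₆-at 0 1 11 10 6 5) (split 2 6 (split 7 11 (found 4 1 (11 ∷ 7 ∷ 6 ∷ 2 ∷ 0 ∷ [])) (split 7 10
  (P₆-at 0 1 11 10 7 6) (P₆-at 7 6 2 1 11 10))) (P₆-at 6 5 2 1 11 10)))))) (P₆-at 5 4 2 1 11 10))))))) (P₆-at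
  4 3 2 1 11 10)))))))) (split 3 5 (split 0 6 (found 2 0 (1 ∷ 2 ∷ 3 ∷ 5 ∷ 6 ∷ [])) (split 2 7 (found 2 3 (4 ∷
  5 ∷ 6 ∷ 7 ∷ 2 ∷ [])) (split 3 8 (found 2 3 (4 ∷ 5 ∷ 6 ∷ 7 ∷ 8 ∷ [])) (split 0 8 (split 3 9 (found 2 0 (1 ∷ 2
  ∷ 3 ∷ 9 ∷ 8 ∷ [])) (split 0 9 (found 2 0 (8 ∷ 9 ∷ 10 ∷ 11 ∷ 12 ∷ [])) (split 8 10 (found 2 8 (9 ∷ 10 ∷ 11 ∷
  12 ∷ 0 ∷ [])) (split 8 11 (found 3 8 (9 ∷ 10 ∷ 11 ∷ 12 ∷ 0 ∷ [])) (split 9 11 (found 2 9 (10 ∷ 11 ∷ 12 ∷ 0 ∷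
  8 ∷ [])) (split 2 9 (claw-at 2 0 3 9) (split 3 10 (claw-at 10 3 9 11) (split 2 8 (P₆-at 3 2 8 9 10 11) (P₆-at 2
  0 8 9 10 11))))))))) (split 2 8 (claw-at 2 0 3 8) (split 6 11 (split 6 8 (found 2 6 (7 ∷ 8 ∷ 9 ∷ 10 ∷ 11 ∷
  [])) (split 6 9 (found 3 6 (7 ∷ 8 ∷ 9 ∷ 10 ∷ 11 ∷ [])) (split 7 9 (found 2 7 (8 ∷ 9 ∷ 10 ∷ 11 ∷ 6 ∷ []))
  (split 7 11 (found 4 7 (8 ∷ 9 ∷ 10 ∷ 11 ∷ 6 ∷ [])) (split 8 10 (found 2 8 (9 ∷ 10 ∷ 11 ∷ 6 ∷ 7 ∷ [])) (split
  8 11 (found 3 8 (9 ∷ 10 ∷ 11 ∷ 6 ∷ 7 ∷ [])) (split 9 11 (found 2 9 (10 ∷ 11 ∷ 6 ∷ 7 ∷ 8 ∷ [])) (split 0 7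
  (claw-at 7 0 6 8) (split 0 9 (claw-at 9 0 8 10) (split 8 12 (claw-at 12 0 8 11) (split 7 12 (claw-at 12 0 7 11)
  (split 9 12 (claw-at 12 0 9 11) (split 6 12 (P₆-at 0 12 6 7 8 9) (P₆-at 0 12 11 6 7 8)))))))))))))) (split 6
  12 (claw-at 12 0 6 11) (split 2 6 (split 3 6 (split 7 12 (found 2 0 (1 ∷ 2 ∷ 6 ∷ 7 ∷ 12 ∷ [])) (split 0 7
  (found 3 2 (3 ∷ 5 ∷ 6 ∷ 7 ∷ 0 ∷ [])) (split 5 7 (found 2 3 (4 ∷ 5 ∷ 7 ∷ 6 ∷ 2 ∷ [])) (split 2 5 (split 2 9
  (found 2 2 (3 ∷ 6 ∷ 7 ∷ 8 ∷ 9 ∷ [])) (split 3 7 (found 3 2 (5 ∷ 4 ∷ 3 ∷ 7 ∷ 6 ∷ [])) (split 7 11 (P₆-at 0 12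
  11 7 6 3) (split 2 12 (split 8 12 (found 4 2 (6 ∷ 7 ∷ 8 ∷ 12 ∷ 0 ∷ [])) (split 6 10 (found 4 2 (6 ∷ 10 ∷ 11
  ∷ 12 ∷ 0 ∷ [])) (split 0 9 (found 2 0 (2 ∷ 12 ∷ 11 ∷ 10 ∷ 9 ∷ [])) (split 7 10 (P₆-at 0 2 6 7 10 11) (split
  8 11 (P₆-at 3 2 12 11 8 7) (split 10 12 (split 6 8 (split 8 10 (P₆-at 0 2 6 8 10 11) (split 6 9 (found 4 2
  (6 ∷ 9 ∷ 10 ∷ 12 ∷ 0 ∷ [])) (P₆-at 0 2 6 8 9 10))) (P₆-at 8 7 6 2 12 11)) (P₆-at 7 6 2 12 11 10)))))))
  (P₆-at 7 6 2 0 12 11))))) (claw-at 6 2 5 7))))) (claw-at 2 0 3 6)) (split 3 6 (split 2 12 (split 0 7 (found 2 0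
  (1 ∷ 2 ∷ 3 ∷ 6 ∷ 7 ∷ [])) (split 3 9 (found 2 3 (5 ∷ 6 ∷ 7 ∷ 8 ∷ 9 ∷ [])) (split 3 10 (found 4 2 (3 ∷ 10 ∷
  11 ∷ 12 ∷ 0 ∷ [])) (split 2 9 (found 4 2 (9 ∷ 10 ∷ 11 ∷ 12 ∷ 0 ∷ [])) (split 0 9 (found 2 0 (2 ∷ 12 ∷ 11 ∷
  10 ∷ 9 ∷ [])) (split 6 10 (P₆-at 0 2 3 6 10 11) (split 6 9 (P₆-at 0 2 3 6 9 10) (split 10 12 (split 6 8
  (P₆-at 0 2 3 6 8 9) (split 9 12 (split 3 7 (split 8 12 (found 4 2 (3 ∷ 7 ∷ 8 ∷ 12 ∷ 0 ∷ [])) (P₆-at 6 3 2 12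
  9 8)) (P₆-at 0 2 3 6 7 8)) (P₆-at 6 3 2 12 10 9))) (P₆-at 6 3 2 12 11 10))))))))) (P₆-at 6 3 2 0 12 11))
  (split 5 11 (claw-at 5 3 6 11) (split 3 10 (split 6 10 (claw-at 10 3 6 11) (split 10 12 (found 2 0 (1 ∷ 2 ∷ 3 ∷
  10 ∷ 12 ∷ [])) (split 5 10 (P₆-at 0 12 11 10 5 6) (P₆-at 0 12 11 10 3 5)))) (split 6 10 (split 5 10 (found 4
  6 (7 ∷ 8 ∷ 9 ∷ 10 ∷ 5 ∷ [])) (split 2 5 (P₆-at 0 2 5 6 10 11) (P₆-at 0 2 3 5 6 10))) (split 5 10 (claw-at 5 3
  6 10) (split 5 9 (split 0 9 (claw-at 9 0 5 10) (split 3 9 (found 4 5 (6 ∷ 7 ∷ 8 ∷ 9 ∷ 3 ∷ [])) (split 2 9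
  (claw-at 2 0 3 9) (split 2 5 (split 9 11 (split 9 12 (found 2 0 (1 ∷ 2 ∷ 5 ∷ 9 ∷ 12 ∷ [])) (P₆-at 0 12 11 9 5
  3)) (P₆-at 0 2 5 9 10 11)) (P₆-at 0 2 3 5 9 10))))) (split 0 9 (split 8 10 (found 2 9 (8 ∷ 10 ∷ 11 ∷ 12 ∷ 0
  ∷ [])) (claw-at 9 0 8 10)) (split 2 5 (split 2 9 (claw-at 2 0 5 9) (split 2 12 (split 0 7 (found 2 0 (1 ∷ 2 ∷ 5
  ∷ 6 ∷ 7 ∷ [])) (split 6 9 (P₆-at 0 2 5 6 9 10) (split 10 12 (split 7 12 (found 4 2 (5 ∷ 6 ∷ 7 ∷ 12 ∷ 0 ∷
  [])) (split 9 12 (split 7 11 (found 2 10 (12 ∷ 11 ∷ 7 ∷ 8 ∷ 9 ∷ [])) (split 5 7 (split 5 8 (found 4 2 (5 ∷ 8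
  ∷ 9 ∷ 12 ∷ 0 ∷ [])) (split 7 10 (found 3 9 (12 ∷ 11 ∷ 10 ∷ 7 ∷ 8 ∷ [])) (split 7 9 (P₆-at 0 2 5 7 9 10)
  (P₆-at 0 2 5 7 8 9)))) (P₆-at 7 6 5 2 12 11))) (P₆-at 6 5 2 12 10 9))) (P₆-at 6 5 2 12 11 10)))) (P₆-at 6 5
  2 0 12 11))) (split 2 12 (P₆-at 6 5 3 2 12 11) (P₆-at 5 3 2 0 12 11)))))))))))))))))) (split 2 5 (claw-at 2 0
  3 5) (split 4 11 (split 5 11 (split 2 12 (found 4 2 (3 ∷ 4 ∷ 11 ∷ 12 ∷ 0 ∷ [])) (P₆-at 3 2 0 12 11 5))
  (claw-at 4 3 5 11)) (split 5 11 (P₆-at 0 12 11 5 4 3) (split 1 4 (split 1 12 (found 4 0 (2 ∷ 3 ∷ 4 ∷ 1 ∷ 12 ∷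
  [])) (P₆-at 5 4 1 0 12 11)) (split 5 10 (split 5 7 (found 2 5 (6 ∷ 7 ∷ 8 ∷ 9 ∷ 10 ∷ [])) (split 5 8 (found 3
  5 (6 ∷ 7 ∷ 8 ∷ 9 ∷ 10 ∷ [])) (split 5 9 (found 4 5 (6 ∷ 7 ∷ 8 ∷ 9 ∷ 10 ∷ [])) (split 6 8 (found 2 6 (7 ∷ 8 ∷
  9 ∷ 10 ∷ 5 ∷ [])) (split 6 9 (found 3 6 (7 ∷ 8 ∷ 9 ∷ 10 ∷ 5 ∷ [])) (split 6 10 (found 4 6 (7 ∷ 8 ∷ 9 ∷ 10 ∷
  5 ∷ [])) (split 7 9 (found 2 7 (8 ∷ 9 ∷ 10 ∷ 5 ∷ 6 ∷ [])) (split 7 10 (found 3 7 (8 ∷ 9 ∷ 10 ∷ 5 ∷ 6 ∷ []))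
  (split 8 10 (found 2 8 (9 ∷ 10 ∷ 5 ∷ 6 ∷ 7 ∷ [])) (split 9 11 (split 0 8 (found 2 9 (10 ∷ 11 ∷ 12 ∷ 0 ∷ 8 ∷
  [])) (split 7 11 (found 2 11 (9 ∷ 10 ∷ 5 ∷ 6 ∷ 7 ∷ [])) (split 6 12 (found 2 11 (9 ∷ 10 ∷ 5 ∷ 6 ∷ 12 ∷ []))
  (split 6 11 (found 2 9 (10 ∷ 11 ∷ 6 ∷ 7 ∷ 8 ∷ [])) (split 7 12 (found 2 9 (10 ∷ 11 ∷ 12 ∷ 7 ∷ 8 ∷ []))
  (split 8 11 (split 10 12 (split 8 12 (claw-at 12 0 8 10) (P₆-at 5 6 7 8 11 12)) (P₆-at 7 6 5 10 11 12)) (P₆-at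
  5 6 7 8 9 11))))))) (claw-at 10 5 9 11))))))))))) (split 2 4 (split 4 10 (claw-at 4 2 5 10) (split 2 12 (split 2
  7 (found 2 2 (3 ∷ 4 ∷ 5 ∷ 6 ∷ 7 ∷ [])) (split 3 7 (found 4 3 (7 ∷ 6 ∷ 5 ∷ 4 ∷ 2 ∷ [])) (split 1 12 (split 10
  12 (split 2 9 (found 4 2 (9 ∷ 10 ∷ 11 ∷ 12 ∷ 0 ∷ [])) (split 0 9 (found 2 0 (2 ∷ 12 ∷ 11 ∷ 10 ∷ 9 ∷ []))
  (split 0 8 (found 2 0 (1 ∷ 12 ∷ 10 ∷ 9 ∷ 8 ∷ [])) (split 4 9 (found 4 2 (4 ∷ 9 ∷ 10 ∷ 12 ∷ 0 ∷ [])) (split 2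
  8 (found 4 2 (8 ∷ 9 ∷ 10 ∷ 12 ∷ 0 ∷ [])) (split 7 12 (found 2 10 (11 ∷ 12 ∷ 7 ∷ 8 ∷ 9 ∷ [])) (split 5 9
  (P₆-at 0 2 4 5 9 10) (split 9 12 (split 0 7 (found 2 0 (1 ∷ 12 ∷ 9 ∷ 8 ∷ 7 ∷ [])) (split 3 8 (found 4 2 (3 ∷
  8 ∷ 9 ∷ 12 ∷ 0 ∷ [])) (split 4 8 (found 4 2 (4 ∷ 8 ∷ 9 ∷ 12 ∷ 0 ∷ [])) (split 5 8 (P₆-at 0 2 4 5 8 9) (split
  8 12 (split 4 7 (P₆-at 0 12 8 7 4 3) (split 5 7 (P₆-at 3 2 12 8 7 5) (P₆-at 5 4 2 12 8 7))) (P₆-at 5 4 2 12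
  9 8)))))) (P₆-at 5 4 2 12 10 9))))))))) (P₆-at 5 4 2 12 11 10)) (claw-at 2 1 4 12)))) (P₆-at 5 4 2 0 12 11)))
  (split 2 12 (P₆-at 5 4 3 2 12 11) (P₆-at 4 3 2 0 12 11))))))))))))))))))))))

span-free-certificate-6 : Certificate
span-free-certificate-6 =
  split 0 4 (split 0 5 (found 4 0 (1 ∷ 2 ∷ 3 ∷ 4 ∷ 5 ∷ [])) (split 4 12 (found 4 0 (1 ∷ 2 ∷ 3 ∷ 4 ∷ 12 ∷ []))
  (split 1 12 (found 4 0 (4 ∷ 3 ∷ 2 ∷ 1 ∷ 12 ∷ [])) (split 1 4 (split 0 3 (split 3 12 (found 2 0 (4 ∷ 1 ∷ 2 ∷
  3 ∷ 12 ∷ [])) (claw-at 0 1 3 12)) (claw-at 4 0 3 5)) (claw-at 0 1 4 12))))) (split 1 4 (claw-at 1 0 2 4) (split 0 3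
  (claw-at 3 0 2 4) (split 1 5 (split 1 6 (found 4 1 (2 ∷ 3 ∷ 4 ∷ 5 ∷ 6 ∷ [])) (claw-at 5 1 4 6)) (split 2 5
  (claw-at 2 1 3 5) (split 0 5 (split 0 6 (split 3 6 (found 4 0 (1 ∷ 2 ∷ 3 ∷ 6 ∷ 5 ∷ [])) (split 2 7 (found 4 0
  (1 ∷ 2 ∷ 7 ∷ 6 ∷ 5 ∷ [])) (split 2 6 (found 4 5 (4 ∷ 3 ∷ 2 ∷ 6 ∷ 0 ∷ [])) (split 3 7 (found 4 5 (4 ∷ 3 ∷ 7 ∷
  6 ∷ 0 ∷ [])) (split 4 7 (claw-at 4 3 5 7) (P₆-at 2 3 4 5 6 7)))))) (claw-at 5 0 4 6)) (P₆-at 0 1 2 3 4 5))))))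

-- Passing over 1 by the edge 0 2 already yields the 7-cycle 0 2 3 4 5 6 7, and only a chord is
-- wanted. If every split fails, its vertices 0 2 3 4 5 6 induce a path.
spanned-certificate-7 : Certificate
spanned-certificate-7 =
  split 0 6 (found 2 0 (1 ∷ 2 ∷ 3 ∷ 4 ∷ 5 ∷ 6 ∷ [])) (split 4 6 (found 2 0 (1 ∷ 2 ∷ 3 ∷ 4 ∷ 6 ∷ 7 ∷ []))
  (split 3 5 (found 2 0 (1 ∷ 2 ∷ 3 ∷ 5 ∷ 6 ∷ 7 ∷ [])) (split 2 4 (found 2 0 (1 ∷ 2 ∷ 4 ∷ 5 ∷ 6 ∷ 7 ∷ []))
  (split 0 3 (found 2 0 (2 ∷ 3 ∷ 4 ∷ 5 ∷ 6 ∷ 7 ∷ [])) (split 0 4 (found 3 0 (2 ∷ 3 ∷ 4 ∷ 5 ∷ 6 ∷ 7 ∷ []))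
  (split 0 5 (found 4 0 (2 ∷ 3 ∷ 4 ∷ 5 ∷ 6 ∷ 7 ∷ [])) (split 2 5 (found 3 2 (3 ∷ 4 ∷ 5 ∷ 6 ∷ 7 ∷ 0 ∷ []))
  (split 2 6 (found 4 2 (3 ∷ 4 ∷ 5 ∷ 6 ∷ 7 ∷ 0 ∷ [])) (split 3 6 (found 3 3 (4 ∷ 5 ∷ 6 ∷ 7 ∷ 0 ∷ 2 ∷ []))
  (P₆-at 0 2 3 4 5 6))))))))))

span-free-certificate-7 : Certificate
span-free-certificate-7 =
  split 4 7 (split 0 6 (found 5 0 (1 ∷ 2 ∷ 3 ∷ 4 ∷ 7 ∷ 6 ∷ [])) (split 2 6 (found 3 6 (5 ∷ 4 ∷ 7 ∷ 0 ∷ 1 ∷ 2 ∷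
  [])) (split 1 5 (found 3 4 (7 ∷ 6 ∷ 5 ∷ 1 ∷ 2 ∷ 3 ∷ [])) (split 1 6 (claw-at 1 0 2 6) (split 2 5 (claw-at 2 1 3
  5) (split 3 6 (claw-at 3 2 4 6) (split 1 4 (claw-at 4 1 3 5) (P₆-at 1 2 3 4 5 6)))))))) (split 0 4 (split 3 6
  (found 3 3 (6 ∷ 5 ∷ 4 ∷ 0 ∷ 1 ∷ 2 ∷ [])) (split 2 7 (found 3 0 (1 ∷ 2 ∷ 7 ∷ 6 ∷ 5 ∷ 4 ∷ [])) (split 1 6
  (found 4 0 (4 ∷ 3 ∷ 2 ∷ 1 ∷ 6 ∷ 7 ∷ [])) (split 2 5 (found 3 4 (3 ∷ 2 ∷ 5 ∷ 6 ∷ 7 ∷ 0 ∷ [])) (split 2 6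
  (claw-at 2 1 3 6) (split 3 7 (claw-at 3 2 4 7) (P₆-at 2 3 4 5 6 7))))))) (split 1 4 (claw-at 1 0 2 4) (split 0 3
  (claw-at 3 0 2 4) (split 1 5 (split 2 7 (found 4 1 (5 ∷ 4 ∷ 3 ∷ 2 ∷ 7 ∷ 0 ∷ [])) (split 1 7 (found 4 1 (2 ∷ 3
  ∷ 4 ∷ 5 ∷ 6 ∷ 7 ∷ [])) (split 3 7 (claw-at 3 2 4 7) (P₆-at 4 3 2 1 0 7)))) (split 2 5 (claw-at 2 1 3 5) (split 0
  5 (split 1 7 (found 5 0 (5 ∷ 4 ∷ 3 ∷ 2 ∷ 1 ∷ 7 ∷ [])) (claw-at 0 1 5 7)) (P₆-at 0 1 2 3 4 5)))))))

-- From lists of vertices to cycles, and rotating a cycle to a given chord.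

module Trails {n : ℕ} (G : Graph n) where

  open Paths G

  Trail-map : ∀ {f : ℕ → Fin n} x xs → All (λ (i , j) → f i ~ f j) (steps x xs) →
              Trail (f x) (f (lastOf x xs)) (map f (x ∷ xs))
  Trail-map x []       []       = [-]
  Trail-map x (y ∷ ys) (e ∷ es) = e ∷ Trail-map y ys es

  at-first : ∀ {d u v xs} → Trail u v xs → at d xs 0 ≡ u
  at-first [-]     = refl
  at-first (_ ∷ _) = refl

  at-last : ∀ {d u v xs i} → Trail u v xs → suc i ≡ length xs → at d xs i ≡ v
  at-last [-]                  refl = refl
  at-last (_ ∷ [-])            refl = refl
  at-last (_ ∷ t@(_ ∷ _)) refl = at-last t refl

  at-edge : ∀ {d u v xs i} → Trail u v xs → suc i < length xs → at d xs i ~ at d xs (suc i)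
  at-edge {i = zero} (e ∷ [-])     _ = e
  at-edge {i = zero} (e ∷ (_ ∷ _)) _ = e
  at-edge {i = suc i} (_ ∷ t)    (s≤s i<) = at-edge t i<
  at-edge [-] (s≤s ())

  -- The back part may be empty, in which case the joint is `v` itself. The field `replace` hides
  -- this distinction from the user.
  record Break (k : ℕ) (u v : Fin n) (xs : List (Fin n)) : Set where
    field
      front back   : List (Fin n)
      joint        : Fin n
      splits       : xs ≡ front ++ back
      front-length : length front ≡ suc k
      front-trail  : Trail u joint front
      replace      : ∀ {w ys} → Trail w joint ys → Trail w v (ys ++ back)

  break : ∀ k {u v xs} → Trail u v xs → k < length xs → Break k u v xs
  break k {xs = xs} [-] (s≤s z≤n) = record
    { front = xs ; back = [] ; splits = refl ; front-length = refl ; front-trail = [-]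
    ; replace = λ {_} {ys} t → subst (Trail _ _) (≡-sym (++-identityʳ ys)) t }
  break zero {xs = x ∷ xs} (e ∷ t) _ = record
    { front = [ x ] ; back = xs ; splits = refl ; front-length = refl ; front-trail = [-]
    ; replace = λ s → Trail-++ s e t }
  break (suc k) {xs = x ∷ xs} (e ∷ t) (s≤s k<) = record
    { front = x ∷ front ; back = back ; splits = cong (x ∷_) splits ; front-length = cong suc front-length
    ; front-trail = e ∷ front-trail ; replace = replace }
    where open Break (break k t k<)

  to-cycle : ∀ {u v xs} → Trail u v xs → v ~ u → Unique xs → 3 ≤ length xs → Cycle G (length xs)
  to-cycle {u} {v} {xs} t v~u unique 3≤ = record
    { len≥3 = 3≤
    ; vert  = λ i → at u xs (toℕ i)
    ; inj   = λ {i} {j} e → Fin.toℕ-injective (at-injective unique (Fin.toℕ<n i) (Fin.toℕ<n j) e)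
    ; edges = λ where
        i j (inj₁ i+1≡j) → subst (λ k → at u xs (toℕ i) ~ at u xs k) i+1≡j
          (at-edge t (subst (_< length xs) (≡-sym i+1≡j) (Fin.toℕ<n j)))
        i j (inj₂ (i+1≡m , j≡0)) → subst₂ _~_ (≡-sym (at-last t i+1≡m))
          (≡-sym (trans (cong (at u xs) j≡0) (at-first t))) v~u
    }

  CycNext? : ∀ m i j → Dec (CycNext m i j)
  CycNext? m i j = (suc (toℕ i) ℕ.≟ toℕ j) ⊎-dec ((suc (toℕ i) ℕ.≟ m) ×-dec (toℕ j ℕ.≟ 0))

  -- Six consecutive vertices of a chordless cycle induce a path as soon as there is a seventh: with
  -- only six, the closing edge would join the ends.
  long⇒chord : Free (pathGraph 6) G → ∀ {m} (C : Cycle G m) → 7 ≤ m → HasChord C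
  long⇒chord P₆-free {m} C 7≤m with Fin.any? (λ i → Fin.any? (λ j →
      ¬? (i Fin.≟ j) ×-dec ¬? (CycNext? m i j) ×-dec ¬? (CycNext? m j i) ×-dec (vert C i ~? vert C j)))
  ... | yes chord = chord
  ... | no chordless = ⊥-elim (P₆-free (emb , emb-inj , ordered-agree (pathGraph 6) emb agree))
    where
    6≤m : 6 ≤ m
    6≤m = ℕ.≤-trans (ℕ.n≤1+n 6) 7≤m
    emb : Fin 6 → Fin n
    emb i = vert C (inject≤ i 6≤m)
    emb-inj : Injective _≡_ _≡_ emb
    emb-inj e = Fin.inject≤-injective 6≤m 6≤m _ _ (inj C e)
    toℕ-inj : ∀ i → toℕ (inject≤ i 6≤m) ≡ toℕ i
    toℕ-inj i = Fin.toℕ-inject≤ i 6≤m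
    not-last : ∀ (i : Fin 6) → suc (toℕ (inject≤ i 6≤m)) ≢ m
    not-last i e = ℕ.<⇒≢ (ℕ.≤-trans (s≤s (Fin.toℕ<n i)) 7≤m) (trans (cong suc (≡-sym (toℕ-inj i))) e)
    next : ∀ {i j : Fin 6} → CycNext m (inject≤ i 6≤m) (inject≤ j 6≤m) → suc (toℕ i) ≡ toℕ j
    next {i} {j} (inj₁ e) = trans (cong suc (≡-sym (toℕ-inj i))) (trans e (toℕ-inj j))
    next {i} (inj₂ (e , _)) = contradiction e (not-last i)
    pathAdj-suc : ∀ i j → pathAdjℕ (suc i) (suc j) ≡ pathAdjℕ i j
    pathAdj-suc zero    _ = refl
    pathAdj-suc (suc _) _ = refl
    pathAdj⇒ : ∀ i j → i < j → (suc i ≡ j × pathAdjℕ i j ≡ true) ⊎ (suc i ≢ j × pathAdjℕ i j ≡ false)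
    pathAdj⇒ zero    (suc zero)    _         = inj₁ (refl , refl)
    pathAdj⇒ zero    (suc (suc j)) _         = inj₂ ((λ ()) , refl)
    pathAdj⇒ (suc i) (suc j)       (s≤s i<j) with pathAdj⇒ i j i<j
    ... | inj₁ (e , p) = inj₁ (cong suc e , trans (pathAdj-suc i j) p)
    ... | inj₂ (e , p) = inj₂ (e ∘ ℕ.suc-injective , trans (pathAdj-suc i j) p)
    agree : ∀ i j → T (toℕ i <ᵇ toℕ j) → adj G (emb i) (emb j) ≡ pathAdjℕ (toℕ i) (toℕ j)
    agree i j t with pathAdj⇒ (toℕ i) (toℕ j) (ℕ.<ᵇ⇒< _ _ t)
    ... | inj₁ (e , p) = trans
      (edges C _ _ (inj₁ (trans (cong suc (toℕ-inj i)) (trans e (≡-sym (toℕ-inj j)))))) (≡-sym p)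
    ... | inj₂ (e , p) = trans (≁⇒false λ i~j → chordless (inject≤ i 6≤m , inject≤ j 6≤m ,
        (λ i≡j → ℕ.<⇒≢ i<j (cong toℕ (Fin.inject≤-injective 6≤m 6≤m i j i≡j))) ,
        e ∘ next ,
        (λ j→i → ℕ.<-asym i<j (ℕ.≤-reflexive (next j→i))) ,
        i~j)) (≡-sym p)
      where
      i<j : toℕ i < toℕ j
      i<j = ℕ.<ᵇ⇒< _ _ t

  -- A chord between vertices at distance two can be assumed to join positions 0 and 2, after rotation;
  -- without such chords the certificates are short, even if the pairs across the starting point are ignored.
  record SpanCycle (xs : List (Fin n)) : Set where
    constructor span-cycle
    field
      {a b c z} : Fin n
      {ys}      : List (Fin n)
      a~c       : a ~ c
      tour      : Trail a z (a ∷ b ∷ c ∷ ys)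
      z~a       : z ~ a
      covers    : a ∷ b ∷ c ∷ ys ↭ xs

  SpanFree : List (Fin n) → Set
  SpanFree xs = ∀ {d i} → 2 + i < length xs → ¬ at d xs i ~ at d xs (2 + i)

  -- The part of the cycle already passed, leading from the end `z` of the remaining trail back to
  -- its start `s`. While nothing has been passed, this is the closing edge alone.
  data Prefix (s z : Fin n) : List (Fin n) → Set where
    []     : z ~ s → Prefix s z []
    prefix : ∀ {u w xs} → z ~ u → Trail u w xs → w ~ s → Prefix s z xs

  close : ∀ {s z xs ys} → Trail s z xs → Prefix s z ys → ∃[ w ] (Trail s w (xs ++ ys) × w ~ s)
  close {xs = xs} t ([] z~s)  = _ , subst (Trail _ _) (≡-sym (++-identityʳ xs)) t , z~s
  close t (prefix z~u p w~s) = _ , Trail-++ t z~u p , w~s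

  advance : ∀ {s y z xs} → s ~ y → Prefix s z xs → Prefix y z (xs ++ [ s ])
  advance s~y ([] z~s)          = prefix z~s [-] s~y
  advance s~y (prefix z~u p w~s) = prefix z~u (Trail-++ p w~s [-]) s~y

  -- The search rotates the cycle: each vertex that fails moves from the front of the trail to the
  -- end of the prefix. A chord found later thus joins positions 0 and 2 of the current rotation,
  -- which `close` turns into a full tour.
  find-span : ∀ {s z xs ys} → Trail s z xs → Prefix s z ys → SpanCycle (xs ++ ys) ⊎ SpanFree xs
  find-span [-]       _ = inj₂ λ { (s≤s ()) }
  find-span (_ ∷ [-]) _ = inj₂ λ { (s≤s (s≤s ())) }
  find-span {ys = ys} t@(_∷_ {x = a} a~b t′@(_∷_ {x = b} {ys = c ∷ xs} _ _)) p =
    choose (a ~? c) (find-span t′ (advance a~b p))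
    where
    choose : Dec (a ~ c) → SpanCycle ((b ∷ c ∷ xs) ++ ys ++ [ a ]) ⊎ SpanFree (b ∷ c ∷ xs) →
             SpanCycle ((a ∷ b ∷ c ∷ xs) ++ ys) ⊎ SpanFree (a ∷ b ∷ c ∷ xs)
    choose (yes a~c) _ with _ , t″ , w~a ← close t p = inj₁ (span-cycle a~c t″ w~a ↭-refl)
    choose (no _) (inj₁ (span-cycle e s z~ cov)) = inj₁ (span-cycle e s z~ (↭-trans cov
      (↭-trans (++⁺ (↭-refl {x = b ∷ c ∷ xs}) (++-comm ys [ a ])) (shift a (b ∷ c ∷ xs) ys))))
    choose (no a≁c) (inj₂ none) = inj₂ span-free
      where
      span-free : SpanFree (a ∷ b ∷ c ∷ xs)
      span-free {i = zero}  _        = a≁c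
      span-free {i = suc _} (s≤s i<) = none i<

-- Cycles of all lengths.

module Pancyclicity {n : ℕ} (G : Graph n) (claw-free : Free claw G) (P₆-free : Free (pathGraph 6) G) where

  open Paths G
  open Trails G

  -- The path found in the window has the same ends as the window, so it can take its place; its
  -- vertices come from the window and hence avoid the rest of the cycle.
  shorten : ∀ {C} → Unique C → Closed C → 9 ≤ length C →
            ∃[ C′ ] (Unique C′ × Closed C′ × suc (length C′) ≡ length C)
  shorten {C} unique (u , v , (ys , p , t) , v~u) 9≤ = result
    where
    -- The argument is the index of the last vertex in front, so 8 cuts off nine vertices.
    open Break (break 8 t (ℕ.≤-trans 9≤ (ℕ.≤-reflexive (≡-sym (↭-length p)))))
    unique-ys : Unique (front ++ back)
    unique-ys = subst Unique splits (Unique-resp-↭ (↭-sym p) unique)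
    in-front : ∀ {i} → i < 9 → i < length front
    in-front = subst (_ <_) (≡-sym front-length)
    f : ℕ → Fin n
    f = at u front
    f-inj : ∀ {i j} → i < 9 → j < 9 → f i ≡ f j → i ≡ j
    f-inj i<9 j<9 = at-injective (proj₁ (Unique-++⁻ front unique-ys)) (in-front i<9) (in-front j<9)
    result : ∃[ C′ ] (Unique C′ × Closed C′ × suc (length C′) ≡ length C)
    result with Check.Sound.check-sound 9 shortcut G claw-free P₆-free f f-inj
                  (All.applyUpTo⁺₁ (λ i → i , suc i) 8 (λ i<8 → at-edge front-trail (in-front (s≤s i<8))))
                  [] shortcut-certificate tt
    ... | _ , x , xs , (uq , bounded , x≡0 , last≡8 , len) , es =
      map f (x ∷ xs) ++ back ,
      Unique.++⁺ (Unique-map f-inj bounded uq) (proj₂ (Unique-++⁻ front unique-ys)) disjoint ,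
      (u , v , trail (replace (subst₂ (λ a b → Trail a b (map f (x ∷ xs))) first last (Trail-map x xs es))) , v~u) ,
      lengths
      where
      first : f x ≡ u
      first = trans (cong f x≡0) (at-first front-trail)
      last : f (lastOf x xs) ≡ joint
      last = trans (cong f last≡8) (at-last front-trail (≡-sym front-length))
      disjoint : ∀ {v} → v ∈ map f (x ∷ xs) × v ∈ back → ⊥
      disjoint (v∈ , v∈back) with i , i∈ , refl ← ∈-map⁻ f v∈ =
        ++≢ unique-ys (at-∈ (in-front (All.lookup bounded i∈))) v∈back refl
      open ≡-Reasoning
      lengths : suc (length (map f (x ∷ xs) ++ back)) ≡ length C
      lengths = begin
        suc (length (map f (x ∷ xs) ++ back)) ≡⟨ cong suc (length-++ (map f (x ∷ xs))) ⟩
        2 + length (map f xs) + length back   ≡⟨ cong (λ k → 2 + k + length back) (trans (length-map f xs) len) ⟩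
        9 + length back                       ≡⟨ cong (_+ length back) front-length ⟨
        length front + length back            ≡⟨ length-++ front ⟨
        length (front ++ back)                ≡⟨ cong length splits ⟨
        length ys                             ≡⟨ ↭-length p ⟩
        length C                              ∎

  shorten-to : ∀ {m} → 8 ≤ m → ∀ k {C} → Unique C → Closed C → length C ≡ k + m →
               ∃[ C′ ] (Unique C′ × Closed C′ × length C′ ≡ m)
  shorten-to 8≤m zero    u c eq = _ , u , c , eq
  shorten-to {m} 8≤m (suc k) {C} u c eq
    with C′ , u′ , c′ , eq′ ← shorten u c
           (subst (9 ≤_) (≡-sym eq) (s≤s (ℕ.≤-trans 8≤m (ℕ.m≤n+m m k)))) =
    shorten-to 8≤m k u′ c′ (ℕ.suc-injective (trans eq′ eq))

  -- Carries a checked tree over to the graph by reading the numbers as positions on the given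
  -- cycle. The chord of the resulting cycle runs from its position 0 to the position `k` of the
  -- leaf.
  realise : ∀ {K L E N u v xs} c → T (Check.check K (chorded K L) E N c) → 3 ≤ L →
            Trail u v xs → Unique xs → length xs ≡ K →
            All (λ (i , j) → at u xs i ~ at u xs j) E → All (λ (i , j) → ¬ at u xs i ~ at u xs j) N →
            ChordedCycle G L
  realise {K} {L} {u = u} {xs = ws} c ok 3≤L t unique refl AE AN
    with Check.Sound.check-sound K (chorded K L) G claw-free P₆-free (at u ws) (at-injective unique) AE AN c ok
  ... | k , x , xs , (uq , bounded , refl , 2≤k , k+1<L) , closing ∷ chord ∷ es =
    subst (ChordedCycle G) (length-map f (x ∷ xs)) (cycle , i , j , i≢j , ¬i→j , ¬j→i , i~j)
    where
    f : ℕ → Fin n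
    f = at u ws
    L≡ : length (map f (x ∷ xs)) ≡ length (x ∷ xs)
    L≡ = length-map f (x ∷ xs)
    cycle : Cycle G (length (map f (x ∷ xs)))
    cycle = to-cycle (Trail-map x xs es) closing (Unique-map (at-injective unique) bounded uq)
              (subst (3 ≤_) (≡-sym L≡) 3≤L)
    k<L : k < length (map f (x ∷ xs))
    k<L = subst (k <_) (≡-sym L≡) (ℕ.<-trans (ℕ.n<1+n k) k+1<L)
    i j : Fin (length (map f (x ∷ xs)))
    i = zero
    j = fromℕ< k<L
    j≡k : toℕ j ≡ k
    j≡k = Fin.toℕ-fromℕ< k<L
    i≢j : i ≢ j
    i≢j e = ℕ.<⇒≢ (ℕ.≤-trans (s≤s z≤n) 2≤k) (trans (cong toℕ e) j≡k)
    ¬i→j : ¬ CycNext (length (map f (x ∷ xs))) i j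
    ¬i→j (inj₁ e) = ℕ.<⇒≢ 2≤k (trans e j≡k)
    ¬i→j (inj₂ (_ , j≡0)) = i≢j (Fin.toℕ-injective (≡-sym j≡0))
    ¬j→i : ¬ CycNext (length (map f (x ∷ xs))) j i
    ¬j→i (inj₁ ())
    ¬j→i (inj₂ (e , _)) = ℕ.<⇒≢ k+1<L (trans (cong suc (≡-sym j≡k)) (trans e L≡))
    i~j : vert cycle i ~ vert cycle j
    i~j = subst (λ l → f x ~ at (f x) (map f (x ∷ xs)) l) (≡-sym j≡k)
            (subst (f x ~_) (≡-sym (at-map f x (x ∷ xs) k)) chord)

  cycle-edges-sound : ∀ {K u v xs} → Trail u v xs → v ~ u → length xs ≡ suc K →
                      All (λ (i , j) → at u xs i ~ at u xs j) (cycle-edges K)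
  cycle-edges-sound {K} {u} {xs = xs} t v~u len =
    subst₂ _~_ (≡-sym (at-last t (≡-sym len))) (≡-sym (at-first t)) v~u ∷
    All.applyUpTo⁺₁ (λ i → i , suc i) K (λ i<K → at-edge t (subst (_ <_) (≡-sym len) (s≤s i<K)))

  -- Two trees share the work: a chord at distance two met by the search is made the pair 0, 2 by
  -- rotation and added to the known edges; otherwise all inner pairs at distance two start out as
  -- known non-edges.
  certified : ∀ K {L} → 3 ≤ L → ∀ spanned free →
              T (Check.check (suc K) (chorded (suc K) L) ((0 , 2) ∷ cycle-edges K) [] spanned) →
              T (Check.check (suc K) (chorded (suc K) L) (cycle-edges K) (span-pairs K) free) →
              ∀ {C} → Unique C → Closed C → length C ≡ suc K → ChordedCycle G L
  certified K 3≤L spanned free ok-spanned ok-free {C} unique (u , v , (xs , p , t) , v~u) len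
    with find-span t ([] v~u)
  ... | inj₁ (span-cycle a~c t′ z~a cov) =
    realise spanned ok-spanned 3≤L t′ (Unique-resp-↭ (↭-sym cov′) unique) len′
      (a~c ∷ cycle-edges-sound t′ z~a len′) []
    where
    cov′ = ↭-trans (↭-trans cov (↭-reflexive (++-identityʳ xs))) p
    len′ = trans (↭-length cov′) len
  ... | inj₂ none =
    realise free ok-free 3≤L t (Unique-resp-↭ (↭-sym p) unique) len′ (cycle-edges-sound t v~u len′)
      (All.applyUpTo⁺₁ (λ i → i , 2 + i) (K ∸ 1) (λ i< → none (subst (_ <_) (≡-sym len′) (far i<))))
    where
    len′ = trans (↭-length p) len
    -- For `k = 0` the truncated difference is 0 and no `i` exists, so the successor case is the
    -- only one.
    far : ∀ {k i} → i < k ∸ 1 → 2 + i < suc k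
    far {suc k} i<k = s≤s (s≤s i<k)

  long : ∀ {C m} → Unique C → Closed C → length C ≡ m → 7 ≤ m → ChordedCycle G m
  long unique (u , v , (xs , p , t) , v~u) refl 7≤m
    with cycle ← to-cycle t v~u (Unique-resp-↭ (↭-sym p) unique)
           (subst (3 ≤_) (≡-sym (↭-length p)) (ℕ.≤-trans (s≤s (s≤s (s≤s z≤n))) 7≤m)) =
    subst (ChordedCycle G) (↭-length p)
      (cycle , long⇒chord P₆-free cycle (subst (7 ≤_) (≡-sym (↭-length p)) 7≤m))

  pancyclic : 13 ≤ n → ∀ {C} → Unique C → Closed C → length C ≡ n → ChordedPancyclic G
  pancyclic 13≤n {C} unique closed len m 4≤m m≤n = by-length m 4≤m m≤n
    where
    of-length : ∀ m → 8 ≤ m → m ≤ n → ∃[ C′ ] (Unique C′ × Closed C′ × length C′ ≡ m)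
    of-length m 8≤m m≤n = shorten-to 8≤m (n ∸ m) unique closed (trans len (≡-sym (ℕ.m∸n+n≡m m≤n)))
    from : ∀ k {m} → 8 ≤ k → k ≤ 13 →
           (∀ {C′} → Unique C′ → Closed C′ → length C′ ≡ k → ChordedCycle G m) → ChordedCycle G m
    from k 8≤k k≤13 h with _ , u , c , l ← of-length k 8≤k (ℕ.≤-trans k≤13 13≤n) = h u c l
    by-length : ∀ m → 4 ≤ m → m ≤ n → ChordedCycle G m
    by-length 0 ()
    by-length 1 (s≤s ())
    by-length 2 (s≤s (s≤s ()))
    by-length 3 (s≤s (s≤s (s≤s ())))
    -- The number after `certified` is the last index of the cycle that is searched, one less than
    -- its length. The two `tt` make the type checker evaluate both trees. Among the four short
    -- lengths, 6 uses the longest cycle and so accounts for the bound 13.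
    by-length 4 _ _ = from 10 (ℕ.m≤m+n 8 2) (ℕ.m≤m+n 10 3) (certified 9 (ℕ.m≤m+n 3 1) spanned-certificate-4 span-free-certificate-4 tt tt)
    by-length 5 _ _ = from 11 (ℕ.m≤m+n 8 3) (ℕ.m≤m+n 11 2) (certified 10 (ℕ.m≤m+n 3 2) spanned-certificate-5 span-free-certificate-5 tt tt)
    by-length 6 _ _ = from 13 (ℕ.m≤m+n 8 5) (ℕ.m≤m+n 13 0) (certified 12 (ℕ.m≤m+n 3 3) spanned-certificate-6 span-free-certificate-6 tt tt)
    by-length 7 _ _ = from 8 (ℕ.m≤m+n 8 0) (ℕ.m≤m+n 8 5) (certified 7 (ℕ.m≤m+n 3 4) spanned-certificate-7 span-free-certificate-7 tt tt)
    by-length m@(suc (suc (suc (suc (suc (suc (suc (suc k)))))))) _ m≤n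
      with _ , u , c , l ← of-length m (ℕ.m≤m+n 8 k) m≤n = long u c l (ℕ.m≤m+n 7 (suc k))

theorem10 : ∀ (n : ℕ) (G : Graph n) → 13 ≤ n → TwoConnected G →
            Free claw G × Free (pathGraph 6) G → ChordedPancyclic G
theorem10 n G 13≤n two-connected (claw-free , P₆-free)
  with C , unique , closed , len ← Hamiltonicity.spanning G claw-free P₆-free two-connected =
  Pancyclicity.pancyclic G claw-free P₆-free 13≤n unique closed len
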